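{- (a) Let $\mathbf{x}=(x_s)\in(\mathbb{C}^*)^{\mathbb{Z}^3}$ be a coherent solution of the Kashaev equation such that $x_vx_{v+e_i+e_j}+x_{v+e_i}x_{v+e_j}\neq0$ for all $v\in\mathbb{Z}^3$ and all distinct $i,j\in\{1,2,3\}$ (where $e_1,e_2,e_3$ are the standard basis vectors). Then $\mathbf{x}$ can be extended to an array $\tilde{\mathbf{x}}=(x_s)\in\mathbb{C}^L$ satisfying the K-hexahedron equations. (b) Conversely, if $\tilde{\mathbf{x}}=(x_s)\in\mathbb{C}^L$, with $x_s\neq0$ for all $s\in\mathbb{Z}^3$, satisfies the K-hexahedron equations, then the restriction of $\tilde{\mathbf{x}}$ to $\mathbb{Z}^3$ is a coherent solution of the Kashaev equation.
   Context: For a unit cube $C$ in $\mathbb{Z}^3$ and $\mathbf{x}\in\mathbb{C}^{\mathbb{Z}^3}$, label the values at the vertices of $C$ as $z_{ijk}$ ($i,j,k\in\{0,1\}$) via a cube isomorphism $C\cong\{0,1\}^3$; put $a=z_{000}z_{111}$, $b=z_{100}z_{011}$, $c=z_{010}z_{101}$, $d=z_{001}z_{110}$, $s=z_{000}z_{011}z_{101}z_{110}$, $t=z_{111}z_{100}z_{010}z_{001}$ and $K^C(\mathbf{x})=2(a^2+b^2+c^2+d^2)-(a+b+c+d)^2-4(s+t)$. For a vertex $v$ of $C$, choosing the labeling with $z_{000}=x_v$, set $K^C_v(\mathbf{x})=\tfrac12\big(z_{111}z_{000}^2-z_{000}(z_{100}z_{011}+z_{010}z_{101}+z_{001}z_{110})\big)-z_{100}z_{010}z_{001}$.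 An array $\mathbf{x}\in\mathbb{C}^{\mathbb{Z}^3}$ is a coherent solution of the Kashaev equation if $K^C(\mathbf{x})=0$ for every unit cube $C$ and, for every $v\in\mathbb{Z}^3$, $\prod_{C\ni v}K^C_v(\mathbf{x})=\prod_{S\ni v}(x_vx_{v_2}+x_{v_1}x_{v_3})$, the first product over the $8$ unit cubes containing $v$, the second over the $12$ unit squares $S$ containing $v$, with $v,v_1,v_2,v_3$ the vertices of $S$ in cyclic order. $L=\{(i,j,k)\in\mathbb{R}^3: 2i,2j,2k,i+j+k\in\mathbb{Z}\}=\mathbb{Z}^3+\{(0,0,0),(0,\tfrac12,\tfrac12),(\tfrac12,0,\tfrac12),(\tfrac12,\tfrac12,0)\}$, i.e. $\mathbb{Z}^3$ together with the centers of unit squares. An array $\tilde{\mathbf{x}}=(x_s)\in\mathbb{C}^L$ with $x_s\ne0$ for $s\in\mathbb{Z}^3$ satisfies the K-hexahedron equations if (i) for every $s\in L\setminus\mathbb{Z}^3$, $x_s^2=x_{v_1}x_{v_3}+x_{v_2}x_{v_4}$, where $v_1,v_2,v_3,v_4$ are the vertices, in cyclic order, of the unit square centered at $s$; and (ii) for every $v\in\mathbb{Z}^3$, writing $z_{ijk}=x_{v+(i,j,k)}$, $z_{1\frac12\frac12}=(z_{\frac120\frac12}z_{\frac12\frac120}+z_{0\frac12\frac12}z_{100})/z_{000}$, $z_{\frac121\frac12}=(z_{0\frac12\frac12}z_{\frac12\frac120}+z_{\frac120\frac12}z_{010})/z_{000}$, $z_{\frac12\frac121}=(z_{0\frac12\frac12}z_{\frac120\frac12}+z_{\frac12\frac120}z_{001})/z_{000}$,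 $z_{111}=(A+2z_{0\frac12\frac12}z_{\frac120\frac12}z_{\frac12\frac120})/z_{000}^2$, where $A=2z_{100}z_{010}z_{001}+z_{000}(z_{100}z_{011}+z_{010}z_{101}+z_{001}z_{110})$. -}

module Defs where

open import Data.Nat.Base using (ℕ)
import Data.Nat.Base as ℕ
import Data.Nat.Properties as ℕₚ
open import Data.Integer.Base using (ℤ; 0ℤ; _◃_)
import Data.Integer.Base as ℤ
open import Data.Rational.Base using (ℚ; 0ℚ; 1ℚ; ½)
import Data.Rational.Base as Q
import Data.Rational.Properties as ℚₚ
open import Data.Rational.Solver using (module +-*-Solver)
open import Data.Sign.Base using (Sign)
open import Data.Fin.Base using (Fin; toℕ)
open import Data.Fin.Patterns using (0F; 1F; 2F)
open import Data.List.Base using (List; []; _∷_; map; foldr; cartesianProduct)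
open import Data.Product.Base using (∃; _×_; _,_)
open import Data.Sum.Base using (inj₁; inj₂)
open import Data.Empty using (⊥-elim)
open import Function.Base using (_∘_)
open import Relation.Nullary using (¬_; yes; no)
open import Relation.Binary.PropositionalEquality using (_≡_; _≢_; refl; sym; trans; cong; cong₂; subst; subst₂)

module Sequences where
  open Q using (_+_; _*_; _-_; -_; ∣_∣; _<_; _≤_; positive; nonNegative; 1/_)
  open ℚₚ.≤-Reasoning

  Eventually : (ℕ → Set) → Set
  Eventually P = ∃ λ N → ∀ n → N ℕ.≤ n → P n

  Cauchy : (ℕ → ℚ) → Set
  Cauchy x = ∀ ε → 0ℚ < ε →
    ∃ λ N → ∀ m n → N ℕ.≤ m → N ℕ.≤ n → ∣ x m - x n ∣ < ε

  Null : (ℕ → ℚ) → Set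
  Null x = ∀ ε → 0ℚ < ε → Eventually (λ n → ∣ x n ∣ < ε)

  Apart : (ℕ → ℚ) → Set
  Apart x = ∃ λ δ → 0ℚ < δ × Eventually (λ n → δ ≤ ∣ x n ∣)

  ⊔ˡ : ∀ {M N n} → M ℕ.⊔ N ℕ.≤ n → M ℕ.≤ n
  ⊔ˡ {M} {N} p = ℕₚ.≤-trans (ℕₚ.m≤m⊔n M N) p

  ⊔ʳ : ∀ {M N n} → M ℕ.⊔ N ℕ.≤ n → N ℕ.≤ n
  ⊔ʳ {M} {N} p = ℕₚ.≤-trans (ℕₚ.m≤n⊔m M N) p

  *-pos : ∀ {p q} → 0ℚ < p → 0ℚ < q → 0ℚ < p * q
  *-pos {p} {q} 0<p 0<q = ℚₚ.positive⁻¹ (p * q)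
    {{ℚₚ.pos*pos⇒pos p {{positive 0<p}} q {{positive 0<q}}}}

  ½-pos : ∀ {ε} → 0ℚ < ε → 0ℚ < ½ * ε
  ½-pos = *-pos (ℚₚ.positive⁻¹ ½)

  *-mono-≤ : ∀ {p q r s} → 0ℚ ≤ p → 0ℚ ≤ s → p ≤ q → r ≤ s → p * r ≤ q * s
  *-mono-≤ {p} {q} {r} {s} 0≤p 0≤s p≤q r≤s = begin
    p * r  ≤⟨ ℚₚ.*-monoˡ-≤-nonNeg p {{nonNegative 0≤p}} r≤s ⟩
    p * s  ≤⟨ ℚₚ.*-monoʳ-≤-nonNeg s {{nonNegative 0≤s}} p≤q ⟩
    q * s  ∎

  ½+½ : ∀ ε → ½ * ε + ½ * ε ≡ ε
  ½+½ ε = trans (sym (ℚₚ.*-distribʳ-+ ε ½ ½)) (ℚₚ.*-identityˡ ε)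

  +-cancelʳ-≤ : ∀ r {p q} → p + r ≤ q + r → p ≤ q
  +-cancelʳ-≤ r {p} {q} h with p ℚₚ.≤? q
  ... | yes p≤q = p≤q
  ... | no  p≰q = ⊥-elim (ℚₚ.<-irrefl refl (ℚₚ.<-≤-trans (ℚₚ.+-monoˡ-< r (ℚₚ.≰⇒> p≰q)) h))

  ∣p∣*∣p∣≡p*p : ∀ p → ∣ p ∣ * ∣ p ∣ ≡ p * p
  ∣p∣*∣p∣≡p*p p with ℚₚ.∣p∣≡p∨∣p∣≡-p p
  ... | inj₁ e = cong₂ _*_ e e
  ... | inj₂ e = trans (cong₂ _*_ e e) (solve 1 (λ a → (:- a) :* (:- a) := a :* a) refl p)
    where open +-*-Solver

  -- the convention recip 0 = 0 only makes recip total
  recip : ℚ → ℚ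
  recip q with q ℚₚ.≟ 0ℚ
  ... | yes _   = 0ℚ
  ... | no q≢0 = (1/ q) {{Q.≢-nonZero q≢0}}

  recip-inverse : ∀ q → q ≢ 0ℚ → q * recip q ≡ 1ℚ
  recip-inverse q q≢0 with q ℚₚ.≟ 0ℚ
  ... | yes q≡0  = ⊥-elim (q≢0 q≡0)
  ... | no  q≢0′ = ℚₚ.*-inverseʳ q {{Q.≢-nonZero q≢0′}}

  pos⇒≢0 : ∀ {q} → 0ℚ < q → q ≢ 0ℚ
  pos⇒≢0 0<q q≡0 = ℚₚ.<-irrefl (sym q≡0) 0<q

  apart⇒≢0 : ∀ {δ q} → 0ℚ < δ → δ ≤ ∣ q ∣ → q ≢ 0ℚ
  apart⇒≢0 0<δ δ≤ refl = ℚₚ.<-irrefl refl (ℚₚ.<-≤-trans 0<δ δ≤)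

  recip-pos : ∀ {q} → 0ℚ < q → 0ℚ < recip q
  recip-pos {q} 0<q = ℚₚ.*-cancelˡ-<-nonNeg q {{nonNegative (ℚₚ.<⇒≤ 0<q)}}
    (subst₂ _<_ (sym (ℚₚ.*-zeroʳ q)) (sym (recip-inverse q (pos⇒≢0 0<q))) (ℚₚ.positive⁻¹ 1ℚ))

  recip-bound : ∀ {δ q} → 0ℚ < δ → δ ≤ ∣ q ∣ → ∣ recip q ∣ ≤ recip δ
  recip-bound {δ} {q} 0<δ δ≤ = ℚₚ.*-cancelˡ-≤-pos δ {{positive 0<δ}} (begin
    δ * ∣ recip q ∣      ≤⟨ ℚₚ.*-monoʳ-≤-nonNeg ∣ recip q ∣ {{ℚₚ.∣-∣-nonNeg (recip q)}} δ≤ ⟩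
    ∣ q ∣ * ∣ recip q ∣  ≡⟨ ℚₚ.∣p*q∣≡∣p∣*∣q∣ q (recip q) ⟨
    ∣ q * recip q ∣      ≡⟨ cong ∣_∣ (recip-inverse q (apart⇒≢0 0<δ δ≤)) ⟩
    1ℚ                   ≡⟨ recip-inverse δ (pos⇒≢0 0<δ) ⟨
    δ * recip δ          ∎)

  bound : ∀ {x} → Cauchy x → ∃ λ B → 0ℚ < B × Eventually (λ n → ∣ x n ∣ ≤ B)
  bound {x} cx with cx 1ℚ (ℚₚ.positive⁻¹ 1ℚ)
  ... | N , h = 1ℚ + ∣ x N ∣
              , ℚₚ.+-mono-<-≤ (ℚₚ.positive⁻¹ 1ℚ) (ℚₚ.0≤∣p∣ (x N))
              , N , λ n N≤n → begin
    ∣ x n ∣                    ≡⟨ cong ∣_∣ (solve 2 (λ a b → a := a :- b :+ b) refl (x n) (x N)) ⟩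
    ∣ x n - x N + x N ∣        ≤⟨ ℚₚ.∣p+q∣≤∣p∣+∣q∣ (x n - x N) (x N) ⟩
    ∣ x n - x N ∣ + ∣ x N ∣    ≤⟨ ℚₚ.+-monoˡ-≤ ∣ x N ∣ (ℚₚ.<⇒≤ (h n N N≤n ℕₚ.≤-refl)) ⟩
    1ℚ + ∣ x N ∣               ∎
    where open +-*-Solver

  const-cauchy : ∀ q → Cauchy (λ _ → q)
  const-cauchy q ε 0<ε = 0 , λ _ _ _ _ → subst (_< ε) (cong ∣_∣ (sym (ℚₚ.+-inverseʳ q))) 0<ε

  neg-cauchy : ∀ {x} → Cauchy x → Cauchy (λ n → - x n)
  neg-cauchy {x} cx ε 0<ε with cx ε 0<ε
  ... | N , h = N , λ m n N≤m N≤n → begin-strict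
    ∣ - x m - - x n ∣    ≡⟨ cong ∣_∣ (solve 2 (λ a b → :- a :- :- b := :- (a :- b)) refl (x m) (x n)) ⟩
    ∣ - (x m - x n) ∣    ≡⟨ ℚₚ.∣-p∣≡∣p∣ (x m - x n) ⟩
    ∣ x m - x n ∣        <⟨ h m n N≤m N≤n ⟩
    ε                    ∎
    where open +-*-Solver

  +-cauchy : ∀ {x y} → Cauchy x → Cauchy y → Cauchy (λ n → x n + y n)
  +-cauchy {x} {y} cx cy ε 0<ε with cx (½ * ε) (½-pos 0<ε) | cy (½ * ε) (½-pos 0<ε)
  ... | M , h | N , k = M ℕ.⊔ N , λ m n p q → begin-strict
    ∣ (x m + y m) - (x n + y n) ∣      ≡⟨ cong ∣_∣ (solve 4 (λ a b c d → (a :+ b) :- (c :+ d) := (a :- c) :+ (b :- d)) refl (x m) (y m) (x n) (y n)) ⟩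
    ∣ (x m - x n) + (y m - y n) ∣      ≤⟨ ℚₚ.∣p+q∣≤∣p∣+∣q∣ (x m - x n) (y m - y n) ⟩
    ∣ x m - x n ∣ + ∣ y m - y n ∣      <⟨ ℚₚ.+-mono-< (h m n (⊔ˡ {M} {N} p) (⊔ˡ {M} {N} q)) (k m n (⊔ʳ {M} {N} p) (⊔ʳ {M} {N} q)) ⟩
    ½ * ε + ½ * ε                      ≡⟨ ½+½ ε ⟩
    ε                                  ∎
    where open +-*-Solver

  scaled : ∀ {B p q η} → 0ℚ < B → ∣ p ∣ ≤ B → ∣ q ∣ < η * recip B → ∣ p * q ∣ < η
  scaled {B} {p} {q} {η} 0<B p≤B q< = begin-strict
    ∣ p * q ∣          ≡⟨ ℚₚ.∣p*q∣≡∣p∣*∣q∣ p q ⟩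
    ∣ p ∣ * ∣ q ∣      ≤⟨ ℚₚ.*-monoʳ-≤-nonNeg ∣ q ∣ {{ℚₚ.∣-∣-nonNeg q}} p≤B ⟩
    B * ∣ q ∣          <⟨ ℚₚ.*-monoʳ-<-pos B {{positive 0<B}} q< ⟩
    B * (η * recip B)  ≡⟨ solve 3 (λ a b c → a :* (b :* c) := b :* (a :* c)) refl B η (recip B) ⟩
    η * (B * recip B)  ≡⟨ cong (η *_) (recip-inverse B (pos⇒≢0 0<B)) ⟩
    η * 1ℚ             ≡⟨ ℚₚ.*-identityʳ η ⟩
    η                  ∎
    where open +-*-Solver

  *-diff : ∀ a b c d → a * b - c * d ≡ a * (b - d) + d * (a - c)
  *-diff = solve 4 (λ a b c d → a :* b :- c :* d := a :* (b :- d) :+ d :* (a :- c)) refl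
    where open +-*-Solver

  *-close : ∀ {A B a b c d ε} → 0ℚ < A → 0ℚ < B → ∣ a ∣ ≤ A → ∣ d ∣ ≤ B →
            ∣ b - d ∣ < ½ * ε * recip A → ∣ a - c ∣ < ½ * ε * recip B → ∣ a * b - c * d ∣ < ε
  *-close {A} {B} {a} {b} {c} {d} {ε} 0<A 0<B a≤A d≤B b-d a-c = begin-strict
    ∣ a * b - c * d ∣                  ≡⟨ cong ∣_∣ (*-diff a b c d) ⟩
    ∣ a * (b - d) + d * (a - c) ∣      ≤⟨ ℚₚ.∣p+q∣≤∣p∣+∣q∣ (a * (b - d)) (d * (a - c)) ⟩
    ∣ a * (b - d) ∣ + ∣ d * (a - c) ∣  <⟨ ℚₚ.+-mono-< (scaled {A} {a} {b - d} {½ * ε} 0<A a≤A b-d) (scaled {B} {d} {a - c} {½ * ε} 0<B d≤B a-c) ⟩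
    ½ * ε + ½ * ε                      ≡⟨ ½+½ ε ⟩
    ε                                  ∎

  *-cauchy : ∀ {x y} → Cauchy x → Cauchy y → Cauchy (λ n → x n * y n)
  *-cauchy {x} {y} cx cy ε 0<ε =
    let A , 0<A , M , a = bound cx
        B , 0<B , N , b = bound cy
        P , h = cx (½ * ε * recip B) (*-pos (½-pos 0<ε) (recip-pos 0<B))
        R , k = cy (½ * ε * recip A) (*-pos (½-pos 0<ε) (recip-pos 0<A))
    in (M ℕ.⊔ N) ℕ.⊔ (P ℕ.⊔ R) , λ m n p q →
      *-close {A} {B} {x m} {y m} {x n} {y n} {ε} 0<A 0<B
        (a m (⊔ˡ {M} {N} (⊔ˡ {M ℕ.⊔ N} {P ℕ.⊔ R} p)))
        (b n (⊔ʳ {M} {N} (⊔ˡ {M ℕ.⊔ N} {P ℕ.⊔ R} q)))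
        (k m n (⊔ʳ {P} {R} (⊔ʳ {M ℕ.⊔ N} {P ℕ.⊔ R} p)) (⊔ʳ {P} {R} (⊔ʳ {M ℕ.⊔ N} {P ℕ.⊔ R} q)))
        (h m n (⊔ˡ {P} {R} (⊔ʳ {M ℕ.⊔ N} {P ℕ.⊔ R} p)) (⊔ˡ {P} {R} (⊔ʳ {M ℕ.⊔ N} {P ℕ.⊔ R} q)))

  recip-cauchy : ∀ {x} → Cauchy x → Apart x → Cauchy (recip ∘ x)
  recip-cauchy {x} cx (δ , 0<δ , M , a) ε 0<ε with cx (ε * (δ * δ)) (*-pos 0<ε (*-pos 0<δ 0<δ))
  ... | N , h = M ℕ.⊔ N , λ m n p q →
    let am = a m (⊔ˡ {M} {N} p) ; an = a n (⊔ˡ {M} {N} q)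
        rm = recip (x m) ; rn = recip (x n) ; R = recip δ * recip δ
    in begin-strict
    ∣ rm - rn ∣                                ≡⟨ cong ∣_∣ (diff (x m) (x n) (apart⇒≢0 0<δ am) (apart⇒≢0 0<δ an)) ⟩
    ∣ - (rm * rn * (x m - x n)) ∣              ≡⟨ ℚₚ.∣-p∣≡∣p∣ (rm * rn * (x m - x n)) ⟩
    ∣ rm * rn * (x m - x n) ∣                  ≡⟨ ℚₚ.∣p*q∣≡∣p∣*∣q∣ (rm * rn) (x m - x n) ⟩
    ∣ rm * rn ∣ * ∣ x m - x n ∣                ≡⟨ cong (_* ∣ x m - x n ∣) (ℚₚ.∣p*q∣≡∣p∣*∣q∣ rm rn) ⟩
    ∣ rm ∣ * ∣ rn ∣ * ∣ x m - x n ∣            ≤⟨ ℚₚ.*-monoʳ-≤-nonNeg ∣ x m - x n ∣ {{ℚₚ.∣-∣-nonNeg (x m - x n)}}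
                                                  (*-mono-≤ (ℚₚ.0≤∣p∣ rm) (ℚₚ.<⇒≤ (recip-pos 0<δ)) (recip-bound 0<δ am) (recip-bound 0<δ an)) ⟩
    R * ∣ x m - x n ∣                          <⟨ ℚₚ.*-monoʳ-<-pos R {{positive (*-pos (recip-pos 0<δ) (recip-pos 0<δ))}} (h m n (⊔ʳ {M} {N} p) (⊔ʳ {M} {N} q)) ⟩
    R * (ε * (δ * δ))                          ≡⟨ solve 3 (λ r e d → r :* r :* (e :* (d :* d)) := e :* ((d :* r) :* (d :* r))) refl (recip δ) ε δ ⟩
    ε * ((δ * recip δ) * (δ * recip δ))        ≡⟨ cong (λ u → ε * (u * u)) (recip-inverse δ (pos⇒≢0 0<δ)) ⟩
    ε * 1ℚ                                     ≡⟨ ℚₚ.*-identityʳ ε ⟩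
    ε                                          ∎
    where
    open +-*-Solver
    diff : ∀ a b → a ≢ 0ℚ → b ≢ 0ℚ → recip a - recip b ≡ - (recip a * recip b * (a - b))
    diff a b a≢0 b≢0 = begin-equality
      recip a - recip b                                      ≡⟨ cong₂ _-_ (ℚₚ.*-identityʳ (recip a)) (ℚₚ.*-identityʳ (recip b)) ⟨
      recip a * 1ℚ - recip b * 1ℚ                            ≡⟨ cong₂ (λ u w → recip a * u - recip b * w) (recip-inverse b b≢0) (recip-inverse a a≢0) ⟨
      recip a * (b * recip b) - recip b * (a * recip a)      ≡⟨ solve 4 (λ a b r s → r :* (b :* s) :- s :* (a :* r) := :- (r :* s :* (a :- b))) refl a b (recip a) (recip b) ⟩
      - (recip a * recip b * (a - b))                        ∎

  apart-* : ∀ {x y} → Apart x → Apart y → Apart (λ n → x n * y n)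
  apart-* {x} {y} (δ , 0<δ , M , h) (η , 0<η , N , k) =
    δ * η , *-pos 0<δ 0<η , M ℕ.⊔ N , λ n p → begin
      δ * η              ≤⟨ *-mono-≤ (ℚₚ.<⇒≤ 0<δ) (ℚₚ.0≤∣p∣ (y n)) (h n (⊔ˡ {M} {N} p)) (k n (⊔ʳ {M} {N} p)) ⟩
      ∣ x n ∣ * ∣ y n ∣  ≡⟨ ℚₚ.∣p*q∣≡∣p∣*∣q∣ (x n) (y n) ⟨
      ∣ x n * y n ∣      ∎

  apart-cong : ∀ {x y} → (∀ n → x n ≡ y n) → Apart x → Apart y
  apart-cong e (δ , 0<δ , N , h) = δ , 0<δ , N , λ n p → subst (λ u → δ ≤ ∣ u ∣) (e n) (h n p)

  apart⇒¬null : ∀ {x} → Apart x → ¬ Null x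
  apart⇒¬null (δ , 0<δ , M , h) null with null δ 0<δ
  ... | N , k = ℚₚ.<-irrefl refl (ℚₚ.≤-<-trans (h (M ℕ.⊔ N) (ℕₚ.m≤m⊔n M N)) (k (M ℕ.⊔ N) (ℕₚ.m≤n⊔m M N)))

  ¬apart⇒null : ∀ {x} → Cauchy x → ¬ Apart x → Null x
  ¬apart⇒null {x} cx ¬ap ε 0<ε with cx (½ * ε) (½-pos 0<ε)
  ... | N , h = N , go
    where
    open +-*-Solver
    go : ∀ n → N ℕ.≤ n → ∣ x n ∣ < ε
    go n N≤n with ∣ x n ∣ ℚₚ.<? ε
    ... | yes p = p
    ... | no ¬p = ⊥-elim (¬ap (½ * ε , ½-pos 0<ε , N , λ m N≤m →
          let c = ∣ x m ∣ in
          +-cancelʳ-≤ (½ * ε) (begin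
            ½ * ε + ½ * ε              ≡⟨ ½+½ ε ⟩
            ε                          ≤⟨ ℚₚ.≮⇒≥ ¬p ⟩
            ∣ x n ∣                    ≡⟨ cong ∣_∣ (solve 2 (λ a b → a := b :+ (a :- b)) refl (x n) (x m)) ⟩
            ∣ x m + (x n - x m) ∣      ≤⟨ ℚₚ.∣p+q∣≤∣p∣+∣q∣ (x m) (x n - x m) ⟩
            c + ∣ x n - x m ∣          ≤⟨ ℚₚ.+-monoʳ-≤ c (ℚₚ.<⇒≤ (h n m N≤n N≤m)) ⟩
            c + ½ * ε                  ∎)))

  null-+ : ∀ {x y} → Null x → Null y → Null (λ n → x n + y n)
  null-+ {x} {y} nx ny ε 0<ε with nx (½ * ε) (½-pos 0<ε) | ny (½ * ε) (½-pos 0<ε)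
  ... | M , h | N , k = M ℕ.⊔ N , λ n p → begin-strict
    ∣ x n + y n ∣      ≤⟨ ℚₚ.∣p+q∣≤∣p∣+∣q∣ (x n) (y n) ⟩
    ∣ x n ∣ + ∣ y n ∣  <⟨ ℚₚ.+-mono-< (h n (⊔ˡ {M} {N} p)) (k n (⊔ʳ {M} {N} p)) ⟩
    ½ * ε + ½ * ε      ≡⟨ ½+½ ε ⟩
    ε                  ∎

  null-* : ∀ {x y} → Cauchy x → Null y → Null (λ n → x n * y n)
  null-* {x} {y} cx ny ε 0<ε =
    let B , 0<B , M , h = bound cx
        N , k = ny (ε * recip B) (*-pos 0<ε (recip-pos 0<B))
    in M ℕ.⊔ N , λ n p →
      scaled {B} {x n} {y n} {ε} 0<B (h n (⊔ˡ {M} {N} p)) (k n (⊔ʳ {M} {N} p))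

  0≤p*p : ∀ p → 0ℚ ≤ p * p
  0≤p*p p = begin
    0ℚ             ≡⟨ ℚₚ.*-zeroʳ ∣ p ∣ ⟨
    ∣ p ∣ * 0ℚ     ≤⟨ ℚₚ.*-monoˡ-≤-nonNeg ∣ p ∣ {{ℚₚ.∣-∣-nonNeg p}} (ℚₚ.0≤∣p∣ p) ⟩
    ∣ p ∣ * ∣ p ∣  ≡⟨ ∣p∣*∣p∣≡p*p p ⟩
    p * p          ∎

  null-√ : ∀ {x y} → (∀ n → x n * x n ≤ y n) → Null y → Null x
  null-√ {x} {y} x²≤y ny ε 0<ε with ny (ε * ε) (*-pos 0<ε 0<ε)
  ... | N , h = N , go
    where
    go : ∀ n → N ℕ.≤ n → ∣ x n ∣ < ε
    go n N≤n with ∣ x n ∣ ℚₚ.<? ε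
    ... | yes p = p
    ... | no ¬p = ⊥-elim (ℚₚ.<-irrefl refl (begin-strict
      ε * ε              ≤⟨ *-mono-≤ (ℚₚ.<⇒≤ 0<ε) (ℚₚ.0≤∣p∣ (x n)) (ℚₚ.≮⇒≥ ¬p) (ℚₚ.≮⇒≥ ¬p) ⟩
      ∣ x n ∣ * ∣ x n ∣  ≡⟨ ∣p∣*∣p∣≡p*p (x n) ⟩
      x n * x n          ≤⟨ x²≤y n ⟩
      y n                ≡⟨ ℚₚ.0≤p⇒∣p∣≡p (ℚₚ.≤-trans (0≤p*p (x n)) (x²≤y n)) ⟨
      ∣ y n ∣            <⟨ h n N≤n ⟩
      ε * ε              ∎))

open Sequences public using (Eventually; Cauchy; Null; Apart)

-- Real numbers: Cauchy sequences of rationals modulo null sequences.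
record ℝ : Set where
  constructor mkℝ
  field
    seq    : ℕ → ℚ
    cauchy : Cauchy seq

open ℝ public

infix  4 _≈ᴿ_
infixl 6 _+ᴿ_
infixl 7 _*ᴿ_
infix  8 -ᴿ_

_≈ᴿ_ : ℝ → ℝ → Set
x ≈ᴿ y = Null (λ n → seq x n Q.- seq y n)

-- The constructive reading of x ≠ 0.
_#ᴿ0 : ℝ → Set
x #ᴿ0 = Apart (seq x)

fromℚ : ℚ → ℝ
fromℚ q = mkℝ (λ _ → q) (Sequences.const-cauchy q)

_+ᴿ_ : ℝ → ℝ → ℝ
x +ᴿ y = mkℝ (λ n → seq x n Q.+ seq y n) (Sequences.+-cauchy {seq x} {seq y} (cauchy x) (cauchy y))

_*ᴿ_ : ℝ → ℝ → ℝ
x *ᴿ y = mkℝ (λ n → seq x n Q.* seq y n) (Sequences.*-cauchy {seq x} {seq y} (cauchy x) (cauchy y))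

-ᴿ_ : ℝ → ℝ
-ᴿ x = mkℝ (λ n → Q.- seq x n) (Sequences.neg-cauchy {seq x} (cauchy x))

invᴿ : (x : ℝ) → x #ᴿ0 → ℝ
invᴿ x x#0 = mkℝ (λ n → Sequences.recip (seq x n)) (Sequences.recip-cauchy {seq x} (cauchy x) x#0)

record ℂ : Set where
  constructor _+i_
  field
    re im : ℝ

open ℂ public

infix  4 _≈_ _#0
infixl 6 _+_ _-_
infixl 7 _*_

record _≈_ (z w : ℂ) : Set where
  constructor mk≈
  field
    re≈ : re z ≈ᴿ re w
    im≈ : im z ≈ᴿ im w

ofℚ : ℚ → ℂ
ofℚ q = fromℚ q +i fromℚ 0ℚ

0ℂ 1ℂ 2ℂ 4ℂ ½ℂ : ℂ
0ℂ = ofℚ 0ℚ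
1ℂ = ofℚ 1ℚ
2ℂ = ofℚ (1ℚ Q.+ 1ℚ)
4ℂ = ofℚ (1ℚ Q.+ 1ℚ Q.+ 1ℚ Q.+ 1ℚ)
½ℂ = ofℚ ½

-- The arithmetic is opaque only to keep the type checker from unfolding it
-- down to sequences of rationals.
opaque
  _+_ _-_ _*_ : ℂ → ℂ → ℂ
  z + w = (re z +ᴿ re w) +i (im z +ᴿ im w)
  z - w = (re z +ᴿ -ᴿ re w) +i (im z +ᴿ -ᴿ im w)
  z * w = (re z *ᴿ re w +ᴿ -ᴿ (im z *ᴿ im w)) +i (re z *ᴿ im w +ᴿ im z *ᴿ re w)

normSq : ℂ → ℝ
normSq z = re z *ᴿ re z +ᴿ im z *ᴿ im z

-- The constructive reading of z ≠ 0 (|z|² is bounded away from 0).  By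
-- #0⇒≉0 and ¬#0⇒≈0 below, it is classically equivalent to ¬ (z ≈ 0ℂ).
_#0 : ℂ → Set
z #0 = normSq z #ᴿ0

opaque
  inv : (z : ℂ) → z #0 → ℂ
  inv z z#0 = (re z *ᴿ invᴿ (normSq z) z#0) +i (-ᴿ im z *ᴿ invᴿ (normSq z) z#0)

infixl 7 _/_[_]
_/_[_] : ℂ → (w : ℂ) → w #0 → ℂ
z / w [ w#0 ] = z * inv w w#0

#0⇒≉0 : ∀ {z} → z #0 → ¬ (z ≈ 0ℂ)
#0⇒≉0 {z} z#0 (mk≈ re≈0 im≈0) = Sequences.apart⇒¬null {seq (normSq z)} z#0
  (Sequences.null-+ {seq (re z *ᴿ re z)} {seq (im z *ᴿ im z)}
    (Sequences.null-* {seq (re z)} {seq (re z)} (cauchy (re z)) (drop {seq (re z)} re≈0))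
    (Sequences.null-* {seq (im z)} {seq (im z)} (cauchy (im z)) (drop {seq (im z)} im≈0)))
  where
  drop : ∀ {x} → Null (λ n → x n Q.- 0ℚ) → Null x
  drop {x} h ε 0<ε with h ε 0<ε
  ... | N , k = N , λ n p → subst (λ u → Q.∣ u ∣ Q.< ε) (ℚₚ.+-identityʳ (x n)) (k n p)

¬#0⇒≈0 : ∀ {z} → ¬ (z #0) → z ≈ 0ℂ
¬#0⇒≈0 {z} ¬z#0 = mk≈
  (add {seq (re z)} (Sequences.null-√ {seq (re z)} {seq (normSq z)} (λ n → ℚₚ.≤-trans (ℚₚ.≤-reflexive (sym (ℚₚ.+-identityʳ (seq (re z) n Q.* seq (re z) n))))
                                   (ℚₚ.+-monoʳ-≤ (seq (re z) n Q.* seq (re z) n) (Sequences.0≤p*p (seq (im z) n)))) null))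
  (add {seq (im z)} (Sequences.null-√ {seq (im z)} {seq (normSq z)} (λ n → ℚₚ.≤-trans (ℚₚ.≤-reflexive (sym (ℚₚ.+-identityˡ (seq (im z) n Q.* seq (im z) n))))
                                   (ℚₚ.+-monoˡ-≤ (seq (im z) n Q.* seq (im z) n) (Sequences.0≤p*p (seq (re z) n)))) null))
  where
  null : Null (seq (normSq z))
  null = Sequences.¬apart⇒null {seq (normSq z)} (cauchy (normSq z)) ¬z#0
  add : ∀ {x} → Null x → Null (λ n → x n Q.- 0ℚ)
  add {x} h ε 0<ε with h ε 0<ε
  ... | N , k = N , λ n p → subst (λ u → Q.∣ u ∣ Q.< ε) (sym (ℚₚ.+-identityʳ (x n))) (k n p)

opaque
  unfolding _*_

  #0-* : ∀ {z w} → z #0 → w #0 → (z * w) #0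
  #0-* {z} {w} z#0 w#0 = Sequences.apart-cong {λ n → seq (normSq z) n Q.* seq (normSq w) n} {seq (normSq (z * w))}
    (λ n → solve 4 (λ a b c d → (a :* a :+ b :* b) :* (c :* c :+ d :* d)
                       := (a :* c :+ :- (b :* d)) :* (a :* c :+ :- (b :* d)) :+ (a :* d :+ b :* c) :* (a :* d :+ b :* c))
             refl (seq (re z) n) (seq (im z) n) (seq (re w) n) (seq (im w) n))
    (Sequences.apart-* {seq (normSq z)} {seq (normSq w)} z#0 w#0)
    where open +-*-Solver

∏ : {A : Set} → List A → (A → ℂ) → ℂ
∏ as f = foldr _*_ 1ℂ (map f as)

ℤ³ : Set
ℤ³ = ℤ × ℤ × ℤ

infixl 6 _⊕_
_⊕_ : ℤ³ → ℤ³ → ℤ³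
(a , b , c) ⊕ (a′ , b′ , c′) = a ℤ.+ a′ , b ℤ.+ b′ , c ℤ.+ c′

±e : Sign → Fin 3 → ℤ³
±e σ 0F = σ ◃ 1 , 0ℤ , 0ℤ
±e σ 1F = 0ℤ , σ ◃ 1 , 0ℤ
±e σ 2F = 0ℤ , 0ℤ , σ ◃ 1

e : Fin 3 → ℤ³
e = ±e Sign.+

data Plane : Set where
  yz xz xy : Plane

axis₁ axis₂ : Plane → Fin 3
axis₁ yz = 1F
axis₁ xz = 0F
axis₁ xy = 0F
axis₂ yz = 2F
axis₂ xz = 2F
axis₂ xy = 1F

planes : List Plane
planes = yz ∷ xz ∷ xy ∷ []

signs : List Sign
signs = Sign.+ ∷ Sign.- ∷ []

-- The unit squares containing a vertex v correspond to (P , σ , τ): in the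
-- plane P, the vertices in cyclic order are v, v ± e i, v ± e i ± e j, v ± e j.
squaresAt : List (Plane × Sign × Sign)
squaresAt = cartesianProduct planes (cartesianProduct signs signs)

-- The unit cubes containing a vertex v correspond to (σ₁ , σ₂ , σ₃): the
-- opposite vertex is v + (σ₁ 1 , σ₂ 1 , σ₃ 1).
Octant : Set
Octant = Sign × Sign × Sign

cubesAt : List Octant
cubesAt = cartesianProduct signs (cartesianProduct signs signs)

+++ : Octant
+++ = Sign.+ , Sign.+ , Sign.+

-- z i j k, the labelling with z 0 0 0 = x v of the vertices of the unit cube
-- at v in the octant σ
label : (ℤ³ → ℂ) → ℤ³ → Octant → Fin 2 → Fin 2 → Fin 2 → ℂ
label x v (σ₁ , σ₂ , σ₃) i j k = x (v ⊕ (σ₁ ◃ toℕ i , σ₂ ◃ toℕ j , σ₃ ◃ toℕ k))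

-- K^C is invariant under all cube isomorphisms, and K^C_v under those fixing
-- v, so one labelling for each C, respectively for each (C , v), suffices: a
-- unit cube C is given by its lowest vertex v, and a pair (C , v) by v and the
-- octant at v that contains C.
KC : (ℤ³ → ℂ) → ℤ³ → ℂ
KC x v = 2ℂ * (a * a + b * b + c * c + d * d)
       - (a + b + c + d) * (a + b + c + d)
       - 4ℂ * (s + t)
  where
  z = label x v +++
  a = z 0F 0F 0F * z 1F 1F 1F
  b = z 1F 0F 0F * z 0F 1F 1F
  c = z 0F 1F 0F * z 1F 0F 1F
  d = z 0F 0F 1F * z 1F 1F 0F
  s = z 0F 0F 0F * z 0F 1F 1F * z 1F 0F 1F * z 1F 1F 0F
  t = z 1F 1F 1F * z 1F 0F 0F * z 0F 1F 0F * z 0F 0F 1F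

KCv : (ℤ³ → ℂ) → ℤ³ → Octant → ℂ
KCv x v σ =
    ½ℂ * (z 1F 1F 1F * (z 0F 0F 0F * z 0F 0F 0F)
          - z 0F 0F 0F * (z 1F 0F 0F * z 0F 1F 1F + z 0F 1F 0F * z 1F 0F 1F + z 0F 0F 1F * z 1F 1F 0F))
  - z 1F 0F 0F * z 0F 1F 0F * z 0F 0F 1F
  where
  z = label x v σ

squareTerm : (ℤ³ → ℂ) → ℤ³ → Plane × Sign × Sign → ℂ
squareTerm x v (P , σ , τ) = x v * x (v ⊕ ±e σ i ⊕ ±e τ j) + x (v ⊕ ±e σ i) * x (v ⊕ ±e τ j)
  where
  i = axis₁ P
  j = axis₂ P

record IsCoherentSolution (x : ℤ³ → ℂ) : Set where
  field
    kashaev   : ∀ v → KC x v ≈ 0ℂ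
    coherence : ∀ v → ∏ cubesAt (KCv x v) ≈ ∏ squaresAt (squareTerm x v)

-- center v P is the center v + ½ (e i + e j) of the unit square with lowest
-- vertex v in the plane P with axes i and j.
data L : Set where
  vertex : ℤ³ → L
  center : ℤ³ → Plane → L

record IsKHexahedron (x : L → ℂ) (x#0 : ∀ v → x (vertex v) #0) : Set where
  z : ℤ³ → Fin 2 → Fin 2 → Fin 2 → ℂ
  z v = label (x ∘ vertex) v +++

  z½ : ℤ³ → Plane → ℂ
  z½ v P = x (center v P)

  A : ℤ³ → ℂ
  A v = 2ℂ * (z v 1F 0F 0F * z v 0F 1F 0F * z v 0F 0F 1F)
      + x (vertex v) * (z v 1F 0F 0F * z v 0F 1F 1F + z v 0F 1F 0F * z v 1F 0F 1F + z v 0F 0F 1F * z v 1F 1F 0F)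

  field
    square : ∀ v P → x (center v P) * x (center v P)
      ≈ x (vertex v) * x (vertex (v ⊕ e (axis₁ P) ⊕ e (axis₂ P)))
      + x (vertex (v ⊕ e (axis₁ P))) * x (vertex (v ⊕ e (axis₂ P)))
    opposite-yz : ∀ v → z½ (v ⊕ e 0F) yz
      ≈ (z½ v xz * z½ v xy + z½ v yz * z v 1F 0F 0F) / x (vertex v) [ x#0 v ]
    opposite-xz : ∀ v → z½ (v ⊕ e 1F) xz
      ≈ (z½ v yz * z½ v xy + z½ v xz * z v 0F 1F 0F) / x (vertex v) [ x#0 v ]
    opposite-xy : ∀ v → z½ (v ⊕ e 2F) xy
      ≈ (z½ v yz * z½ v xz + z½ v xy * z v 0F 0F 1F) / x (vertex v) [ x#0 v ]
    opposite-vertex : ∀ v → z v 1F 1F 1F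
      ≈ (A v + 2ℂ * (z½ v yz * z½ v xz * z½ v xy)) / x (vertex v) * x (vertex v) [ #0-* {x (vertex v)} {x (vertex v)} (x#0 v) (x#0 v) ]

{-# OPTIONS --safe #-}
module Submission where

-- Choose a square root of the square term of every unit square.  The Kashaev
-- equation for a cube C says that K^C_v is, up to sign, the product of the
-- roots on the three faces of C at v, and the K-hexahedron equations for C
-- amount to prescribing these signs: + at 000 and 111, − at the other corners.
-- Part (b) follows because the signs at the eight cubes around a vertex cancel
-- and each square at that vertex lies in two of these cubes.
--
-- For (a), the signs in one cube always differ from the prescribed ones by an
-- affine function c₀ + c₁ w₁ + c₂ w₂ + c₃ w₃ of the corner w ∈ 𝔽₂³, because
-- four corners can be corrected by changing roots, and then the other four are
-- right as well.  Changing the roots consistently on all of ℤ³ requires an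
-- 𝔽₂-valued function g on the squares with g₁ + g₂ + g₃ = c₀ whose difference
-- in direction i is cᵢ; the obstruction to its existence is a third mixed
-- difference, and coherence says that this vanishes.

open import Algebra.Bundles using (CommutativeRing)
import Algebra.Properties.AbelianGroup
import Algebra.Solver.Ring as RingSolver
open import Algebra.Solver.Ring.AlmostCommutativeRing using (AlmostCommutativeRing; fromCommutativeRing; _-Raw-AlmostCommutative⟶_)
open import Algebra.Structures using (IsCommutativeRing)
open import Data.Bool.Base using (Bool; true; false; _xor_; _∧_)
import Data.Bool.Properties as 𝔹ₚ
open import Data.Bool.Solver using (module xor-∧-Solver)
open import Data.Empty using (⊥-elim)
open import Data.Fin.Base using (Fin; toℕ)
open import Data.Fin.Patterns using (0F; 1F; 2F)
open import Data.Integer.Base using (ℤ; 0ℤ; 1ℤ; -1ℤ; _◃_)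
import Data.Integer.Base as ℤ
import Data.Integer.Properties as ℤₚ
open import Data.List.Base using (List; []; _∷_; map; foldr)
open import Data.Maybe.Base as Maybe using (Maybe)
open import Data.Nat.Base using (ℕ; zero; suc)
import Data.Nat.Base as ℕ
import Data.Nat.Properties as ℕₚ
open import Data.Product.Base using (Σ; _×_; _,_; ∃; proj₁; proj₂)
open import Data.Rational.Base using (ℚ; 0ℚ; 1ℚ; ½; mkℚ)
import Data.Rational.Base as Q
import Data.Rational.Properties as ℚₚ
import Data.Rational.Solver
open import Data.Rational.Unnormalised.Base using (mkℚᵘ)
import Data.Rational.Unnormalised.Base as ℚᵘ
import Data.Rational.Unnormalised.Properties as ℚᵘₚ
open import Data.Sign.Base using (Sign)
open import Data.Sum.Base using (_⊎_; inj₁; inj₂; [_,_]′; reduce) renaming (map to map⊎)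
open import Function.Base using (_∘_)
open import Level using (0ℓ)
open import Relation.Binary.PropositionalEquality using (_≡_; _≢_; refl; sym; trans; cong; cong₂; subst; subst₂)
open import Relation.Nullary using (yes; no)
open import Relation.Nullary.Decidable using (dec⇒maybe; from-yes)

-- The corners of a cube are linked by one polynomial identity, `K-edge`: for an edge, the values of
-- K at its two ends, each weighted by the vertex value at the other end, add up to minus the
-- product of the square terms of the two faces through the edge. It turns correct signs at two
-- adjacent corners into the linear equation for a face value, and back. Reflecting the cube then
-- carries a solution to the remaining corners, which is why four corners decide all eight.
--
-- Equality of complex numbers is undecidable here, so signs cannot be found by testing.
-- Non-vanishing means apartness from 0: if z² = w² with w² apart from 0, comparing rational
-- approximations decides between z = w and z = -w, and so a sign becomes an actual `Bool`. The
-- hypothesis of (a) supplies this apartness for every square term. In (b) square terms may vanish,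
-- so that direction only multiplies by roots and cancels nothing but vertex values.

module ℚSolver = Data.Rational.Solver.+-*-Solver

-- Square roots by bisection: rationals, then absolute values of reals

module RationalSqrt where
  open import Defs using (Cauchy; Null; ℝ; mkℝ; seq; cauchy; module Sequences)
  open Q using (_+_; _*_; _-_; -_; ∣_∣; _<_; _≤_)
  open ℚSolver

  +-nonNeg : ∀ {p q} → 0ℚ ≤ p → 0ℚ ≤ q → 0ℚ ≤ p + q
  +-nonNeg = ℚₚ.+-mono-≤

  *-nonNeg : ∀ {p q} → 0ℚ ≤ p → 0ℚ ≤ q → 0ℚ ≤ p * q
  *-nonNeg {p} {q} 0≤p 0≤q = subst (_≤ p * q) (ℚₚ.*-zeroʳ p) (ℚₚ.*-monoˡ-≤-nonNeg p {{Q.nonNegative 0≤p}} 0≤q)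

  ≤-by : ∀ {p q} d → 0ℚ ≤ d → p + d ≡ q → p ≤ q
  ≤-by {p} {q} d 0≤d eq = subst₂ _≤_ (ℚₚ.+-identityʳ p) eq (ℚₚ.+-monoʳ-≤ p 0≤d)

  ≤⇒0≤- : ∀ {p q} → p ≤ q → 0ℚ ≤ q - p
  ≤⇒0≤- {p} {q} p≤q = subst (_≤ q - p) (ℚₚ.+-inverseʳ p) (ℚₚ.+-monoˡ-≤ (- p) p≤q)

  ∣∣-≤ : ∀ {p c} → p ≤ c → - p ≤ c → ∣ p ∣ ≤ c
  ∣∣-≤ {p} p≤c -p≤c with ℚₚ.∣p∣≡p∨∣p∣≡-p p
  ... | inj₁ eq = subst (_≤ _) (sym eq) p≤c
  ... | inj₂ eq = subst (_≤ _) (sym eq) -p≤c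

  ∣-∣-sym : ∀ p q → ∣ p - q ∣ ≡ ∣ q - p ∣
  ∣-∣-sym p q = trans (cong ∣_∣ (solve 2 (λ p q → p :- q := :- (q :- p)) refl p q)) (ℚₚ.∣-p∣≡∣p∣ (q - p))

  p≤q+∣p-q∣ : ∀ p q → p ≤ q + ∣ p - q ∣
  p≤q+∣p-q∣ p q with ℚₚ.∣p∣≡p∨∣p∣≡-p (p - q)
  ... | inj₁ eq = ℚₚ.≤-reflexive (trans (solve 2 (λ p q → p := q :+ (p :- q)) refl p q) (cong (q +_) (sym eq)))
  ... | inj₂ eq = ≤-by (∣ p - q ∣ + ∣ p - q ∣) (+-nonNeg (ℚₚ.0≤∣p∣ (p - q)) (ℚₚ.0≤∣p∣ (p - q)))
    (trans (cong (λ u → p + (u + ∣ p - q ∣)) eq) (solve 3 (λ p q u → p :+ (:- (p :- q) :+ u) := q :+ u) refl p q ∣ p - q ∣))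

  close⇒≤ : ∀ {p q η} → ∣ p - q ∣ < η → η + η ≤ p → η ≤ q
  close⇒≤ {p} {q} {η} close η+η≤p = Sequences.+-cancelʳ-≤ η
    (ℚₚ.≤-trans η+η≤p (ℚₚ.≤-trans (p≤q+∣p-q∣ p q) (ℚₚ.+-monoʳ-≤ q (ℚₚ.<⇒≤ close))))

  ∣∣p∣-∣q∣∣≤∣p-q∣ : ∀ p q → ∣ ∣ p ∣ - ∣ q ∣ ∣ ≤ ∣ p - q ∣
  ∣∣p∣-∣q∣∣≤∣p-q∣ p q = ∣∣-≤ (half p q)
    (subst₂ _≤_ (solve 2 (λ a b → b :- a := :- (a :- b)) refl ∣ p ∣ ∣ q ∣) (∣-∣-sym q p) (half q p))
    where
    half : ∀ p q → ∣ p ∣ - ∣ q ∣ ≤ ∣ p - q ∣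
    half p q = Sequences.+-cancelʳ-≤ ∣ q ∣ (subst (_≤ ∣ p - q ∣ + ∣ q ∣)
      (trans (cong ∣_∣ (solve 2 (λ p q → p :- q :+ q := p) refl p q)) (solve 2 (λ a b → a := a :- b :+ b) refl ∣ p ∣ ∣ q ∣))
      (ℚₚ.∣p+q∣≤∣p∣+∣q∣ (p - q) q))

  natℚ : ℕ → ℚ
  natℚ zero    = 0ℚ
  natℚ (suc n) = 1ℚ + natℚ n

  natℚ-nonNeg : ∀ n → 0ℚ ≤ natℚ n
  natℚ-nonNeg zero    = ℚₚ.≤-refl
  natℚ-nonNeg (suc n) = +-nonNeg (ℚₚ.nonNegative⁻¹ 1ℚ) (natℚ-nonNeg n)

  natℚ-mono : ∀ {m n} → m ℕ.≤ n → natℚ m ≤ natℚ n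
  natℚ-mono {n = n} ℕ.z≤n = natℚ-nonNeg n
  natℚ-mono (ℕ.s≤s m≤n)   = ℚₚ.+-monoʳ-≤ 1ℚ (natℚ-mono m≤n)

  toℚᵘ-natℚ : ∀ n → Q.toℚᵘ (natℚ n) ℚᵘ.≃ mkℚᵘ (ℤ.+ n) 0
  toℚᵘ-natℚ zero    = ℚᵘₚ.≃-refl
  toℚᵘ-natℚ (suc n) = ℚᵘₚ.≃-trans (ℚₚ.toℚᵘ-homo-+ 1ℚ (natℚ n))
    (ℚᵘₚ.≃-trans (ℚᵘₚ.+-congʳ (Q.toℚᵘ 1ℚ) (toℚᵘ-natℚ n)) (ℚᵘ.*≡* (cong (ℤ._* ℤ.+ 1) (cong (λ u → ℤ.+ 1 ℤ.+ u) (ℤₚ.*-identityʳ (ℤ.+ n))))))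

  -- The absolute value of the numerator works, since the denominator is at least 1; in unnormalised
  -- form this is an inequality of integers.
  archimedean : ∀ q → ∃ λ n → q ≤ natℚ n
  archimedean q@(mkℚ p d c) = ℤ.∣ p ∣ , ℚₚ.toℚᵘ-cancel-≤ (ℚᵘₚ.≤-respʳ-≃ (ℚᵘₚ.≃-sym (toℚᵘ-natℚ ℤ.∣ p ∣))
    (ℚᵘ.*≤* (ℤₚ.≤-trans (ℤₚ.≤-reflexive (ℤₚ.*-identityʳ p)) (numerator≤ p))))
    where
    numerator≤ : ∀ p → p ℤ.≤ ℤ.+ ℤ.∣ p ∣ ℤ.* ℤ.+ suc d
    numerator≤ (ℤ.+ n)      = subst (ℤ.+ n ℤ.≤_) (ℤₚ.pos-* n (suc d)) (ℤ.+≤+ (ℕₚ.m≤m*n n (suc d)))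
    numerator≤ ℤ.-[1+ n ] = ℤ.-≤+

  halfⁿ : ℕ → ℚ
  halfⁿ zero    = 1ℚ
  halfⁿ (suc n) = ½ * halfⁿ n

  halfⁿ-nonNeg : ∀ n → 0ℚ ≤ halfⁿ n
  halfⁿ-nonNeg zero    = ℚₚ.nonNegative⁻¹ 1ℚ
  halfⁿ-nonNeg (suc n) = *-nonNeg (ℚₚ.nonNegative⁻¹ ½) (halfⁿ-nonNeg n)

  -- This is n + 1 ≤ 2ⁿ in a division-free form. With `archimedean` it forces `halfⁿ` below any ε:
  -- otherwise (n + 1) ε ≤ 1 for some n ≥ 1/ε.
  halfⁿ-bound : ∀ n → natℚ (suc n) * halfⁿ n ≤ 1ℚ
  halfⁿ-bound zero    = ℚₚ.≤-refl
  halfⁿ-bound (suc n) = ℚₚ.≤-trans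
    (≤-by (½ * (natℚ n * halfⁿ n)) (*-nonNeg (ℚₚ.nonNegative⁻¹ ½) (*-nonNeg (natℚ-nonNeg n) (halfⁿ-nonNeg n)))
      (solve 2 (λ n h → (con 1ℚ :+ (con 1ℚ :+ n)) :* (con ½ :* h) :+ con ½ :* (n :* h) := (con 1ℚ :+ n) :* h) refl (natℚ n) (halfⁿ n)))
    (halfⁿ-bound n)

  null-halfⁿ : Null halfⁿ
  null-halfⁿ ε 0<ε with archimedean (Sequences.recip ε)
  ... | N , rε≤N = N , λ n N≤n → go n N≤n
    where
    go : ∀ n → N ℕ.≤ n → ∣ halfⁿ n ∣ < ε
    go n N≤n with ∣ halfⁿ n ∣ ℚₚ.<? ε
    ... | yes p = p
    ... | no ¬p = ⊥-elim (ℚₚ.<-irrefl refl (ℚₚ.<-≤-trans 1<εn+ε (ℚₚ.≤-trans εn≤ (halfⁿ-bound n))))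
      where
      ε≤h : ε ≤ halfⁿ n
      ε≤h = subst (ε ≤_) (ℚₚ.0≤p⇒∣p∣≡p (halfⁿ-nonNeg n)) (ℚₚ.≮⇒≥ ¬p)
      εn≤ : natℚ (suc n) * ε ≤ natℚ (suc n) * halfⁿ n
      εn≤ = ℚₚ.*-monoˡ-≤-nonNeg (natℚ (suc n)) {{Q.nonNegative (natℚ-nonNeg (suc n))}} ε≤h
      1≤εn : 1ℚ ≤ ε * natℚ n
      1≤εn = subst (_≤ ε * natℚ n) (Sequences.recip-inverse ε (Sequences.pos⇒≢0 0<ε))
        (ℚₚ.*-monoˡ-≤-nonNeg ε {{Q.nonNegative (ℚₚ.<⇒≤ 0<ε)}} (ℚₚ.≤-trans rε≤N (natℚ-mono N≤n)))
      1<εn+ε : 1ℚ < natℚ (suc n) * ε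
      1<εn+ε = subst₂ _<_ (ℚₚ.+-identityʳ 1ℚ)
        (solve 2 (λ e n → e :* n :+ e := (con 1ℚ :+ n) :* e) refl ε (natℚ n)) (ℚₚ.+-mono-≤-< 1≤εn 0<ε)

  width : ℕ → ℚ → ℚ
  width n q = (1ℚ + q) * halfⁿ n

  -- n bisection steps for the square root of q, starting from [0 , 1 + q];
  -- the value is the lower end of the resulting interval of length width n q.
  bisect : ℕ → ℚ → ℚ
  bisect zero    q = 0ℚ
  bisect (suc n) q with (bisect n q + width (suc n) q) * (bisect n q + width (suc n) q) ℚₚ.≤? q
  ... | yes _ = bisect n q + width (suc n) q
  ... | no  _ = bisect n q

  -- The last field keeps the whole interval below 1 + q, which makes the error bound in
  -- `bisect-error` linear in the width.
  record Bracket (q s w : ℚ) : Set where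
    field
      s≥0   : 0ℚ ≤ s
      s²≤q  : s * s ≤ q
      q≤s+w : q ≤ (s + w) * (s + w)
      s+w≤  : s + w ≤ 1ℚ + q

  width-nonNeg : ∀ n {q} → 0ℚ ≤ q → 0ℚ ≤ width n q
  width-nonNeg n 0≤q = *-nonNeg (+-nonNeg (ℚₚ.nonNegative⁻¹ 1ℚ) 0≤q) (halfⁿ-nonNeg n)

  bisect-bracket : ∀ n {q} → 0ℚ ≤ q → Bracket q (bisect n q) (width n q)
  bisect-bracket zero {q} 0≤q = record
    { s≥0   = ℚₚ.≤-refl
    ; s²≤q  = 0≤q
    ; q≤s+w = ≤-by (1ℚ + q + q * q) (+-nonNeg (+-nonNeg (ℚₚ.nonNegative⁻¹ 1ℚ) 0≤q) (*-nonNeg 0≤q 0≤q))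
        (solve 1 (λ q → q :+ (con 1ℚ :+ q :+ q :* q)
          := (con 0ℚ :+ (con 1ℚ :+ q) :* con 1ℚ) :* (con 0ℚ :+ (con 1ℚ :+ q) :* con 1ℚ)) refl q)
    ; s+w≤  = ℚₚ.≤-reflexive (solve 1 (λ q → con 0ℚ :+ (con 1ℚ :+ q) :* con 1ℚ := con 1ℚ :+ q) refl q)
    }
  bisect-bracket (suc n) {q} 0≤q
    with (bisect n q + width (suc n) q) * (bisect n q + width (suc n) q) ℚₚ.≤? q | bisect-bracket n 0≤q
  ... | yes p | b = record
    { s≥0   = +-nonNeg s≥0 (width-nonNeg (suc n) 0≤q)
    ; s²≤q  = p
    ; q≤s+w = subst (λ u → q ≤ u * u) (sym twice) q≤s+w
    ; s+w≤  = subst (_≤ 1ℚ + q) (sym twice) s+w≤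
    }
    where
    open Bracket b
    twice : bisect n q + width (suc n) q + width (suc n) q ≡ bisect n q + width n q
    twice = solve 3 (λ s q h → s :+ (con 1ℚ :+ q) :* (con ½ :* h) :+ (con 1ℚ :+ q) :* (con ½ :* h)
      := s :+ (con 1ℚ :+ q) :* h) refl (bisect n q) q (halfⁿ n)
  ... | no ¬p | b = record
    { s≥0   = s≥0
    ; s²≤q  = s²≤q
    ; q≤s+w = ℚₚ.<⇒≤ (ℚₚ.≰⇒> ¬p)
    ; s+w≤  = ℚₚ.≤-trans (≤-by (width (suc n) q) (width-nonNeg (suc n) 0≤q)
        (solve 3 (λ s q h → s :+ (con 1ℚ :+ q) :* (con ½ :* h) :+ (con 1ℚ :+ q) :* (con ½ :* h)
          := s :+ (con 1ℚ :+ q) :* h) refl (bisect n q) q (halfⁿ n))) s+w≤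
    }
    where open Bracket b

  -- Both q and s² lie between s² and (s + w)², so the error is at most w (s + (s + w)) ≤ 2 (1 + q)
  -- w.
  bisect-error : ∀ n {q} → 0ℚ ≤ q →
    ∣ bisect n q * bisect n q - q ∣ ≤ (1ℚ + q) * (1ℚ + q) * (1ℚ + 1ℚ) * halfⁿ n
  bisect-error n {q} 0≤q = ∣∣-≤
    (ℚₚ.≤-trans
      (≤-by (q - s * s) (≤⇒0≤- s²≤q) (solve 2 (λ t q → t :- q :+ (q :- t) := con 0ℚ) refl (s * s) q))
      (*-nonNeg (*-nonNeg (*-nonNeg 0≤1+q 0≤1+q) (ℚₚ.nonNegative⁻¹ (1ℚ + 1ℚ))) (halfⁿ-nonNeg n)))
    (≤-by ((s + w) * (s + w) - q + (w * (1ℚ + q - (s + w) + (1ℚ + q - s))))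
      (+-nonNeg (≤⇒0≤- q≤s+w) (*-nonNeg 0≤w (+-nonNeg (≤⇒0≤- s+w≤)
        (≤⇒0≤- (ℚₚ.≤-trans (≤-by w 0≤w refl) s+w≤)))))
      (solve 3 (λ s q h → let w = (con 1ℚ :+ q) :* h in
         :- (s :* s :- q) :+ ((s :+ w) :* (s :+ w) :- q :+ (w :* (con 1ℚ :+ q :- (s :+ w) :+ (con 1ℚ :+ q :- s))))
         := (con 1ℚ :+ q) :* (con 1ℚ :+ q) :* (con (1ℚ + 1ℚ)) :* h) refl s q (halfⁿ n)))
    where
    open Bracket (bisect-bracket n 0≤q)
    s = bisect n q
    w = width n q
    0≤w = width-nonNeg n 0≤q
    0≤1+q = +-nonNeg (ℚₚ.nonNegative⁻¹ 1ℚ) 0≤q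

  null-≤ : ∀ {x y} → (∀ n → ∣ x n ∣ ≤ y n) → Null y → Null x
  null-≤ {x} {y} x≤y ny ε 0<ε with ny ε 0<ε
  ... | N , h = N , λ n N≤n → ℚₚ.≤-<-trans (x≤y n)
    (subst (_< ε) (ℚₚ.0≤p⇒∣p∣≡p (ℚₚ.≤-trans (ℚₚ.0≤∣p∣ (x n)) (x≤y n))) (h n N≤n))

  abs-cauchy : ∀ {x} → Cauchy x → Cauchy (λ n → ∣ x n ∣)
  abs-cauchy {x} cx ε 0<ε with cx ε 0<ε
  ... | N , h = N , λ m n N≤m N≤n → ℚₚ.≤-<-trans (∣∣p∣-∣q∣∣≤∣p-q∣ (x m) (x n)) (h m n N≤m N≤n)

  cauchy-near : ∀ {x y} → Cauchy y → Null (λ n → x n - y n) → Cauchy x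
  cauchy-near {x} {y} cy near ε 0<ε with cy (½ * ε) (Sequences.½-pos 0<ε) | near (½ * (½ * ε)) (Sequences.½-pos (Sequences.½-pos 0<ε))
  ... | M , h | N , k = M ℕ.⊔ N , λ m n p q → begin-strict
    ∣ x m - x n ∣
      ≡⟨ cong ∣_∣ (solve 4 (λ a b c d → a :- b := (c :- d) :+ ((a :- c) :+ (:- (b :- d)))) refl (x m) (x n) (y m) (y n)) ⟩
    ∣ (y m - y n) + ((x m - y m) + (- (x n - y n))) ∣
      ≤⟨ ℚₚ.∣p+q∣≤∣p∣+∣q∣ (y m - y n) _ ⟩
    ∣ y m - y n ∣ + ∣ (x m - y m) + (- (x n - y n)) ∣
      ≤⟨ ℚₚ.+-monoʳ-≤ ∣ y m - y n ∣ (ℚₚ.∣p-q∣≤∣p∣+∣q∣ (x m - y m) (x n - y n)) ⟩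
    ∣ y m - y n ∣ + (∣ x m - y m ∣ + ∣ x n - y n ∣)
      <⟨ ℚₚ.+-mono-< (h m n (Sequences.⊔ˡ {M} {N} p) (Sequences.⊔ˡ {M} {N} q))
           (ℚₚ.+-mono-< (k m (Sequences.⊔ʳ {M} {N} p)) (k n (Sequences.⊔ʳ {M} {N} q))) ⟩
    ½ * ε + (½ * (½ * ε) + ½ * (½ * ε))
      ≡⟨ cong (_+_ (½ * ε)) (Sequences.½+½ (½ * ε)) ⟩
    ½ * ε + ½ * ε
      ≡⟨ Sequences.½+½ ε ⟩
    ε ∎
    where open ℚₚ.≤-Reasoning

  -- Since |p - q| ≤ p + q for non-negative p and q. Hence the square root is uniformly continuous
  -- even near 0, with modulus ε², which is what `cauchy-√` exploits.
  ∣p-q∣²≤∣p²-q²∣ : ∀ {p q} → 0ℚ ≤ p → 0ℚ ≤ q → ∣ p - q ∣ * ∣ p - q ∣ ≤ ∣ p * p - q * q ∣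
  ∣p-q∣²≤∣p²-q²∣ {p} {q} 0≤p 0≤q = begin
    ∣ p - q ∣ * ∣ p - q ∣  ≤⟨ ℚₚ.*-monoˡ-≤-nonNeg ∣ p - q ∣ {{ℚₚ.∣-∣-nonNeg (p - q)}} (ℚₚ.∣p-q∣≤∣p∣+∣q∣ p q) ⟩
    ∣ p - q ∣ * (∣ p ∣ + ∣ q ∣)  ≡⟨ cong (∣ p - q ∣ *_) (cong₂ _+_ (ℚₚ.0≤p⇒∣p∣≡p 0≤p) (ℚₚ.0≤p⇒∣p∣≡p 0≤q)) ⟩
    ∣ p - q ∣ * (p + q)  ≡⟨ cong (∣ p - q ∣ *_) (ℚₚ.0≤p⇒∣p∣≡p (+-nonNeg 0≤p 0≤q)) ⟨
    ∣ p - q ∣ * ∣ p + q ∣  ≡⟨ ℚₚ.∣p*q∣≡∣p∣*∣q∣ (p - q) (p + q) ⟨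
    ∣ (p - q) * (p + q) ∣  ≡⟨ cong ∣_∣ (solve 2 (λ p q → (p :- q) :* (p :+ q) := p :* p :- q :* q) refl p q) ⟩
    ∣ p * p - q * q ∣  ∎
    where open ℚₚ.≤-Reasoning

  cauchy-√ : ∀ {x} → (∀ n → 0ℚ ≤ x n) → Cauchy (λ n → x n * x n) → Cauchy x
  cauchy-√ {x} 0≤x cx ε 0<ε with cx (ε * ε) (Sequences.*-pos 0<ε 0<ε)
  ... | N , h = N , go
    where
    go : ∀ m n → N ℕ.≤ m → N ℕ.≤ n → ∣ x m - x n ∣ < ε
    go m n N≤m N≤n with ∣ x m - x n ∣ ℚₚ.<? ε
    ... | yes p = p
    ... | no ¬p = ⊥-elim (ℚₚ.<-irrefl refl (ℚₚ.≤-<-trans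
      (ℚₚ.≤-trans (Sequences.*-mono-≤ (ℚₚ.<⇒≤ 0<ε) (ℚₚ.0≤∣p∣ (x m - x n)) (ℚₚ.≮⇒≥ ¬p) (ℚₚ.≮⇒≥ ¬p))
        (∣p-q∣²≤∣p²-q²∣ (0≤x m) (0≤x n)))
      (h m n N≤m N≤n)))

  module _ (x : ℝ) where
    -- A diagonal sequence: the n-th term gets n bisection steps, so precision grows with the index.
    -- The absolute value is there because a non-negative real may be represented by a sequence with
    -- negative terms.
    approx : ℕ → ℚ
    approx n = bisect n ∣ seq x n ∣

    approx-null : Null (λ n → approx n * approx n - ∣ seq x n ∣)
    approx-null = null-≤ (λ n → bisect-error n (ℚₚ.0≤∣p∣ (seq x n)))
      (Sequences.null-* {λ n → (1ℚ + ∣ seq x n ∣) * (1ℚ + ∣ seq x n ∣) * (1ℚ + 1ℚ)} {halfⁿ}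
        (Sequences.*-cauchy {λ n → (1ℚ + ∣ seq x n ∣) * (1ℚ + ∣ seq x n ∣)} {λ _ → 1ℚ + 1ℚ}
          (Sequences.*-cauchy {λ n → 1ℚ + ∣ seq x n ∣} {λ n → 1ℚ + ∣ seq x n ∣} 1+∣x∣ 1+∣x∣)
          (Sequences.const-cauchy (1ℚ + 1ℚ)))
        null-halfⁿ)
      where
      1+∣x∣ : Cauchy (λ n → 1ℚ + ∣ seq x n ∣)
      1+∣x∣ = Sequences.+-cauchy {λ _ → 1ℚ} {λ n → ∣ seq x n ∣} (Sequences.const-cauchy 1ℚ) (abs-cauchy {seq x} (cauchy x))

    approx-nonNeg : ∀ n → 0ℚ ≤ approx n
    approx-nonNeg n = Bracket.s≥0 (bisect-bracket n (ℚₚ.0≤∣p∣ (seq x n)))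

    sqrtAbs : ℝ
    sqrtAbs = mkℝ approx (cauchy-√ approx-nonNeg
      (cauchy-near {λ n → approx n * approx n} {λ n → ∣ seq x n ∣} (abs-cauchy {seq x} (cauchy x)) approx-null))

open import Defs
open RationalSqrt using (+-nonNeg; ≤-by; close⇒≤; sqrtAbs; approx; approx-null; approx-nonNeg)

-- The complex numbers as a commutative ring

null-eventually : ∀ {x y} → Eventually (λ n → x n ≡ y n) → Null y → Null x
null-eventually (M , e) ny ε 0<ε with ny ε 0<ε
... | N , h = M ℕ.⊔ N , λ n p →
  subst (λ u → Q.∣ u ∣ Q.< ε) (sym (e n (Sequences.⊔ˡ {M} {N} p))) (h n (Sequences.⊔ʳ {M} {N} p))

null-cong : ∀ {x y} → (∀ n → x n ≡ y n) → Null y → Null x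
null-cong {x} {y} e = null-eventually {x} {y} (0 , λ n _ → e n)

null-0 : Null (λ _ → 0ℚ)
null-0 ε 0<ε = 0 , λ _ _ → 0<ε

≡⇒≈ᴿ : ∀ {x y} → (∀ n → seq x n ≡ seq y n) → x ≈ᴿ y
≡⇒≈ᴿ {x} {y} e = null-cong {λ n → seq x n Q.- seq y n} {λ _ → 0ℚ}
  (λ n → trans (cong (Q._- seq y n) (e n)) (ℚₚ.+-inverseʳ (seq y n))) null-0

≈ᴿ-refl : ∀ {x} → x ≈ᴿ x
≈ᴿ-refl {x} = ≡⇒≈ᴿ {x} {x} (λ _ → refl)

≈ᴿ-sym : ∀ {x y} → x ≈ᴿ y → y ≈ᴿ x
≈ᴿ-sym {x} {y} x≈y = null-cong {λ n → seq y n Q.- seq x n} {λ n → Q.- 1ℚ Q.* (seq x n Q.- seq y n)}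
  (λ n → solve 2 (λ a b → b :- a := con (Q.- 1ℚ) :* (a :- b)) refl (seq x n) (seq y n))
  (Sequences.null-* {λ _ → Q.- 1ℚ} {λ n → seq x n Q.- seq y n} (Sequences.const-cauchy (Q.- 1ℚ)) x≈y)
  where open ℚSolver

≈ᴿ-trans : ∀ {x y z} → x ≈ᴿ y → y ≈ᴿ z → x ≈ᴿ z
≈ᴿ-trans {x} {y} {z} x≈y y≈z = null-cong {λ n → seq x n Q.- seq z n} {λ n → (seq x n Q.- seq y n) Q.+ (seq y n Q.- seq z n)}
  (λ n → solve 3 (λ a b c → a :- c := (a :- b) :+ (b :- c)) refl (seq x n) (seq y n) (seq z n))
  (Sequences.null-+ {λ n → seq x n Q.- seq y n} {λ n → seq y n Q.- seq z n} x≈y y≈z)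
  where open ℚSolver

+ᴿ-cong : ∀ {x x′ y y′} → x ≈ᴿ x′ → y ≈ᴿ y′ → x +ᴿ y ≈ᴿ x′ +ᴿ y′
+ᴿ-cong {x} {x′} {y} {y′} p q = null-cong {λ n → (seq x n Q.+ seq y n) Q.- (seq x′ n Q.+ seq y′ n)}
  {λ n → (seq x n Q.- seq x′ n) Q.+ (seq y n Q.- seq y′ n)}
  (λ n → solve 4 (λ a b c d → (a :+ b) :- (c :+ d) := (a :- c) :+ (b :- d)) refl (seq x n) (seq y n) (seq x′ n) (seq y′ n))
  (Sequences.null-+ {λ n → seq x n Q.- seq x′ n} {λ n → seq y n Q.- seq y′ n} p q)
  where open ℚSolver

*ᴿ-cong : ∀ {x x′ y y′} → x ≈ᴿ x′ → y ≈ᴿ y′ → x *ᴿ y ≈ᴿ x′ *ᴿ y′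
*ᴿ-cong {x} {x′} {y} {y′} p q = null-cong {λ n → (seq x n Q.* seq y n) Q.- (seq x′ n Q.* seq y′ n)}
  {λ n → seq x n Q.* (seq y n Q.- seq y′ n) Q.+ seq y′ n Q.* (seq x n Q.- seq x′ n)}
  (λ n → Sequences.*-diff (seq x n) (seq y n) (seq x′ n) (seq y′ n))
  (Sequences.null-+ {λ n → seq x n Q.* (seq y n Q.- seq y′ n)} {λ n → seq y′ n Q.* (seq x n Q.- seq x′ n)}
    (Sequences.null-* {seq x} {λ n → seq y n Q.- seq y′ n} (cauchy x) q)
    (Sequences.null-* {seq y′} {λ n → seq x n Q.- seq x′ n} (cauchy y′) p))

-ᴿ-cong : ∀ {x x′} → x ≈ᴿ x′ → -ᴿ x ≈ᴿ -ᴿ x′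
-ᴿ-cong {x} {x′} p = null-cong {λ n → Q.- seq x n Q.- Q.- seq x′ n} {λ n → seq x′ n Q.- seq x n}
  (λ n → solve 2 (λ a b → :- a :- :- b := b :- a) refl (seq x n) (seq x′ n)) (≈ᴿ-sym {x} {x′} p)
  where open ℚSolver

infix 8 -ᶜ_

opaque
  unfolding _*_

  -ᶜ_ : ℂ → ℂ
  -ᶜ z = (-ᴿ re z) +i (-ᴿ im z)

≈-refl : ∀ {z} → z ≈ z
≈-refl {z} = mk≈ (≈ᴿ-refl {re z}) (≈ᴿ-refl {im z})

≈-sym : ∀ {z w} → z ≈ w → w ≈ z
≈-sym {z} {w} (mk≈ p q) = mk≈ (≈ᴿ-sym {re z} {re w} p) (≈ᴿ-sym {im z} {im w} q)

≈-trans : ∀ {z w u} → z ≈ w → w ≈ u → z ≈ u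
≈-trans {z} {w} {u} (mk≈ p q) (mk≈ p′ q′) =
  mk≈ (≈ᴿ-trans {re z} {re w} {re u} p p′) (≈ᴿ-trans {im z} {im w} {im u} q q′)

≡⇒≈ : ∀ {z w} → (∀ n → seq (re z) n ≡ seq (re w) n) → (∀ n → seq (im z) n ≡ seq (im w) n) → z ≈ w
≡⇒≈ {z} {w} p q = mk≈ (≡⇒≈ᴿ {re z} {re w} p) (≡⇒≈ᴿ {im z} {im w} q)

module _ where
  open ℚSolver

  opaque
    unfolding _*_ -ᶜ_

    +-cong : ∀ {z z′ w w′} → z ≈ z′ → w ≈ w′ → z + w ≈ z′ + w′
    +-cong {z} {z′} {w} {w′} (mk≈ p q) (mk≈ p′ q′) =
      mk≈ (+ᴿ-cong {re z} {re z′} {re w} {re w′} p p′) (+ᴿ-cong {im z} {im z′} {im w} {im w′} q q′)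

    -ᶜ-cong : ∀ {z z′} → z ≈ z′ → -ᶜ z ≈ -ᶜ z′
    -ᶜ-cong {z} {z′} (mk≈ p q) = mk≈ (-ᴿ-cong {re z} {re z′} p) (-ᴿ-cong {im z} {im z′} q)

    *-cong : ∀ {z z′ w w′} → z ≈ z′ → w ≈ w′ → z * w ≈ z′ * w′
    *-cong {z} {z′} {w} {w′} (mk≈ p q) (mk≈ p′ q′) = mk≈
      (+ᴿ-cong {re z *ᴿ re w} {re z′ *ᴿ re w′} { -ᴿ (im z *ᴿ im w)} { -ᴿ (im z′ *ᴿ im w′)}
        (*ᴿ-cong {re z} {re z′} {re w} {re w′} p p′)
        (-ᴿ-cong {im z *ᴿ im w} {im z′ *ᴿ im w′} (*ᴿ-cong {im z} {im z′} {im w} {im w′} q q′)))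
      (+ᴿ-cong {re z *ᴿ im w} {re z′ *ᴿ im w′} {im z *ᴿ re w} {im z′ *ᴿ re w′}
        (*ᴿ-cong {re z} {re z′} {im w} {im w′} p q′)
        (*ᴿ-cong {im z} {im z′} {re w} {re w′} q p′))

    sub≈ : ∀ z w → z - w ≈ z + -ᶜ w
    sub≈ z w = ≡⇒≈ (λ _ → refl) (λ _ → refl)

    +-assoc : ∀ z w u → z + w + u ≈ z + (w + u)
    +-assoc z w u = ≡⇒≈ (λ n → ℚₚ.+-assoc (seq (re z) n) (seq (re w) n) (seq (re u) n))
                        (λ n → ℚₚ.+-assoc (seq (im z) n) (seq (im w) n) (seq (im u) n))

    +-comm : ∀ z w → z + w ≈ w + z
    +-comm z w = ≡⇒≈ (λ n → ℚₚ.+-comm (seq (re z) n) (seq (re w) n)) (λ n → ℚₚ.+-comm (seq (im z) n) (seq (im w) n))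

    +-identityˡ : ∀ z → 0ℂ + z ≈ z
    +-identityˡ z = ≡⇒≈ (λ n → ℚₚ.+-identityˡ (seq (re z) n)) (λ n → ℚₚ.+-identityˡ (seq (im z) n))

    +-identityʳ : ∀ z → z + 0ℂ ≈ z
    +-identityʳ z = ≡⇒≈ (λ n → ℚₚ.+-identityʳ (seq (re z) n)) (λ n → ℚₚ.+-identityʳ (seq (im z) n))

    -ᶜ-inverseˡ : ∀ z → -ᶜ z + z ≈ 0ℂ
    -ᶜ-inverseˡ z = ≡⇒≈ (λ n → ℚₚ.+-inverseˡ (seq (re z) n)) (λ n → ℚₚ.+-inverseˡ (seq (im z) n))

    -ᶜ-inverseʳ : ∀ z → z + -ᶜ z ≈ 0ℂ
    -ᶜ-inverseʳ z = ≡⇒≈ (λ n → ℚₚ.+-inverseʳ (seq (re z) n)) (λ n → ℚₚ.+-inverseʳ (seq (im z) n))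

    *-assoc : ∀ z w u → z * w * u ≈ z * (w * u)
    *-assoc z w u = ≡⇒≈
      (λ n → solve 6 (λ a b c d e f → (a :* c :+ :- (b :* d)) :* e :+ :- ((a :* d :+ b :* c) :* f)
                       := a :* (c :* e :+ :- (d :* f)) :+ :- (b :* (c :* f :+ d :* e))) refl
               (seq (re z) n) (seq (im z) n) (seq (re w) n) (seq (im w) n) (seq (re u) n) (seq (im u) n))
      (λ n → solve 6 (λ a b c d e f → (a :* c :+ :- (b :* d)) :* f :+ (a :* d :+ b :* c) :* e
                       := a :* (c :* f :+ d :* e) :+ b :* (c :* e :+ :- (d :* f))) refl
               (seq (re z) n) (seq (im z) n) (seq (re w) n) (seq (im w) n) (seq (re u) n) (seq (im u) n))

    *-comm : ∀ z w → z * w ≈ w * z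
    *-comm z w = ≡⇒≈
      (λ n → solve 4 (λ a b c d → a :* c :+ :- (b :* d) := c :* a :+ :- (d :* b)) refl
               (seq (re z) n) (seq (im z) n) (seq (re w) n) (seq (im w) n))
      (λ n → solve 4 (λ a b c d → a :* d :+ b :* c := c :* b :+ d :* a) refl
               (seq (re z) n) (seq (im z) n) (seq (re w) n) (seq (im w) n))

    *-identityˡ : ∀ z → 1ℂ * z ≈ z
    *-identityˡ z = ≡⇒≈
      (λ n → solve 2 (λ a b → con 1ℚ :* a :+ :- (con 0ℚ :* b) := a) refl (seq (re z) n) (seq (im z) n))
      (λ n → solve 2 (λ a b → con 1ℚ :* b :+ con 0ℚ :* a := b) refl (seq (re z) n) (seq (im z) n))

    *-distribʳ-+ : ∀ z w u → (w + u) * z ≈ w * z + u * z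
    *-distribʳ-+ z w u = ≡⇒≈
      (λ n → solve 6 (λ a b c d e f → (c :+ e) :* a :+ :- ((d :+ f) :* b)
                       := (c :* a :+ :- (d :* b)) :+ (e :* a :+ :- (f :* b))) refl
               (seq (re z) n) (seq (im z) n) (seq (re w) n) (seq (im w) n) (seq (re u) n) (seq (im u) n))
      (λ n → solve 6 (λ a b c d e f → (c :+ e) :* b :+ (d :+ f) :* a
                       := (c :* b :+ d :* a) :+ (e :* b :+ f :* a)) refl
               (seq (re z) n) (seq (im z) n) (seq (re w) n) (seq (im w) n) (seq (re u) n) (seq (im u) n))

    ofℚ-+ : ∀ p q → ofℚ (p Q.+ q) ≈ ofℚ p + ofℚ q
    ofℚ-+ p q = ≡⇒≈ (λ _ → refl) (λ _ → refl)

    ofℚ-* : ∀ p q → ofℚ (p Q.* q) ≈ ofℚ p * ofℚ q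
    ofℚ-* p q = ≡⇒≈
      (λ _ → solve 2 (λ a b → a :* b := a :* b :+ :- (con 0ℚ :* con 0ℚ)) refl p q)
      (λ _ → solve 2 (λ a b → con 0ℚ := a :* con 0ℚ :+ con 0ℚ :* b) refl p q)

    ofℚ-neg : ∀ p → ofℚ (Q.- p) ≈ -ᶜ (ofℚ p)
    ofℚ-neg p = ≡⇒≈ (λ _ → refl) (λ _ → refl)

*-identityʳ : ∀ z → z * 1ℂ ≈ z
*-identityʳ z = ≈-trans (*-comm z 1ℂ) (*-identityˡ z)

*-distribˡ-+ : ∀ z w u → z * (w + u) ≈ z * w + z * u
*-distribˡ-+ z w u = ≈-trans (*-comm z (w + u)) (≈-trans (*-distribʳ-+ z w u) (+-cong (*-comm w z) (*-comm u z)))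

ℂ-isCommutativeRing : IsCommutativeRing _≈_ _+_ _*_ -ᶜ_ 0ℂ 1ℂ
ℂ-isCommutativeRing = record
  { isRing = record
    { +-isAbelianGroup = record
      { isGroup = record
        { isMonoid = record
          { isSemigroup = record
            { isMagma = record
              { isEquivalence = record { refl = ≈-refl ; sym = ≈-sym ; trans = ≈-trans }
              ; ∙-cong = +-cong
              }
            ; assoc = +-assoc
            }
          ; identity = +-identityˡ , +-identityʳ
          }
        ; inverse = -ᶜ-inverseˡ , -ᶜ-inverseʳ
        ; ⁻¹-cong = -ᶜ-cong
        }
      ; comm = +-comm
      }
    ; *-cong = *-cong
    ; *-assoc = *-assoc
    ; *-identity = *-identityˡ , *-identityʳ
    ; distrib = *-distribˡ-+ , *-distribʳ-+
    }
  ; *-comm = *-comm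
  }

ℂ-commutativeRing : CommutativeRing 0ℓ 0ℓ
ℂ-commutativeRing = record { isCommutativeRing = ℂ-isCommutativeRing }

ℂ-almostCommutativeRing : AlmostCommutativeRing 0ℓ 0ℓ
ℂ-almostCommutativeRing = fromCommutativeRing ℂ-commutativeRing

ofℚ-homomorphism : CommutativeRing.rawRing ℚₚ.+-*-commutativeRing -Raw-AlmostCommutative⟶ ℂ-almostCommutativeRing
ofℚ-homomorphism = record
  { ⟦_⟧    = ofℚ
  ; +-homo = ofℚ-+
  ; *-homo = ofℚ-*
  ; -‿homo = ofℚ-neg
  ; 0-homo = ≈-refl
  ; 1-homo = ≈-refl
  }

ofℚ-≟ : ∀ p q → Maybe (ofℚ p ≈ ofℚ q)
ofℚ-≟ p q = Maybe.map (λ { refl → ≈-refl }) (dec⇒maybe (p ℚₚ.≟ q))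

module ℂSolver = RingSolver (CommutativeRing.rawRing ℚₚ.+-*-commutativeRing) ℂ-almostCommutativeRing ofℚ-homomorphism ofℚ-≟

open Algebra.Properties.AbelianGroup (CommutativeRing.+-abelianGroup ℂ-commutativeRing) using (∙-cancelʳ)

infixr 6 _·_
infixl 5 _⊹_

_·_ : ∀ c {l r} → l ≈ r → c * l ≈ c * r
c · l≈r = *-cong ≈-refl l≈r

_⊹_ : ∀ {l r l′ r′} → l ≈ r → l′ ≈ r′ → l + l′ ≈ r + r′
_⊹_ = +-cong

-- An equation follows from a linear combination l ≈ r of known equations once
-- the ring identity z + r ≈ w + l has been checked.
combine : ∀ {z w l r} → l ≈ r → z + r ≈ w + l → z ≈ w
combine {z} {w} {l} {r} l≈r e = ∙-cancelʳ l z w (≈-trans (+-cong ≈-refl l≈r) e)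

-- Positivity, apartness from zero and division

Positive : (ℕ → ℚ) → Set
Positive x = ∃ λ δ → 0ℚ Q.< δ × Eventually (λ n → δ Q.≤ x n)

positive⇒apart : ∀ {x} → Positive x → Apart x
positive⇒apart {x} (δ , 0<δ , N , h) = δ , 0<δ , N , λ n N≤n →
  subst (δ Q.≤_) (sym (ℚₚ.0≤p⇒∣p∣≡p (ℚₚ.≤-trans (ℚₚ.<⇒≤ 0<δ) (h n N≤n)))) (h n N≤n)

apart⇒positive : ∀ {x} → (∀ n → 0ℚ Q.≤ x n) → Apart x → Positive x
apart⇒positive 0≤x (δ , 0<δ , N , h) = δ , 0<δ , N , λ n N≤n →
  subst (δ Q.≤_) (ℚₚ.0≤p⇒∣p∣≡p (0≤x n)) (h n N≤n)

positive-mono : ∀ {x y} → (∀ n → x n Q.≤ y n) → Positive x → Positive y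
positive-mono x≤y (δ , 0<δ , N , h) = δ , 0<δ , N , λ n N≤n → ℚₚ.≤-trans (h n N≤n) (x≤y n)

positive-near : ∀ {x y} → Null (λ n → x n Q.- y n) → Positive x → Positive y
positive-near {x} {y} near (δ , 0<δ , N , h) with near (½ Q.* δ) (Sequences.½-pos 0<δ)
... | M , k = ½ Q.* δ , Sequences.½-pos 0<δ , N ℕ.⊔ M , λ n p →
  close⇒≤ {x n} {y n} (k n (Sequences.⊔ʳ {N} {M} p)) (subst (Q._≤ x n) (sym (Sequences.½+½ δ)) (h n (Sequences.⊔ˡ {N} {M} p)))

positive-at : ∀ {x δ} → Cauchy x → 0ℚ Q.< δ → ∃ (λ N → ∀ n → N ℕ.≤ n → δ Q.≤ x n → Positive x)
positive-at {x} {δ} cx 0<δ with cx (½ Q.* δ) (Sequences.½-pos 0<δ)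
... | M , k = M , λ n M≤n δ≤ → ½ Q.* δ , Sequences.½-pos 0<δ , M , λ m M≤m →
  close⇒≤ {x n} {x m} (k n m M≤n M≤m) (subst (Q._≤ x n) (sym (Sequences.½+½ δ)) δ≤)

-- One rational comparison at a late index decides: if the sum is at least δ there, one summand is
-- at least δ/2, and by `positive-at` the Cauchy property turns this single value into positivity
-- from then on.
positive-+ : ∀ {x y} → Cauchy x → Cauchy y → Positive (λ n → x n Q.+ y n) → Positive x ⊎ Positive y
positive-+ {x} {y} cx cy (δ , 0<δ , N , h)
  with positive-at {x} cx (Sequences.½-pos 0<δ) | positive-at {y} cy (Sequences.½-pos 0<δ)
... | A , a | B , b with ½ Q.* δ ℚₚ.≤? x (N ℕ.⊔ (A ℕ.⊔ B))
... | yes p = inj₁ (a n (ℕₚ.≤-trans (ℕₚ.m≤m⊔n A B) (ℕₚ.m≤n⊔m N (A ℕ.⊔ B))) p)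
  where n = N ℕ.⊔ (A ℕ.⊔ B)
... | no ¬p = inj₂ (b n (ℕₚ.≤-trans (ℕₚ.m≤n⊔m A B) (ℕₚ.m≤n⊔m N (A ℕ.⊔ B)))
    (Sequences.+-cancelʳ-≤ (½ Q.* δ) (ℚₚ.≤-trans
      (subst (Q._≤ x n Q.+ y n) (sym (Sequences.½+½ δ)) (h n (ℕₚ.m≤m⊔n N (A ℕ.⊔ B))))
      (subst (x n Q.+ y n Q.≤_) (ℚₚ.+-comm (½ Q.* δ) (y n)) (ℚₚ.+-monoˡ-≤ (y n) (ℚₚ.<⇒≤ (ℚₚ.≰⇒> ¬p)))))))
  where n = N ℕ.⊔ (A ℕ.⊔ B)

≤-√ : ∀ {δ B p} → 0ℚ Q.< B → 0ℚ Q.≤ p → p Q.≤ B → δ Q.≤ p Q.* p → δ Q.* Sequences.recip B Q.≤ p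
≤-√ {δ} {B} {p} 0<B 0≤p p≤B δ≤p² = ℚₚ.*-cancelˡ-≤-pos B {{Q.positive 0<B}} (begin
  B Q.* (δ Q.* ρ)  ≡⟨ solve 3 (λ b d r → b :* (d :* r) := d :* (b :* r)) refl B δ ρ ⟩
  δ Q.* (B Q.* ρ)  ≡⟨ cong (δ Q.*_) (Sequences.recip-inverse B (Sequences.pos⇒≢0 0<B)) ⟩
  δ Q.* 1ℚ         ≡⟨ ℚₚ.*-identityʳ δ ⟩
  δ                ≤⟨ δ≤p² ⟩
  p Q.* p          ≤⟨ ℚₚ.*-monoʳ-≤-nonNeg p {{Q.nonNegative 0≤p}} p≤B ⟩
  B Q.* p          ∎)
  where
  open ℚₚ.≤-Reasoning
  open ℚSolver
  ρ = Sequences.recip B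

-- An upper bound B of the sequence gives x ≥ x²/B ≥ δ/B, so no root of δ has to be taken.
positive-√ : ∀ {x} → Cauchy x → (∀ n → 0ℚ Q.≤ x n) → Positive (λ n → x n Q.* x n) → Positive x
positive-√ {x} cx 0≤x (δ , 0<δ , N , h) =
  let B , 0<B , M , k = Sequences.bound {x} cx
  in δ Q.* Sequences.recip B , Sequences.*-pos 0<δ (Sequences.recip-pos 0<B) , N ℕ.⊔ M , λ n p →
    ≤-√ {δ} {B} {x n} 0<B (0≤x n) (subst (Q._≤ B) (ℚₚ.0≤p⇒∣p∣≡p (0≤x n)) (k n (Sequences.⊔ʳ {N} {M} p))) (h n (Sequences.⊔ˡ {N} {M} p))

normSq-nonNeg : ∀ z n → 0ℚ Q.≤ seq (normSq z) n
normSq-nonNeg z n = +-nonNeg (Sequences.0≤p*p (seq (re z) n)) (Sequences.0≤p*p (seq (im z) n))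

normSq-cong : ∀ {z w} → z ≈ w → normSq z ≈ᴿ normSq w
normSq-cong {z} {w} (mk≈ p q) = +ᴿ-cong {re z *ᴿ re z} {re w *ᴿ re w} {im z *ᴿ im z} {im w *ᴿ im w}
  (*ᴿ-cong {re z} {re w} {re z} {re w} p p) (*ᴿ-cong {im z} {im w} {im z} {im w} q q)

#0⇒positive : ∀ {z} → z #0 → Positive (seq (normSq z))
#0⇒positive {z} = apart⇒positive {seq (normSq z)} (normSq-nonNeg z)

#0-cong : ∀ {z w} → z ≈ w → z #0 → w #0
#0-cong {z} {w} z≈w z#0 = positive⇒apart {seq (normSq w)}
  (positive-near {seq (normSq z)} {seq (normSq w)} (normSq-cong z≈w) (#0⇒positive {z} z#0))

opaque
  unfolding _*_

  -- The parallelogram law with the term |z - w|² dropped.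
  normSq-+ : ∀ z w n → seq (normSq (z + w)) n Q.≤ seq ((normSq z +ᴿ normSq z) +ᴿ (normSq w +ᴿ normSq w)) n
  normSq-+ z w n = ≤-by (seq (normSq (z - w)) n) (normSq-nonNeg (z - w) n)
    (solve 4 (λ a b c d → ((a :+ c) :* (a :+ c) :+ (b :+ d) :* (b :+ d)) :+ ((a :+ :- c) :* (a :+ :- c) :+ (b :+ :- d) :* (b :+ :- d))
       := ((a :* a :+ b :* b) :+ (a :* a :+ b :* b)) :+ ((c :* c :+ d :* d) :+ (c :* c :+ d :* d))) refl
       (seq (re z) n) (seq (im z) n) (seq (re w) n) (seq (im w) n))
    where open ℚSolver

positive-half : ∀ x → Positive (seq (x +ᴿ x)) → Positive (seq x)
positive-half x p = reduce (positive-+ {seq x} {seq x} (cauchy x) (cauchy x) p)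

#0-+ : ∀ {z w} → (z + w) #0 → z #0 ⊎ w #0
#0-+ {z} {w} z+w#0 = map⊎
  (λ p → positive⇒apart {seq N} (positive-half N p))
  (λ p → positive⇒apart {seq M} (positive-half M p))
  (positive-+ {seq (N +ᴿ N)} {seq (M +ᴿ M)} (cauchy (N +ᴿ N)) (cauchy (M +ᴿ M))
    (positive-mono {seq (normSq (z + w))} {seq ((N +ᴿ N) +ᴿ (M +ᴿ M))} (normSq-+ z w) (#0⇒positive {z + w} z+w#0)))
  where
  N M : ℝ
  N = normSq z
  M = normSq w

opaque
  unfolding _*_ inv

  *-inverse : ∀ z (z#0 : z #0) → z * inv z z#0 ≈ 1ℂ
  *-inverse z z#0@(δ , 0<δ , N , h) = mk≈
    -- Before index `N` the norm may vanish and `recip` may take its default value 0, so the real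
    -- part is 1 only eventually; the imaginary part is 0 at every index.
    (null-eventually {λ n → seq (re (z * inv z z#0)) n Q.- 1ℚ} {λ _ → 0ℚ}
      (N , λ n N≤n → trans
        (solve 3 (λ a b r → (a :* (a :* r) :+ :- (b :* (:- b :* r))) :- con 1ℚ := (a :* a :+ b :* b) :* r :- con 1ℚ) refl
          (seq (re z) n) (seq (im z) n) (Sequences.recip (seq (normSq z) n)))
        (cong (Q._- 1ℚ) (Sequences.recip-inverse (seq (normSq z) n) (Sequences.apart⇒≢0 0<δ (h n N≤n)))))
      null-0)
    (≡⇒≈ᴿ {im (z * inv z z#0)} {fromℚ 0ℚ}
      (λ n → solve 3 (λ a b r → a :* (:- b :* r) :+ b :* (a :* r) := con 0ℚ) refl
        (seq (re z) n) (seq (im z) n) (Sequences.recip (seq (normSq z) n))))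
    where open ℚSolver

module _ where
  open ℂSolver

  cancelˡ : ∀ w {z u} → w #0 → w * z ≈ w * u → z ≈ u
  cancelˡ w {z} {u} w#0 e = combine (u · *-inverse w w#0 ⊹ i · e ⊹ (-ᶜ z) · *-inverse w w#0)
    (solve 4 (λ w z u i → z :+ (u :* con 1ℚ :+ i :* (w :* u) :+ (:- z) :* con 1ℚ) := u :+ (u :* (w :* i) :+ i :* (w :* z) :+ (:- z) :* (w :* i))) ≈-refl w z u i)
    where i = inv w w#0

  *≈⇒≈/ : ∀ w {z u} (w#0 : w #0) → w * z ≈ u → z ≈ u / w [ w#0 ]
  *≈⇒≈/ w {z} {u} w#0 e = cancelˡ w w#0 (≈-trans e (≈-sym (combine (u · *-inverse w w#0)
    (solve 3 (λ w u i → w :* (u :* i) :+ u :* con 1ℚ := u :+ u :* (w :* i)) ≈-refl w u (inv w w#0)))))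

  ≈/⇒*≈ : ∀ w {z u} (w#0 : w #0) → z ≈ u / w [ w#0 ] → w * z ≈ u
  ≈/⇒*≈ w {z} {u} w#0 e = combine (w · e ⊹ u · *-inverse w w#0)
    (solve 4 (λ w z u i → w :* z :+ (w :* (u :* i) :+ u :* con 1ℚ) := u :+ (w :* z :+ u :* (w :* i))) ≈-refl w z u (inv w w#0))

  2#0 : 2ℂ #0
  2#0 = 1ℚ , from-yes (0ℚ ℚₚ.<? 1ℚ) , 0 , λ _ _ → from-yes (1ℚ ℚₚ.≤? Q.∣ seq (normSq 2ℂ) 0 ∣)

  4#0 : 4ℂ #0
  4#0 = 1ℚ , from-yes (0ℚ ℚₚ.<? 1ℚ) , 0 , λ _ _ → from-yes (1ℚ ℚₚ.≤? Q.∣ seq (normSq 4ℂ) 0 ∣)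

  -- The hypothesis says (w + z)(w - z) = 0. To learn which factor can be cancelled, note that (w +
  -- z)² + (w - z)² = 4w² is apart from 0; hence one of the two squares is, by `#0-+`.
  ±-unique : ∀ {z w} → z * z ≈ w * w → (w * w) #0 → z ≈ w ⊎ z ≈ -ᶜ w
  ±-unique {z} {w} z²≈w² w²#0 = map⊎
    (λ w+z#0 → cancelˡ ((w + z) * (w + z)) w+z#0 (combine ((w + z) · z²≈w²)
      (solve 2 (λ z w → (w :+ z) :* (w :+ z) :* z :+ (w :+ z) :* (w :* w) := (w :+ z) :* (w :+ z) :* w :+ (w :+ z) :* (z :* z)) ≈-refl z w)))
    (λ w-z#0 → cancelˡ ((w + -ᶜ z) * (w + -ᶜ z)) w-z#0 (combine ((-ᶜ (w + -ᶜ z)) · z²≈w²)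
      (solve 2 (λ z w → (w :+ :- z) :* (w :+ :- z) :* z :+ (:- (w :+ :- z)) :* (w :* w)
         := (w :+ :- z) :* (w :+ :- z) :* (:- w) :+ (:- (w :+ :- z)) :* (z :* z)) ≈-refl z w)))
    (#0-+ {(w + z) * (w + z)} {(w + -ᶜ z) * (w + -ᶜ z)}
      (#0-cong {4ℂ * (w * w)} {(w + z) * (w + z) + (w + -ᶜ z) * (w + -ᶜ z)} sum (#0-* {4ℂ} {w * w} 4#0 w²#0)))
    where
    sum : 4ℂ * (w * w) ≈ (w + z) * (w + z) + (w + -ᶜ z) * (w + -ᶜ z)
    sum = combine ((-ᶜ 2ℂ) · z²≈w²) (solve 2 (λ z w → con (1ℚ Q.+ 1ℚ Q.+ 1ℚ Q.+ 1ℚ) :* (w :* w) :+ (:- con (1ℚ Q.+ 1ℚ)) :* (w :* w)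
        := ((w :+ z) :* (w :+ z) :+ (w :+ :- z) :* (w :+ :- z)) :+ (:- con (1ℚ Q.+ 1ℚ)) :* (z :* z)) ≈-refl z w)

-- Complex square roots

ofℝ : ℝ → ℂ
ofℝ x = x +i fromℚ 0ℚ

ι : ℂ
ι = fromℚ 0ℚ +i fromℚ 1ℚ

ofℝ-cong : ∀ {x y} → x ≈ᴿ y → ofℝ x ≈ ofℝ y
ofℝ-cong {x} {y} p = mk≈ p (≈ᴿ-refl {fromℚ 0ℚ})

module _ where
  open ℚSolver

  opaque
    unfolding _*_ -ᶜ_

    ofℝ-+ : ∀ x y → ofℝ (x +ᴿ y) ≈ ofℝ x + ofℝ y
    ofℝ-+ x y = ≡⇒≈ (λ _ → refl) (λ _ → refl)

    ofℝ-neg : ∀ x → ofℝ (-ᴿ x) ≈ -ᶜ ofℝ x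
    ofℝ-neg x = ≡⇒≈ (λ _ → refl) (λ _ → refl)

    ofℝ-* : ∀ x y → ofℝ (x *ᴿ y) ≈ ofℝ x * ofℝ y
    ofℝ-* x y = ≡⇒≈
      (λ n → solve 2 (λ a b → a :* b := a :* b :+ :- (con 0ℚ :* con 0ℚ)) refl (seq x n) (seq y n))
      (λ n → solve 2 (λ a b → con 0ℚ := a :* con 0ℚ :+ con 0ℚ :* b) refl (seq x n) (seq y n))

    ι²≈-1 : ι * ι ≈ -ᶜ 1ℂ
    ι²≈-1 = ≡⇒≈ (λ _ → refl) (λ _ → refl)

    rectangular : ∀ z → ofℝ (re z) + ι * ofℝ (im z) ≈ z
    rectangular z = ≡⇒≈
      (λ n → solve 2 (λ a b → a :+ (con 0ℚ :* b :+ :- (con 1ℚ :* con 0ℚ)) := a) refl (seq (re z) n) (seq (im z) n))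
      (λ n → solve 1 (λ b → con 0ℚ :+ (con 0ℚ :* con 0ℚ :+ con 1ℚ :* b) := b) refl (seq (im z) n))

positive⇒#0 : ∀ {x} → Positive (seq x) → ofℝ x #0
positive⇒#0 {x} p@(δ , 0<δ , N , h) = positive⇒apart {seq (normSq (ofℝ x))}
  (δ Q.* δ , Sequences.*-pos 0<δ 0<δ , N , λ n N≤n →
    subst (δ Q.* δ Q.≤_) (sym (ℚₚ.+-identityʳ (seq x n Q.* seq x n)))
      (Sequences.*-mono-≤ (ℚₚ.<⇒≤ 0<δ) (ℚₚ.≤-trans (ℚₚ.<⇒≤ 0<δ) (h n N≤n)) (h n N≤n) (h n N≤n)))

sqrtAbs² : ∀ {x} → Eventually (λ n → 0ℚ Q.≤ seq x n) → sqrtAbs x *ᴿ sqrtAbs x ≈ᴿ x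
sqrtAbs² {x} (N , h) = null-eventually {λ n → approx x n Q.* approx x n Q.- seq x n} {λ n → approx x n Q.* approx x n Q.- Q.∣ seq x n ∣}
  (N , λ n N≤n → cong (λ u → approx x n Q.* approx x n Q.- u) (sym (ℚₚ.0≤p⇒∣p∣≡p (h n N≤n)))) (approx-null x)

-- For r = |a + b i| and r + a > 0, with s = √(2 (r + a)) the root is s / 2 + (b / s) i.
sqrt-right : ∀ a b r → ofℝ r * ofℝ r ≈ ofℝ a * ofℝ a + ofℝ b * ofℝ b → Positive (seq (r +ᴿ a)) →
             ∃ λ w → w * w ≈ ofℝ a + ι * ofℝ b
sqrt-right a b r E₄ (δ , 0<δ , N , h) = ½ℂ * σ + ι * β * σ * I ,
  -- Here I = 1/σ², so σ I stands for 1/σ. The square is (ρ + α)/2 + ι β - β² I, and β² I = (ρ -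
  -- α)(ρ + α) I = (ρ - α)/2 because σ² = 2 (ρ + α).
  combine ((¼ + ½ℂ * I * (ρ + -ᶜ α)) · E₁ ⊹ (ι * β + -ᶜ (β * β * I) + -ᶜ (½ℂ * (ρ + -ᶜ α))) · E₂ ⊹ (β * β * σ * σ * I * I) · ι²≈-1 ⊹ I · E₄)
    (solve 6 (λ σ ι β I ρ α →
        (con ½ :* σ :+ ι :* β :* σ :* I) :* (con ½ :* σ :+ ι :* β :* σ :* I)
          :+ ((con (½ Q.* ½) :+ con ½ :* I :* (ρ :+ :- α)) :* ((ρ :+ α) :+ (ρ :+ α))
              :+ (ι :* β :+ :- (β :* β :* I) :+ :- (con ½ :* (ρ :+ :- α))) :* con 1ℚ
              :+ (β :* β :* σ :* σ :* I :* I) :* (:- con 1ℚ) :+ I :* (α :* α :+ β :* β))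
        := α :+ ι :* β
          :+ ((con (½ Q.* ½) :+ con ½ :* I :* (ρ :+ :- α)) :* (σ :* σ)
              :+ (ι :* β :+ :- (β :* β :* I) :+ :- (con ½ :* (ρ :+ :- α))) :* (σ :* σ :* I)
              :+ (β :* β :* σ :* σ :* I :* I) :* (ι :* ι) :+ I :* (ρ :* ρ))) ≈-refl σ ι β I ρ α)
  where
  open ℂSolver
  y = (r +ᴿ a) +ᴿ (r +ᴿ a)
  y-positive : Positive (seq y)
  y-positive = δ Q.+ δ , ℚₚ.+-mono-< 0<δ 0<δ , N , λ n N≤n → ℚₚ.+-mono-≤ (h n N≤n) (h n N≤n)
  y#0 : ofℝ y #0
  y#0 = positive⇒#0 {y} y-positive
  σ = ofℝ (sqrtAbs y)
  α = ofℝ a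
  β = ofℝ b
  ρ = ofℝ r
  I = inv (ofℝ y) y#0
  ¼ = ofℚ (½ Q.* ½)
  E₀ : σ * σ ≈ ofℝ y
  E₀ = ≈-trans (≈-sym (ofℝ-* (sqrtAbs y) (sqrtAbs y)))
    (ofℝ-cong {sqrtAbs y *ᴿ sqrtAbs y} {y} (sqrtAbs² {y} (N , λ n N≤n →
      ℚₚ.≤-trans (ℚₚ.<⇒≤ (ℚₚ.+-mono-< 0<δ 0<δ)) (ℚₚ.+-mono-≤ (h n N≤n) (h n N≤n)))))
  E₁ : σ * σ ≈ (ρ + α) + (ρ + α)
  E₁ = ≈-trans E₀ (≈-trans (ofℝ-+ (r +ᴿ a) (r +ᴿ a)) (+-cong (ofℝ-+ r a) (ofℝ-+ r a)))
  E₂ : σ * σ * I ≈ 1ℂ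
  E₂ = ≈-trans (*-cong E₀ ≈-refl) (*-inverse (ofℝ y) y#0)

sqrt-left : ∀ {w a b} → w * w ≈ ofℝ (-ᴿ a) + ι * ofℝ (-ᴿ b) → ι * w * (ι * w) ≈ ofℝ a + ι * ofℝ b
sqrt-left {w} {a} {b} w²≈ = combine ((w * w) · ι²≈-1 ⊹ (-ᶜ 1ℂ) · w²≈ ⊹ (-ᶜ 1ℂ) · ofℝ-neg a ⊹ (-ᶜ ι) · ofℝ-neg b)
  (solve 6 (λ w ι α β α′ β′ →
    ι :* w :* (ι :* w) :+ ((w :* w) :* (:- con 1ℚ) :+ (:- con 1ℚ) :* (α′ :+ ι :* β′) :+ (:- con 1ℚ) :* (:- α) :+ (:- ι) :* (:- β))
    := (α :+ ι :* β) :+ ((w :* w) :* (ι :* ι) :+ (:- con 1ℚ) :* (w :* w) :+ (:- con 1ℚ) :* α′ :+ (:- ι) :* β′))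
    ≈-refl w ι (ofℝ a) (ofℝ b) (ofℝ (-ᴿ a)) (ofℝ (-ᴿ b)))
  where open ℂSolver

-- The formula of `sqrt-right` degenerates on the negative real axis. But r + a and r - a add up to
-- 2r > 0, so one of them is positive; in the second case the root of the negated number is taken
-- and multiplied by ι.
sqrt-rectangular : ∀ a b → (a +i b) #0 → ∃ λ w → w * w ≈ ofℝ a + ι * ofℝ b
sqrt-rectangular a b z#0 = by-cases (positive-+ {seq (r +ᴿ a)} {seq (r +ᴿ -ᴿ a)} (cauchy (r +ᴿ a)) (cauchy (r +ᴿ -ᴿ a))
    (positive-mono {seq r} (λ n → ≤-by (seq r n) (approx-nonNeg N n)
      (ℚSolver.solve 2 (λ r a → r ℚSolver.:+ r ℚSolver.:= (r ℚSolver.:+ a) ℚSolver.:+ (r ℚSolver.:+ ℚSolver.:- a)) refl (seq r n) (seq a n))) r-positive))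
  where
  open ℂSolver
  N = a *ᴿ a +ᴿ b *ᴿ b
  r = sqrtAbs N
  r²≈N : r *ᴿ r ≈ᴿ N
  r²≈N = sqrtAbs² {N} (0 , λ n _ → normSq-nonNeg (a +i b) n)
  r-positive : Positive (seq r)
  r-positive = positive-√ {seq r} (cauchy r) (approx-nonNeg N)
    (positive-near {seq N} {seq (r *ᴿ r)} (≈ᴿ-sym {r *ᴿ r} {N} r²≈N) (#0⇒positive {a +i b} z#0))
  ρ²≈ : ofℝ r * ofℝ r ≈ ofℝ a * ofℝ a + ofℝ b * ofℝ b
  ρ²≈ = ≈-trans (≈-sym (ofℝ-* r r)) (≈-trans (ofℝ-cong {r *ᴿ r} {N} r²≈N)
    (≈-trans (ofℝ-+ (a *ᴿ a) (b *ᴿ b)) (+-cong (ofℝ-* a a) (ofℝ-* b b))))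
  ρ²≈′ : ofℝ r * ofℝ r ≈ ofℝ (-ᴿ a) * ofℝ (-ᴿ a) + ofℝ (-ᴿ b) * ofℝ (-ᴿ b)
  ρ²≈′ = ≈-trans ρ²≈ (≈-trans (solve 2 (λ α β → α :* α :+ β :* β := (:- α) :* (:- α) :+ (:- β) :* (:- β)) ≈-refl (ofℝ a) (ofℝ b))
    (≈-sym (+-cong (*-cong (ofℝ-neg a) (ofℝ-neg a)) (*-cong (ofℝ-neg b) (ofℝ-neg b)))))
  by-cases : Positive (seq (r +ᴿ a)) ⊎ Positive (seq (r +ᴿ -ᴿ a)) → ∃ λ w → w * w ≈ ofℝ a + ι * ofℝ b
  by-cases (inj₁ p) = sqrt-right a b r ρ²≈ p
  by-cases (inj₂ p) = let w , w²≈ = sqrt-right (-ᴿ a) (-ᴿ b) r ρ²≈′ p in ι * w , sqrt-left w²≈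

-- The root depends on the representing sequences and on the apartness witness, and need not respect
-- `≈`. This is harmless, since only one root per unit square is ever drawn.
sqrt : ∀ {z} → z #0 → ∃ λ w → w * w ≈ z
sqrt {z} z#0 = let w , w²≈ = sqrt-rectangular (re z) (im z) z#0 in w , ≈-trans w²≈ (rectangular z)

reflexive : ∀ {z w} → z ≡ w → z ≈ w
reflexive refl = ≈-refl

-- Algebra of a single cube

module CubeAlgebra where
  open ℂSolver

  Edge : Set
  Edge = Fin 2 → ℂ

  Cube : Set
  Cube = Fin 2 → Fin 2 → Fin 2 → ℂ

  -- Restated on a bare cube, so that reflected cubes can be inserted, and with `-ᶜ_` in place of
  -- `_-_`, since negation is the operation of the ring that the solver knows.
  K kashaev : Cube → ℂ
  K z = ½ℂ * (z 1F 1F 1F * (z 0F 0F 0F * z 0F 0F 0F)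
              + -ᶜ (z 0F 0F 0F * (z 1F 0F 0F * z 0F 1F 1F + z 0F 1F 0F * z 1F 0F 1F + z 0F 0F 1F * z 1F 1F 0F)))
      + -ᶜ (z 1F 0F 0F * z 0F 1F 0F * z 0F 0F 1F)
  kashaev z = 2ℂ * (a * a + b * b + c * c + d * d)
            + -ᶜ ((a + b + c + d) * (a + b + c + d))
            + -ᶜ (4ℂ * (s + t))
    where
    a = z 0F 0F 0F * z 1F 1F 1F
    b = z 1F 0F 0F * z 0F 1F 1F
    c = z 0F 1F 0F * z 1F 0F 1F
    d = z 0F 0F 1F * z 1F 1F 0F
    s = z 0F 0F 0F * z 0F 1F 1F * z 1F 0F 1F * z 1F 1F 0F
    t = z 1F 1F 1F * z 1F 0F 0F * z 0F 1F 0F * z 0F 0F 1F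

  K-cong : ∀ {z z′} → (∀ i j k → z i j k ≈ z′ i j k) → K z ≈ K z′
  K-cong h = +-cong
    (*-cong ≈-refl (+-cong (*-cong (h 1F 1F 1F) (*-cong (h 0F 0F 0F) (h 0F 0F 0F)))
      (-ᶜ-cong (*-cong (h 0F 0F 0F) (+-cong (+-cong (*-cong (h 1F 0F 0F) (h 0F 1F 1F)) (*-cong (h 0F 1F 0F) (h 1F 0F 1F)))
        (*-cong (h 0F 0F 1F) (h 1F 1F 0F)))))))
    (-ᶜ-cong (*-cong (*-cong (h 1F 0F 0F) (h 0F 1F 0F)) (h 0F 0F 1F)))

  KCv≈K : ∀ x v σ → KCv x v σ ≈ K (label x v σ)
  KCv≈K x v σ = ≈-trans (sub≈ _ _) (+-cong (*-cong ≈-refl (sub≈ _ _)) ≈-refl)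

  KC≈kashaev : ∀ x v → KC x v ≈ kashaev (label x v +++)
  KC≈kashaev x v = ≈-trans (sub≈ _ _) (+-cong (sub≈ _ _) ≈-refl)

  module _ {n : ℕ} where
    2ᵖ 4ᵖ : Polynomial n
    2ᵖ = con (1ℚ Q.+ 1ℚ)
    4ᵖ = con (1ℚ Q.+ 1ℚ Q.+ 1ℚ Q.+ 1ℚ)

    -- The variables are the values at 000 (`a`), at its neighbours along the three axes (`b₁`,
    -- `b₂`, `b₃`), at the corners opposite to those (`d₁`, `d₂`, `d₃`) and at 111 (`h`).
    Kᵖ kashaevᵖ : (a b₁ b₂ b₃ d₁ d₂ d₃ h : Polynomial n) → Polynomial n
    Kᵖ a b₁ b₂ b₃ d₁ d₂ d₃ h = con ½ :* (h :* (a :* a) :+ :- (a :* (b₁ :* d₁ :+ b₂ :* d₂ :+ b₃ :* d₃))) :+ :- (b₁ :* b₂ :* b₃)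
    kashaevᵖ a b₁ b₂ b₃ d₁ d₂ d₃ h =
      2ᵖ :* (A :* A :+ B :* B :+ C :* C :+ D :* D) :+ :- ((A :+ B :+ C :+ D) :* (A :+ B :+ C :+ D))
        :+ :- (4ᵖ :* (a :* d₁ :* d₂ :* d₃ :+ h :* b₁ :* b₂ :* b₃))
      where
      A = a :* h
      B = b₁ :* d₁
      C = b₂ :* d₂
      D = b₃ :* d₃

  flip : Fin 2 → Fin 2
  flip 0F = 1F
  flip 1F = 0F

  turn : Sign → Fin 2 → Fin 2
  turn Sign.+ i = i
  turn Sign.- i = flip i

  flip₁ swap₁₂ swap₁₃ : Cube → Cube
  flip₁ z i j k = z (flip i) j k
  swap₁₂ z i j k = z j i k
  swap₁₃ z i j k = z k j i

  turned : Octant → Cube → Cube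
  turned (σ₁ , σ₂ , σ₃) z i j k = z (turn σ₁ i) (turn σ₂ j) (turn σ₃ k)

  -- the square terms of the faces containing the vertex 000 and orthogonal to the first, second and third axis
  T₁ T₂ T₃ : Cube → ℂ
  T₁ z = z 0F 0F 0F * z 0F 1F 1F + z 0F 1F 0F * z 0F 0F 1F
  T₂ z = z 0F 0F 0F * z 1F 0F 1F + z 1F 0F 0F * z 0F 0F 1F
  T₃ z = z 0F 0F 0F * z 1F 1F 0F + z 1F 0F 0F * z 0F 1F 0F

  -- Put F₂² and F₃² for the square terms, F₁ F₂ F₃ for K at 000 and -F₁′ F₂ F₃ for K at 100, where
  -- F₁′ is the value on the opposite face. Cancelling F₂ F₃ leaves exactly `opp₁`.
  K-edge : ∀ z → z 0F 0F 0F * K (flip₁ z) + z 1F 0F 0F * K z ≈ -ᶜ (T₂ z * T₃ z)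
  K-edge z = solve 8 (λ a b₁ b₂ b₃ d₁ d₂ d₃ h → a :* Kᵖ b₁ a d₃ d₂ h b₃ b₂ d₁ :+ b₁ :* Kᵖ a b₁ b₂ b₃ d₁ d₂ d₃ h
      := :- ((a :* d₂ :+ b₁ :* b₃) :* (a :* d₃ :+ b₁ :* b₂))) ≈-refl
    (z 0F 0F 0F) (z 1F 0F 0F) (z 0F 1F 0F) (z 0F 0F 1F) (z 0F 1F 1F) (z 1F 0F 1F) (z 1F 1F 0F) (z 1F 1F 1F)

  -- As z₀₀₀ is invertible, the Kashaev equation says precisely that K² is the product of the three
  -- square terms at the corner; both directions of the theorem use this.
  K-kashaev : ∀ z → 4ℂ * (K z * K z) ≈ z 0F 0F 0F * z 0F 0F 0F * kashaev z + 4ℂ * (T₁ z * T₂ z * T₃ z)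
  K-kashaev z = solve 8 (λ a b₁ b₂ b₃ d₁ d₂ d₃ h → 4ᵖ :* (Kᵖ a b₁ b₂ b₃ d₁ d₂ d₃ h :* Kᵖ a b₁ b₂ b₃ d₁ d₂ d₃ h)
      := a :* a :* kashaevᵖ a b₁ b₂ b₃ d₁ d₂ d₃ h
         :+ 4ᵖ :* ((a :* d₁ :+ b₂ :* b₃) :* (a :* d₂ :+ b₁ :* b₃) :* (a :* d₃ :+ b₁ :* b₂))) ≈-refl
    (z 0F 0F 0F) (z 1F 0F 0F) (z 0F 1F 0F) (z 0F 0F 1F) (z 0F 1F 1F) (z 1F 0F 1F) (z 1F 1F 0F) (z 1F 1F 1F)

  kashaev-flip₁ : ∀ z → kashaev (flip₁ z) ≈ kashaev z
  kashaev-flip₁ z = solve 8 (λ a b₁ b₂ b₃ d₁ d₂ d₃ h → kashaevᵖ b₁ a d₃ d₂ h b₃ b₂ d₁ := kashaevᵖ a b₁ b₂ b₃ d₁ d₂ d₃ h) ≈-refl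
    (z 0F 0F 0F) (z 1F 0F 0F) (z 0F 1F 0F) (z 0F 0F 1F) (z 0F 1F 1F) (z 1F 0F 1F) (z 1F 1F 0F) (z 1F 1F 1F)

  kashaev-swap₁₂ : ∀ z → kashaev (swap₁₂ z) ≈ kashaev z
  kashaev-swap₁₂ z = solve 8 (λ a b₁ b₂ b₃ d₁ d₂ d₃ h → kashaevᵖ a b₂ b₁ b₃ d₂ d₁ d₃ h := kashaevᵖ a b₁ b₂ b₃ d₁ d₂ d₃ h) ≈-refl
    (z 0F 0F 0F) (z 1F 0F 0F) (z 0F 1F 0F) (z 0F 0F 1F) (z 0F 1F 1F) (z 1F 0F 1F) (z 1F 1F 0F) (z 1F 1F 1F)

  kashaev-swap₁₃ : ∀ z → kashaev (swap₁₃ z) ≈ kashaev z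
  kashaev-swap₁₃ z = solve 8 (λ a b₁ b₂ b₃ d₁ d₂ d₃ h → kashaevᵖ a b₃ b₂ b₁ d₃ d₂ d₁ h := kashaevᵖ a b₁ b₂ b₃ d₁ d₂ d₃ h) ≈-refl
    (z 0F 0F 0F) (z 1F 0F 0F) (z 0F 1F 0F) (z 0F 0F 1F) (z 0F 1F 1F) (z 1F 0F 1F) (z 1F 1F 0F) (z 1F 1F 1F)

  K-swap₁₂ : ∀ z → K (swap₁₂ z) ≈ K z
  K-swap₁₂ z = solve 8 (λ a b₁ b₂ b₃ d₁ d₂ d₃ h → Kᵖ a b₂ b₁ b₃ d₂ d₁ d₃ h := Kᵖ a b₁ b₂ b₃ d₁ d₂ d₃ h) ≈-refl
    (z 0F 0F 0F) (z 1F 0F 0F) (z 0F 1F 0F) (z 0F 0F 1F) (z 0F 1F 1F) (z 1F 0F 1F) (z 1F 1F 0F) (z 1F 1F 1F)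

  K-swap₁₃ : ∀ z → K (swap₁₃ z) ≈ K z
  K-swap₁₃ z = solve 8 (λ a b₁ b₂ b₃ d₁ d₂ d₃ h → Kᵖ a b₃ b₂ b₁ d₃ d₂ d₁ h := Kᵖ a b₁ b₂ b₃ d₁ d₂ d₃ h) ≈-refl
    (z 0F 0F 0F) (z 1F 0F 0F) (z 0F 1F 0F) (z 0F 0F 1F) (z 0F 1F 1F) (z 1F 0F 1F) (z 1F 1F 0F) (z 1F 1F 1F)

  -- F₁ i, F₂ j, F₃ k are the values at the centers of the faces i × [0,1]², [0,1] × j × [0,1], [0,1]² × k.
  record Squares (z : Cube) (F₁ F₂ F₃ : Edge) : Set where
    field
      sq₁ : ∀ i → F₁ i * F₁ i ≈ z i 0F 0F * z i 1F 1F + z i 1F 0F * z i 0F 1F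
      sq₂ : ∀ j → F₂ j * F₂ j ≈ z 0F j 0F * z 1F j 1F + z 1F j 0F * z 0F j 1F
      sq₃ : ∀ k → F₃ k * F₃ k ≈ z 0F 0F k * z 1F 1F k + z 1F 0F k * z 0F 1F k

  -- Denominators are cleared, and `K≈` is the equation for z₁₁₁, rearranged and halved.
  record Hexahedron (z : Cube) (F₁ F₂ F₃ : Edge) : Set where
    field
      squares : Squares z F₁ F₂ F₃
      opp₁    : z 0F 0F 0F * F₁ 1F ≈ F₂ 0F * F₃ 0F + F₁ 0F * z 1F 0F 0F
      opp₂    : z 0F 0F 0F * F₂ 1F ≈ F₁ 0F * F₃ 0F + F₂ 0F * z 0F 1F 0F
      opp₃    : z 0F 0F 0F * F₃ 1F ≈ F₁ 0F * F₂ 0F + F₃ 0F * z 0F 0F 1F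
      K≈      : K z ≈ F₁ 0F * F₂ 0F * F₃ 0F
    open Squares squares public

  squares-swap₁₂ : ∀ {z F₁ F₂ F₃} → Squares z F₁ F₂ F₃ → Squares (swap₁₂ z) F₂ F₁ F₃
  squares-swap₁₂ {z} S = record { sq₁ = sq₂ ; sq₂ = sq₁ ; sq₃ = λ k → ≈-trans (sq₃ k) (+-cong ≈-refl (*-comm _ _)) }
    where open Squares S

  squares-swap₁₃ : ∀ {z F₁ F₂ F₃} → Squares z F₁ F₂ F₃ → Squares (swap₁₃ z) F₃ F₂ F₁
  squares-swap₁₃ {z} S = record
    { sq₁ = λ k → ≈-trans (sq₃ k) (+-cong ≈-refl (*-comm _ _))
    ; sq₂ = λ k → ≈-trans (sq₂ k) (+-cong ≈-refl (*-comm _ _))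
    ; sq₃ = λ k → ≈-trans (sq₁ k) (+-cong ≈-refl (*-comm _ _)) }
    where open Squares S

  squares-flip₁ : ∀ {z F₁ F₂ F₃} → Squares z F₁ F₂ F₃ → Squares (flip₁ z) (F₁ ∘ flip) F₂ F₃
  squares-flip₁ {z} S = record
    { sq₁ = λ i → sq₁ (flip i)
    ; sq₂ = λ j → ≈-trans (sq₂ j) (+-comm _ _)
    ; sq₃ = λ k → ≈-trans (sq₃ k) (+-comm _ _) }
    where open Squares S

  sg : Bool → ℂ
  sg false = 1ℂ
  sg true  = -ᶜ 1ℂ

  sg-xor : ∀ s t → sg (s xor t) ≈ sg s * sg t
  sg-xor false t     = ≈-sym (*-identityˡ (sg t))
  sg-xor true  false = ≈-sym (*-identityʳ (-ᶜ 1ℂ))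
  sg-xor true  true  = solve 0 (con 1ℚ := (:- con 1ℚ) :* (:- con 1ℚ)) ≈-refl

  sg² : ∀ s → sg s * sg s ≈ 1ℂ
  sg² false = *-identityˡ 1ℂ
  sg² true  = solve 0 ((:- con 1ℚ) :* (:- con 1ℚ) := con 1ℚ) ≈-refl

  infixr 7 _⊙_
  _⊙_ : (Fin 2 → Bool) → Edge → Edge
  (s ⊙ F) i = sg (s i) * F i

  ⊙² : ∀ s z → sg s * z * (sg s * z) ≈ z * z
  ⊙² s z = combine ((z * z) · sg² s)
    (solve 2 (λ s z → s :* z :* (s :* z) :+ z :* z :* con 1ℚ := z :* z :+ z :* z :* (s :* s)) ≈-refl (sg s) z)

  squares-⊙ : ∀ {z F₁ F₂ F₃} s₁ s₂ s₃ → Squares z F₁ F₂ F₃ → Squares z (s₁ ⊙ F₁) (s₂ ⊙ F₂) (s₃ ⊙ F₃)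
  squares-⊙ s₁ s₂ s₃ S = record
    { sq₁ = λ i → ≈-trans (⊙² (s₁ i) _) (sq₁ i)
    ; sq₂ = λ i → ≈-trans (⊙² (s₂ i) _) (sq₂ i)
    ; sq₃ = λ i → ≈-trans (⊙² (s₃ i) _) (sq₃ i) }
    where open Squares S

  minus bit : Fin 2 → Bool
  minus _ = true
  bit 0F = false
  bit 1F = true

  hex-swap₁₂ : ∀ {z F₁ F₂ F₃} → Hexahedron z F₁ F₂ F₃ → Hexahedron (swap₁₂ z) F₂ F₁ F₃
  hex-swap₁₂ {z} H = record
    { squares = squares-swap₁₂ squares
    ; opp₁ = opp₂
    ; opp₂ = opp₁
    ; opp₃ = ≈-trans opp₃ (+-cong (*-comm _ _) ≈-refl)
    ; K≈   = ≈-trans (K-swap₁₂ z) (≈-trans K≈ (*-cong (*-comm _ _) ≈-refl))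
    }
    where open Hexahedron H

  hex-swap₁₃ : ∀ {z F₁ F₂ F₃} → Hexahedron z F₁ F₂ F₃ → Hexahedron (swap₁₃ z) F₃ F₂ F₁
  hex-swap₁₃ {z} {F₁} {F₂} {F₃} H = record
    { squares = squares-swap₁₃ squares
    ; opp₁ = ≈-trans opp₃ (+-cong (*-comm _ _) ≈-refl)
    ; opp₂ = ≈-trans opp₂ (+-cong (*-comm _ _) ≈-refl)
    ; opp₃ = ≈-trans opp₁ (+-cong (*-comm _ _) ≈-refl)
    ; K≈   = ≈-trans (K-swap₁₃ z) (≈-trans K≈
        (solve 3 (λ p q r → p :* q :* r := r :* q :* p) ≈-refl (F₁ 0F) (F₂ 0F) (F₃ 0F)))
    }
    where open Hexahedron H

  -- Reflections preserve the equations up to these sign changes; composing them yields the sign pattern η.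
  hex-flip₁ : ∀ {z F₁ F₂ F₃} → z 0F 0F 0F #0 → Hexahedron z F₁ F₂ F₃ →
              Hexahedron (flip₁ z) (minus ⊙ (F₁ ∘ flip)) (bit ⊙ F₂) (bit ⊙ F₃)
  hex-flip₁ {z} {F₁} {F₂} {F₃} a#0 H = record
    { squares = squares-⊙ minus bit bit (squares-flip₁ squares)
    ; opp₁ = combine opp₁ (solve 6 (λ a b p p′ q r →
          b :* ((:- con 1ℚ) :* p) :+ (q :* r :+ p :* b)
            := con 1ℚ :* q :* (con 1ℚ :* r) :+ (:- con 1ℚ) :* p′ :* a :+ a :* p′) ≈-refl a b p p′ q r)
    ; opp₂ = cancelˡ a a#0 (combine ((-ᶜ b) · opp₂ ⊹ r · opp₁ ⊹ q · sq₃ 0F)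
        (solve 9 (λ a b p p′ q q′ r b₂ d₃ →
          a :* (b :* ((:- con 1ℚ) :* q′)) :+ ((:- b) :* (p :* r :+ q :* b₂) :+ r :* (q :* r :+ p :* b) :+ q :* (a :* d₃ :+ b :* b₂))
            := a :* ((:- con 1ℚ) :* p′ :* (con 1ℚ :* r) :+ con 1ℚ :* q :* d₃) :+ ((:- b) :* (a :* q′) :+ r :* (a :* p′) :+ q :* (r :* r)))
          ≈-refl a b p p′ q (F₂ 1F) r (z 0F 1F 0F) (z 1F 1F 0F)))
    ; opp₃ = cancelˡ a a#0 (combine ((-ᶜ b) · opp₃ ⊹ q · opp₁ ⊹ r · sq₂ 0F)
        (solve 9 (λ a b p p′ q r r′ b₃ d₂ →
          a :* (b :* ((:- con 1ℚ) :* r′)) :+ ((:- b) :* (p :* q :+ r :* b₃) :+ q :* (q :* r :+ p :* b) :+ r :* (a :* d₂ :+ b :* b₃))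
            := a :* ((:- con 1ℚ) :* p′ :* (con 1ℚ :* q) :+ con 1ℚ :* r :* d₂) :+ ((:- b) :* (a :* r′) :+ q :* (a :* p′) :+ r :* (q :* q)))
          ≈-refl a b p p′ q r (F₃ 1F) (z 0F 0F 1F) (z 1F 0F 1F)))
    ; K≈ = cancelˡ a a#0 (combine (1ℂ · K-edge z ⊹ (-ᶜ b) · K≈ ⊹ (q * r) · opp₁ ⊹ (r * r) · sq₂ 0F ⊹ T₂ z · sq₃ 0F)
        (solve 10 (λ a b p p′ q r t₂ t₃ k k′ →
          a :* k′ :+ (con 1ℚ :* (:- (t₂ :* t₃)) :+ (:- b) :* (p :* q :* r) :+ q :* r :* (q :* r :+ p :* b) :+ r :* r :* t₂ :+ t₂ :* t₃)
            := a :* ((:- con 1ℚ) :* p′ :* (con 1ℚ :* q) :* (con 1ℚ :* r))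
               :+ (con 1ℚ :* (a :* k′ :+ b :* k) :+ (:- b) :* k :+ q :* r :* (a :* p′) :+ r :* r :* (q :* q) :+ t₂ :* (r :* r)))
          ≈-refl a b p p′ q r (T₂ z) (T₃ z) (K z) (K (flip₁ z))))
    }
    where
    open Hexahedron H
    a b p p′ q r : ℂ
    a = z 0F 0F 0F
    b = z 1F 0F 0F
    p = F₁ 0F
    p′ = F₁ 1F
    q = F₂ 0F
    r = F₃ 0F

  sg-⊙ : ∀ s t u w p q r → sg (s xor (t xor (u xor w))) * (p * q * r) ≈ sg s * (sg t * p * (sg u * q) * (sg w * r))
  sg-⊙ s t u w p q r = ≈-trans
    (*-cong (≈-trans (sg-xor s _) (*-cong ≈-refl (≈-trans (sg-xor t _) (*-cong ≈-refl (sg-xor u w))))) ≈-refl)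
    (solve 7 (λ s t u w p q r → s :* (t :* (u :* w)) :* (p :* q :* r) := s :* (t :* p :* (u :* q) :* (w :* r))) ≈-refl
      (sg s) (sg t) (sg u) (sg w) p q r)

  -- true marks the corners where the sign in K = ± F₁ F₂ F₃ is negative
  η : Octant → Bool
  η (Sign.+ , Sign.+ , Sign.+) = false
  η (Sign.- , Sign.- , Sign.-) = false
  η _                          = true

  AtCorner : Cube → Edge → Edge → Edge → Octant → Bool → Set
  AtCorner z F₁ F₂ F₃ σ@(σ₁ , σ₂ , σ₃) s =
    K (turned σ z) ≈ sg s * (F₁ (turn σ₁ 0F) * F₂ (turn σ₂ 0F) * F₃ (turn σ₃ 0F))

  hex-flip₂ : ∀ {z F₁ F₂ F₃} → z 0F 0F 0F #0 → Hexahedron z F₁ F₂ F₃ →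
              Hexahedron (λ i j k → z i (flip j) k) (bit ⊙ F₁) (minus ⊙ (F₂ ∘ flip)) (bit ⊙ F₃)
  hex-flip₂ {z} a#0 H = hex-swap₁₂ (hex-flip₁ {swap₁₂ z} a#0 (hex-swap₁₂ H))

  hex-flip₃ : ∀ {z F₁ F₂ F₃} → z 0F 0F 0F #0 → Hexahedron z F₁ F₂ F₃ →
              Hexahedron (λ i j k → z i j (flip k)) (bit ⊙ F₁) (bit ⊙ F₂) (minus ⊙ (F₃ ∘ flip))
  hex-flip₃ {z} a#0 H = hex-swap₁₃ (hex-flip₁ {swap₁₃ z} a#0 (hex-swap₁₃ H))

  -- Each corner is moved to 000 by reflecting one axis at a time, and `K≈` is read off there. Every
  -- reflection cancels the value at the current 000, so the path runs through vertices known to be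
  -- apart from 0; the nested factors `o` and `n` record the accumulated signs.
  corners : ∀ {z F₁ F₂ F₃} → (∀ i j k → z i j k #0) → Hexahedron z F₁ F₂ F₃ → ∀ σ → AtCorner z F₁ F₂ F₃ σ (η σ)
  corners {z} {F₁} {F₂} {F₃} z#0 H = λ where
      (Sign.+ , Sign.+ , Sign.+) → ≈-trans (Hexahedron.K≈ H) (≈-sym (*-identityˡ _))
      (Sign.- , Sign.+ , Sign.+) → ≈-trans (Hexahedron.K≈ H₁)
        (solve 3 (λ p q r → n :* p :* (o :* q) :* (o :* r) := n :* (p :* q :* r)) ≈-refl (F₁ 1F) (F₂ 0F) (F₃ 0F))
      (Sign.+ , Sign.- , Sign.+) → ≈-trans (Hexahedron.K≈ H₂)
        (solve 3 (λ p q r → o :* p :* (n :* q) :* (o :* r) := n :* (p :* q :* r)) ≈-refl (F₁ 0F) (F₂ 1F) (F₃ 0F))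
      (Sign.+ , Sign.+ , Sign.-) → ≈-trans (Hexahedron.K≈ (hex-flip₃ (z#0 0F 0F 0F) H))
        (solve 3 (λ p q r → o :* p :* (o :* q) :* (n :* r) := n :* (p :* q :* r)) ≈-refl (F₁ 0F) (F₂ 0F) (F₃ 1F))
      (Sign.- , Sign.- , Sign.+) → ≈-trans (Hexahedron.K≈ H₁₂)
        (solve 3 (λ p q r → o :* (n :* p) :* (n :* (n :* q)) :* (o :* (o :* r)) := n :* (p :* q :* r)) ≈-refl (F₁ 1F) (F₂ 1F) (F₃ 0F))
      (Sign.- , Sign.+ , Sign.-) → ≈-trans (Hexahedron.K≈ (hex-flip₃ (z#0 1F 0F 0F) H₁))
        (solve 3 (λ p q r → o :* (n :* p) :* (o :* (o :* q)) :* (n :* (n :* r)) := n :* (p :* q :* r)) ≈-refl (F₁ 1F) (F₂ 0F) (F₃ 1F))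
      (Sign.+ , Sign.- , Sign.-) → ≈-trans (Hexahedron.K≈ (hex-flip₃ (z#0 0F 1F 0F) H₂))
        (solve 3 (λ p q r → o :* (o :* p) :* (o :* (n :* q)) :* (n :* (n :* r)) := n :* (p :* q :* r)) ≈-refl (F₁ 0F) (F₂ 1F) (F₃ 1F))
      (Sign.- , Sign.- , Sign.-) → ≈-trans (Hexahedron.K≈ (hex-flip₃ (z#0 1F 1F 0F) H₁₂))
        (solve 3 (λ p q r → o :* (o :* (n :* p)) :* (o :* (n :* (n :* q))) :* (n :* (n :* (n :* r))) := o :* (p :* q :* r)) ≈-refl (F₁ 1F) (F₂ 1F) (F₃ 1F))
    where
    o n : ∀ {m} → Polynomial m
    o = con 1ℚ
    n = :- con 1ℚ
    H₁ = hex-flip₁ (z#0 0F 0F 0F) H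
    H₂ = hex-flip₂ (z#0 0F 0F 0F) H
    H₁₂ = hex-flip₂ (z#0 1F 0F 0F) H₁

  NonZero² : Edge → Set
  NonZero² F = ∀ i → (F i * F i) #0

  -- `K-edge` read backwards. The division by F₂ F₃ is done by multiplying with F₂ F₃ once more and
  -- cancelling F₂² F₃², because apartness is known for the squares.
  opp-intro : ∀ {z F₁ F₂ F₃} → NonZero² F₂ → NonZero² F₃ → Squares z F₁ F₂ F₃ →
              K z ≈ F₁ 0F * F₂ 0F * F₃ 0F → K (flip₁ z) ≈ -ᶜ (F₁ 1F * F₂ 0F * F₃ 0F) →
              z 0F 0F 0F * F₁ 1F ≈ F₂ 0F * F₃ 0F + F₁ 0F * z 1F 0F 0F
  opp-intro {z} {F₁} {F₂} {F₃} F₂#0 F₃#0 S K₀ K₁ = cancelˡ (q * q * (r * r)) (#0-* {q * q} {r * r} (F₂#0 0F) (F₃#0 0F))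
    (combine ((q * r * a) · K₁ ⊹ (q * r * b) · K₀ ⊹ (-ᶜ (q * r)) · K-edge z ⊹ (-ᶜ (q * r * r * r)) · sq₂ 0F ⊹ (-ᶜ (q * r * T₂ z)) · sq₃ 0F)
      (solve 10 (λ a b p p′ q r t₂ t₃ k k′ →
        q :* q :* (r :* r) :* (a :* p′)
          :+ (q :* r :* a :* (:- (p′ :* q :* r)) :+ q :* r :* b :* (p :* q :* r) :+ (:- (q :* r)) :* (:- (t₂ :* t₃))
              :+ (:- (q :* r :* r :* r)) :* t₂ :+ (:- (q :* r :* t₂)) :* t₃)
        := q :* q :* (r :* r) :* (q :* r :+ p :* b)
          :+ (q :* r :* a :* k′ :+ q :* r :* b :* k :+ (:- (q :* r)) :* (a :* k′ :+ b :* k)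
              :+ (:- (q :* r :* r :* r)) :* (q :* q) :+ (:- (q :* r :* t₂)) :* (r :* r)))
        ≈-refl a b p p′ q r (T₂ z) (T₃ z) (K z) (K (flip₁ z))))
    where
    open Squares S
    a b p p′ q r : ℂ
    a = z 0F 0F 0F
    b = z 1F 0F 0F
    p = F₁ 0F
    p′ = F₁ 1F
    q = F₂ 0F
    r = F₃ 0F

  -- Each `opp` equation belongs to one of the three edges at 000, so it needs only the signs at the
  -- two ends of that edge.
  hex-intro : ∀ {z F₁ F₂ F₃} → NonZero² F₁ → NonZero² F₂ → NonZero² F₃ → Squares z F₁ F₂ F₃ →
              AtCorner z F₁ F₂ F₃ (Sign.+ , Sign.+ , Sign.+) false → AtCorner z F₁ F₂ F₃ (Sign.- , Sign.+ , Sign.+) true →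
              AtCorner z F₁ F₂ F₃ (Sign.+ , Sign.- , Sign.+) true → AtCorner z F₁ F₂ F₃ (Sign.+ , Sign.+ , Sign.-) true →
              Hexahedron z F₁ F₂ F₃
  hex-intro {z} {F₁} {F₂} {F₃} F₁#0 F₂#0 F₃#0 S C₀ C₁ C₂ C₃ = record
    { squares = S
    ; opp₁ = opp-intro F₂#0 F₃#0 S K₀
        (≈-trans C₁ (solve 3 (λ p q r → (:- con 1ℚ) :* (p :* q :* r) := :- (p :* q :* r)) ≈-refl (F₁ 1F) (F₂ 0F) (F₃ 0F)))
    ; opp₂ = opp-intro {swap₁₂ z} {F₂} {F₁} {F₃} F₁#0 F₃#0 (squares-swap₁₂ S)
        (≈-trans (K-swap₁₂ z) (≈-trans K₀ (*-cong (*-comm _ _) ≈-refl)))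
        (≈-trans (K-swap₁₂ (λ i j k → z i (flip j) k)) (≈-trans C₂
          (solve 3 (λ p q r → (:- con 1ℚ) :* (p :* q :* r) := :- (q :* p :* r)) ≈-refl (F₁ 0F) (F₂ 1F) (F₃ 0F))))
    ; opp₃ = ≈-trans (opp-intro {swap₁₃ z} {F₃} {F₂} {F₁} F₂#0 F₁#0 (squares-swap₁₃ S)
        (≈-trans (K-swap₁₃ z) (≈-trans K₀ (solve 3 (λ p q r → p :* q :* r := r :* q :* p) ≈-refl (F₁ 0F) (F₂ 0F) (F₃ 0F))))
        (≈-trans (K-swap₁₃ (λ i j k → z i j (flip k))) (≈-trans C₃
          (solve 3 (λ p q r → (:- con 1ℚ) :* (p :* q :* r) := :- (r :* q :* p)) ≈-refl (F₁ 0F) (F₂ 0F) (F₃ 1F)))))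
        (+-cong (*-comm _ _) ≈-refl)
    ; K≈ = K₀
    }
    where
    K₀ : K z ≈ F₁ 0F * F₂ 0F * F₃ 0F
    K₀ = ≈-trans C₀ (*-identityˡ _)

  hex⇒kashaev : ∀ {z F₁ F₂ F₃} → z 0F 0F 0F #0 → Hexahedron z F₁ F₂ F₃ → kashaev z ≈ 0ℂ
  hex⇒kashaev {z} {F₁} {F₂} {F₃} a#0 H = cancelˡ (a * a) (#0-* {a} {a} a#0 a#0)
    (combine ((-ᶜ 1ℂ) · K-kashaev z ⊹ (4ℂ * (K z + p * q * r)) · K≈
              ⊹ (4ℂ * q * q * r * r) · sq₁ 0F ⊹ (4ℂ * r * r * T₁ z) · sq₂ 0F ⊹ (4ℂ * T₁ z * T₂ z) · sq₃ 0F)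
      (solve 9 (λ a p q r t₁ t₂ t₃ k w →
        a :* a :* w :+ ((:- con 1ℚ) :* (a :* a :* w :+ 4ᵖ :* (t₁ :* t₂ :* t₃)) :+ 4ᵖ :* (k :+ p :* q :* r) :* (p :* q :* r)
            :+ 4ᵖ :* q :* q :* r :* r :* t₁ :+ 4ᵖ :* r :* r :* t₁ :* t₂ :+ 4ᵖ :* t₁ :* t₂ :* t₃)
        := a :* a :* con 0ℚ :+ ((:- con 1ℚ) :* (4ᵖ :* (k :* k)) :+ 4ᵖ :* (k :+ p :* q :* r) :* k
            :+ 4ᵖ :* q :* q :* r :* r :* (p :* p) :+ 4ᵖ :* r :* r :* t₁ :* (q :* q) :+ 4ᵖ :* t₁ :* t₂ :* (r :* r)))
        ≈-refl a p q r (T₁ z) (T₂ z) (T₃ z) (K z) (kashaev z)))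
    where
    open Hexahedron H
    a p q r : ℂ
    a = z 0F 0F 0F
    p = F₁ 0F
    q = F₂ 0F
    r = F₃ 0F

  K-sign : ∀ {z F₁ F₂ F₃} → NonZero² F₁ → NonZero² F₂ → NonZero² F₃ → Squares z F₁ F₂ F₃ → kashaev z ≈ 0ℂ →
           ∃ λ s → K z ≈ sg s * (F₁ 0F * F₂ 0F * F₃ 0F)
  K-sign {z} {F₁} {F₂} {F₃} F₁#0 F₂#0 F₃#0 S kashaev≈0 =
    [ (λ e → false , ≈-trans e (≈-sym (*-identityˡ _)))
    , (λ e → true , ≈-trans e (solve 1 (λ w → :- w := (:- con 1ℚ) :* w) ≈-refl (p * q * r))) ]′
    (±-unique {K z} {p * q * r} (cancelˡ 4ℂ 4#0 K²≈)
      (#0-cong {p * p * (q * q) * (r * r)} {p * q * r * (p * q * r)}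
        (solve 3 (λ p q r → p :* p :* (q :* q) :* (r :* r) := p :* q :* r :* (p :* q :* r)) ≈-refl p q r)
        (#0-* {p * p * (q * q)} {r * r} (#0-* {p * p} {q * q} (F₁#0 0F) (F₂#0 0F)) (F₃#0 0F))))
    where
    open Squares S
    a p q r : ℂ
    a = z 0F 0F 0F
    p = F₁ 0F
    q = F₂ 0F
    r = F₃ 0F
    K²≈ : 4ℂ * (K z * K z) ≈ 4ℂ * (p * q * r * (p * q * r))
    K²≈ = combine (1ℂ · K-kashaev z ⊹ (a * a) · kashaev≈0
          ⊹ (-ᶜ (4ℂ * q * q * r * r)) · sq₁ 0F ⊹ (-ᶜ (4ℂ * r * r * T₁ z)) · sq₂ 0F ⊹ (-ᶜ (4ℂ * T₁ z * T₂ z)) · sq₃ 0F)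
      (solve 9 (λ a p q r t₁ t₂ t₃ k w →
        4ᵖ :* (k :* k) :+ (con 1ℚ :* (a :* a :* w :+ 4ᵖ :* (t₁ :* t₂ :* t₃)) :+ a :* a :* con 0ℚ
            :+ (:- (4ᵖ :* q :* q :* r :* r)) :* t₁ :+ (:- (4ᵖ :* r :* r :* t₁)) :* t₂ :+ (:- (4ᵖ :* t₁ :* t₂)) :* t₃)
        := 4ᵖ :* (p :* q :* r :* (p :* q :* r)) :+ (con 1ℚ :* (4ᵖ :* (k :* k)) :+ a :* a :* w
            :+ (:- (4ᵖ :* q :* q :* r :* r)) :* (p :* p) :+ (:- (4ᵖ :* r :* r :* t₁)) :* (q :* q) :+ (:- (4ᵖ :* t₁ :* t₂)) :* (r :* r)))
        ≈-refl a p q r (T₁ z) (T₂ z) (T₃ z) (K z) (kashaev z))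

  nonZero²-⊙ : ∀ {F} s → NonZero² F → NonZero² (s ⊙ F)
  nonZero²-⊙ {F} s F#0 i = #0-cong {F i * F i} {(s ⊙ F) i * (s ⊙ F) i} (≈-sym (⊙² (s i) (F i))) (F#0 i)

  -- The effect on the sign at a corner when the six face values are multiplied by the given signs:
  -- only the three faces meeting there count.
  total : (s₁ s₂ s₃ : Fin 2 → Bool) → Octant → Bool
  total s₁ s₂ s₃ (σ₁ , σ₂ , σ₃) = s₁ (turn σ₁ 0F) xor (s₂ (turn σ₂ 0F) xor s₃ (turn σ₃ 0F))

  module _ {z : Cube} {F₁ F₂ F₃ : Edge} (s₁ s₂ s₃ : Fin 2 → Bool) where
    atCorner-⊙ : ∀ σ s t → s ≡ t xor total s₁ s₂ s₃ σ → AtCorner z F₁ F₂ F₃ σ s → AtCorner z (s₁ ⊙ F₁) (s₂ ⊙ F₂) (s₃ ⊙ F₃) σ t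
    atCorner-⊙ (σ₁ , σ₂ , σ₃) _ t refl C = ≈-trans C (sg-⊙ t (s₁ (turn σ₁ 0F)) (s₂ (turn σ₂ 0F)) (s₃ (turn σ₃ 0F)) _ _ _)

    atCorner-⊙⁻ : ∀ σ t → AtCorner z (s₁ ⊙ F₁) (s₂ ⊙ F₂) (s₃ ⊙ F₃) σ t → AtCorner z F₁ F₂ F₃ σ (t xor total s₁ s₂ s₃ σ)
    atCorner-⊙⁻ (σ₁ , σ₂ , σ₃) t C = ≈-trans C (≈-sym (sg-⊙ t (s₁ (turn σ₁ 0F)) (s₂ (turn σ₂ 0F)) (s₃ (turn σ₃ 0F)) _ _ _))

  Affine : Set
  Affine = Bool × Bool × Bool × Bool

  -- Every `total` is affine in the corner, and every affine function is a `total`; putting the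
  -- constant on the first pair of faces is one choice among several.
  affine : Affine → Octant → Bool
  affine (c₀ , c₁ , c₂ , c₃) = total (λ i → c₀ xor (bit i ∧ c₁)) (λ i → bit i ∧ c₂) (λ i → bit i ∧ c₃)

  -- The coefficients are forced: η is 0 at 000 and 1 at its neighbours, so c₀ = k₀ and cᵢ = 1 + k₀
  -- + kᵢ. Changing the roots by this affine function makes `hex-intro` applicable, `corners` yields
  -- all eight signs, and undoing the change gives those of the original roots.
  corners-affine : ∀ {z F₁ F₂ F₃} → (∀ i j k → z i j k #0) → NonZero² F₁ → NonZero² F₂ → NonZero² F₃ → Squares z F₁ F₂ F₃ → ∀ {k₀ k₁ k₂ k₃} →
    AtCorner z F₁ F₂ F₃ (Sign.+ , Sign.+ , Sign.+) k₀ → AtCorner z F₁ F₂ F₃ (Sign.- , Sign.+ , Sign.+) k₁ →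
    AtCorner z F₁ F₂ F₃ (Sign.+ , Sign.- , Sign.+) k₂ → AtCorner z F₁ F₂ F₃ (Sign.+ , Sign.+ , Sign.-) k₃ →
    ∀ σ → AtCorner z F₁ F₂ F₃ σ (η σ xor affine (k₀ , true xor (k₀ xor k₁) , true xor (k₀ xor k₂) , true xor (k₀ xor k₃)) σ)
  corners-affine {z} {F₁} {F₂} {F₃} z#0 F₁#0 F₂#0 F₃#0 S {k₀} {k₁} {k₂} {k₃} C₀ C₁ C₂ C₃ σ =
    atCorner-⊙⁻ {z} {F₁} {F₂} {F₃} s₁ s₂ s₃ σ (η σ) (corners z#0 hex σ)
    where
    open xor-∧-Solver using () renaming (solve to solveᵇ; _:=_ to _:=ᵇ_; _:+_ to _:+ᵇ_; con to conᵇ)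
    s₁ s₂ s₃ : Fin 2 → Bool
    s₁ i = k₀ xor (bit i ∧ (true xor (k₀ xor k₁)))
    s₂ i = bit i ∧ (true xor (k₀ xor k₂))
    s₃ i = bit i ∧ (true xor (k₀ xor k₃))
    t f : ∀ {m} → xor-∧-Solver.Polynomial m
    t = conᵇ true
    f = conᵇ false
    hex : Hexahedron z (s₁ ⊙ F₁) (s₂ ⊙ F₂) (s₃ ⊙ F₃)
    hex = hex-intro (nonZero²-⊙ {F₁} s₁ F₁#0) (nonZero²-⊙ {F₂} s₂ F₂#0) (nonZero²-⊙ {F₃} s₃ F₃#0) (squares-⊙ s₁ s₂ s₃ S)
      (atCorner-⊙ {z} {F₁} {F₂} {F₃} s₁ s₂ s₃ (Sign.+ , Sign.+ , Sign.+) k₀ false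
        (solveᵇ 1 (λ a → a :=ᵇ f :+ᵇ ((a :+ᵇ f) :+ᵇ (f :+ᵇ f))) refl k₀) C₀)
      (atCorner-⊙ {z} {F₁} {F₂} {F₃} s₁ s₂ s₃ (Sign.- , Sign.+ , Sign.+) k₁ true
        (solveᵇ 2 (λ a b → b :=ᵇ t :+ᵇ ((a :+ᵇ (t :+ᵇ (a :+ᵇ b))) :+ᵇ (f :+ᵇ f))) refl k₀ k₁) C₁)
      (atCorner-⊙ {z} {F₁} {F₂} {F₃} s₁ s₂ s₃ (Sign.+ , Sign.- , Sign.+) k₂ true
        (solveᵇ 2 (λ a b → b :=ᵇ t :+ᵇ ((a :+ᵇ f) :+ᵇ ((t :+ᵇ (a :+ᵇ b)) :+ᵇ f))) refl k₀ k₂) C₂)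
      (atCorner-⊙ {z} {F₁} {F₂} {F₃} s₁ s₂ s₃ (Sign.+ , Sign.+ , Sign.-) k₃ true
        (solveᵇ 2 (λ a b → b :=ᵇ t :+ᵇ ((a :+ᵇ f) :+ᵇ (f :+ᵇ (t :+ᵇ (a :+ᵇ b))))) refl k₀ k₃) C₃)

  affine-signs : ∀ {z F₁ F₂ F₃} → (∀ i j k → z i j k #0) → NonZero² F₁ → NonZero² F₂ → NonZero² F₃ → Squares z F₁ F₂ F₃ → kashaev z ≈ 0ℂ →
                 ∃ λ c → ∀ σ → AtCorner z F₁ F₂ F₃ σ (η σ xor affine c σ)
  affine-signs {z} {F₁} {F₂} {F₃} z#0 F₁#0 F₂#0 F₃#0 S kashaev≈0 =
    let
      k₀ , C₀ = K-sign {z} {F₁} {F₂} {F₃} F₁#0 F₂#0 F₃#0 S kashaev≈0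
      k₁ , C₁ = K-sign {flip₁ z} {F₁ ∘ flip} {F₂} {F₃} (F₁#0 ∘ flip) F₂#0 F₃#0 (squares-flip₁ S) (≈-trans (kashaev-flip₁ z) kashaev≈0)
      k₂ , C₂ = K-sign {swap₁₂ (flip₁ (swap₁₂ z))} {F₁} {F₂ ∘ flip} {F₃} F₁#0 (F₂#0 ∘ flip) F₃#0
        (squares-swap₁₂ (squares-flip₁ (squares-swap₁₂ S)))
        (≈-trans (kashaev-swap₁₂ (flip₁ (swap₁₂ z))) (≈-trans (kashaev-flip₁ (swap₁₂ z)) (≈-trans (kashaev-swap₁₂ z) kashaev≈0)))
      k₃ , C₃ = K-sign {swap₁₃ (flip₁ (swap₁₃ z))} {F₁} {F₂} {F₃ ∘ flip} F₁#0 F₂#0 (F₃#0 ∘ flip)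
        (squares-swap₁₃ (squares-flip₁ (squares-swap₁₃ S)))
        (≈-trans (kashaev-swap₁₃ (flip₁ (swap₁₃ z))) (≈-trans (kashaev-flip₁ (swap₁₃ z)) (≈-trans (kashaev-swap₁₃ z) kashaev≈0)))
    in (k₀ , true xor (k₀ xor k₁) , true xor (k₀ xor k₂) , true xor (k₀ xor k₃))
     , corners-affine z#0 F₁#0 F₂#0 F₃#0 S {k₀} {k₁} {k₂} {k₃} C₀ C₁ C₂ C₃

open CubeAlgebra

-- The eight cubes and twelve squares around a vertex

module VertexStar where
  open ℂSolver

  ⊕-assoc : ∀ u v w → u ⊕ v ⊕ w ≡ u ⊕ (v ⊕ w)
  ⊕-assoc (a , b , c) (a′ , b′ , c′) (a″ , b″ , c″) =
    cong₂ _,_ (ℤₚ.+-assoc a a′ a″) (cong₂ _,_ (ℤₚ.+-assoc b b′ b″) (ℤₚ.+-assoc c c′ c″))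

  origin : ℤ³
  origin = 0ℤ , 0ℤ , 0ℤ

  ⊕-identityʳ : ∀ u → u ⊕ origin ≡ u
  ⊕-identityʳ (a , b , c) = cong₂ _,_ (ℤₚ.+-identityʳ a) (cong₂ _,_ (ℤₚ.+-identityʳ b) (ℤₚ.+-identityʳ c))

  squareTerm⁺ : (ℤ³ → ℂ) → ℤ³ → Plane → ℂ
  squareTerm⁺ x v P = x v * x (v ⊕ e (axis₁ P) ⊕ e (axis₂ P)) + x (v ⊕ e (axis₁ P)) * x (v ⊕ e (axis₂ P))

  IsRoot : (ℤ³ → ℂ) → (ℤ³ → Plane → ℂ) → Set
  IsRoot x ρ = ∀ v P → ρ v P * ρ v P ≈ squareTerm⁺ x v P

  cube : (ℤ³ → ℂ) → ℤ³ → Cube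
  cube x u = label x u +++

  face₁ face₂ face₃ : (ℤ³ → Plane → ℂ) → ℤ³ → Edge
  face₁ ρ u i = ρ (u ⊕ (Sign.+ ◃ toℕ i , 0ℤ , 0ℤ)) yz
  face₂ ρ u i = ρ (u ⊕ (0ℤ , Sign.+ ◃ toℕ i , 0ℤ)) xz
  face₃ ρ u i = ρ (u ⊕ (0ℤ , 0ℤ , Sign.+ ◃ toℕ i)) xy

  module _ {x : ℤ³ → ℂ} {ρ : ℤ³ → Plane → ℂ} (root : IsRoot x ρ) where
    -- Reassociated so that, for a concrete `c`, the offset from `u` is a closed term and evaluates
    -- to the one used in `label`.
    root-shift : ∀ u c P → ρ (u ⊕ c) P * ρ (u ⊕ c) P
      ≈ x (u ⊕ c) * x (u ⊕ (c ⊕ e (axis₁ P) ⊕ e (axis₂ P))) + x (u ⊕ (c ⊕ e (axis₁ P))) * x (u ⊕ (c ⊕ e (axis₂ P)))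
    root-shift u c P = ≈-trans (root (u ⊕ c) P) (reflexive (cong₂ _+_
      (cong (λ w → x (u ⊕ c) * x w) (trans (cong (_⊕ e (axis₂ P)) (⊕-assoc u c (e (axis₁ P)))) (⊕-assoc u (c ⊕ e (axis₁ P)) (e (axis₂ P)))))
      (cong₂ (λ w w′ → x w * x w′) (⊕-assoc u c (e (axis₁ P))) (⊕-assoc u c (e (axis₂ P))))))

    squares-at : ∀ u → Squares (cube x u) (face₁ ρ u) (face₂ ρ u) (face₃ ρ u)
    squares-at u = record
      { sq₁ = λ { 0F → root-shift u origin yz ; 1F → root-shift u (e 0F) yz }
      ; sq₂ = λ { 0F → root-shift u origin xz ; 1F → root-shift u (e 1F) xz }
      ; sq₃ = λ { 0F → root-shift u origin xy ; 1F → root-shift u (e 2F) xy }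
      }

  -- The cube in the octant σ at v has lowest vertex v ⊕ lowest σ.
  low : Sign → ℤ
  low Sign.+ = 0ℤ
  low Sign.- = -1ℤ

  lowest : Octant → ℤ³
  lowest (σ₁ , σ₂ , σ₃) = low σ₁ , low σ₂ , low σ₃

  low-turn : ∀ σ i → low σ ℤ.+ (Sign.+ ◃ toℕ (turn σ i)) ≡ σ ◃ toℕ i
  low-turn Sign.+ 0F = refl
  low-turn Sign.+ 1F = refl
  low-turn Sign.- 0F = refl
  low-turn Sign.- 1F = refl

  lowestOf : Plane → Sign → Sign → ℤ³
  lowestOf yz σ τ = 0ℤ , low σ , low τ
  lowestOf xz σ τ = low σ , 0ℤ , low τ
  lowestOf xy σ τ = low σ , low τ , 0ℤ

  ∏-cong : ∀ {A : Set} (f g : A → ℂ) as → (∀ a → f a ≈ g a) → ∏ as f ≈ ∏ as g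
  ∏-cong f g []       h = ≈-refl
  ∏-cong f g (a ∷ as) h = *-cong (h a) (∏-cong f g as h)

  ∏-* : ∀ {A : Set} (f g : A → ℂ) as → ∏ as (λ a → f a * g a) ≈ ∏ as f * ∏ as g
  ∏-* f g []       = ≈-sym (*-identityˡ 1ℂ)
  ∏-* f g (a ∷ as) = ≈-trans (*-cong ≈-refl (∏-* f g as))
    (solve 4 (λ a b c d → a :* b :* (c :* d) := a :* c :* (b :* d)) ≈-refl (f a) (g a) (∏ as f) (∏ as g))

  ⨁ : ∀ {A : Set} → List A → (A → Bool) → Bool
  ⨁ as s = foldr _xor_ false (map s as)

  sg-⨁ : ∀ {A : Set} (s : A → Bool) as → ∏ as (sg ∘ s) ≈ sg (⨁ as s)
  sg-⨁ s []       = ≈-refl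
  sg-⨁ s (a ∷ as) = ≈-trans (*-cong ≈-refl (sg-⨁ s as)) (≈-sym (sg-xor (s a) (⨁ as s)))

  -- Each of the 12 squares at a vertex belongs to exactly two of the 8 cubes.
  ∏-faces : ∀ (G : Plane → Sign → Sign → ℂ) →
    ∏ cubesAt (λ (σ₁ , σ₂ , σ₃) → G yz σ₂ σ₃ * G xz σ₁ σ₃ * G xy σ₁ σ₂) ≈ ∏ squaresAt (λ (P , σ , τ) → G P σ τ * G P σ τ)
  ∏-faces G = solve 12 (λ a b c d a′ b′ c′ d′ a″ b″ c″ d″ →
      (a :* a′ :* a″) :* ((b :* b′ :* a″) :* ((c :* a′ :* b″) :* ((d :* b′ :* b″) :*
      ((a :* c′ :* c″) :* ((b :* d′ :* c″) :* ((c :* c′ :* d″) :* ((d :* d′ :* d″) :* con 1ℚ)))))))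
      := (a :* a) :* ((b :* b) :* ((c :* c) :* ((d :* d) :* ((a′ :* a′) :* ((b′ :* b′) :* ((c′ :* c′) :* ((d′ :* d′) :*
         ((a″ :* a″) :* ((b″ :* b″) :* ((c″ :* c″) :* ((d″ :* d″) :* con 1ℚ)))))))))))) ≈-refl
    (G yz Sign.+ Sign.+) (G yz Sign.+ Sign.-) (G yz Sign.- Sign.+) (G yz Sign.- Sign.-)
    (G xz Sign.+ Sign.+) (G xz Sign.+ Sign.-) (G xz Sign.- Sign.+) (G xz Sign.- Sign.-)
    (G xy Sign.+ Sign.+) (G xy Sign.+ Sign.-) (G xy Sign.- Sign.+) (G xy Sign.- Sign.-)

  module _ {x : ℤ³ → ℂ} {ρ : ℤ³ → Plane → ℂ} (root : IsRoot x ρ) (v : ℤ³) where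
    G : Plane → Sign → Sign → ℂ
    G P σ τ = ρ (v ⊕ lowestOf P σ τ) P

    facesAt : Octant → ℂ
    facesAt (σ₁ , σ₂ , σ₃) = G yz σ₂ σ₃ * G xz σ₁ σ₃ * G xy σ₁ σ₂

    -- A square term is the sum of the products over the two diagonals, whichever vertex comes
    -- first; the four sign patterns merely permute summands and factors.
    squareTerm≈ : ∀ P σ τ → squareTerm x v (P , σ , τ) ≈ G P σ τ * G P σ τ
    squareTerm≈ P σ τ = ≈-trans (reflexive (cong₂ (λ w w′ → x w * x w′ + x (v ⊕ ±e σ (axis₁ P)) * x (v ⊕ ±e τ (axis₂ P)))
        (sym (⊕-identityʳ v)) (⊕-assoc v (±e σ (axis₁ P)) (±e τ (axis₂ P)))))
      (≈-trans (turned-square P σ τ) (≈-sym (root-shift {x} {ρ} root v (lowestOf P σ τ) P)))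
      where
      X : ℤ³ → ℂ
      X c = x (v ⊕ c)
      swap⁺⁺ : ∀ a b c d → a * b + c * d ≈ a * b + c * d
      swap⁺⁺ _ _ _ _ = ≈-refl
      swap⁺⁻ : ∀ a b c d → a * b + c * d ≈ d * c + b * a
      swap⁺⁻ = solve 4 (λ a b c d → a :* b :+ c :* d := d :* c :+ b :* a) ≈-refl
      swap⁻⁺ : ∀ a b c d → a * b + c * d ≈ c * d + a * b
      swap⁻⁺ a b c d = +-comm _ _
      swap⁻⁻ : ∀ a b c d → a * b + c * d ≈ b * a + d * c
      swap⁻⁻ = solve 4 (λ a b c d → a :* b :+ c :* d := b :* a :+ d :* c) ≈-refl
      turned-square : ∀ P σ τ →
        X origin * X (±e σ (axis₁ P) ⊕ ±e τ (axis₂ P)) + X (±e σ (axis₁ P)) * X (±e τ (axis₂ P))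
        ≈ X (lowestOf P σ τ) * X (lowestOf P σ τ ⊕ e (axis₁ P) ⊕ e (axis₂ P)) + X (lowestOf P σ τ ⊕ e (axis₁ P)) * X (lowestOf P σ τ ⊕ e (axis₂ P))
      turned-square yz Sign.+ Sign.+ = swap⁺⁺ _ _ _ _
      turned-square yz Sign.+ Sign.- = swap⁺⁻ _ _ _ _
      turned-square yz Sign.- Sign.+ = swap⁻⁺ _ _ _ _
      turned-square yz Sign.- Sign.- = swap⁻⁻ _ _ _ _
      turned-square xz Sign.+ Sign.+ = swap⁺⁺ _ _ _ _
      turned-square xz Sign.+ Sign.- = swap⁺⁻ _ _ _ _
      turned-square xz Sign.- Sign.+ = swap⁻⁺ _ _ _ _
      turned-square xz Sign.- Sign.- = swap⁻⁻ _ _ _ _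
      turned-square xy Sign.+ Sign.+ = swap⁺⁺ _ _ _ _
      turned-square xy Sign.+ Sign.- = swap⁺⁻ _ _ _ _
      turned-square xy Sign.- Sign.+ = swap⁻⁺ _ _ _ _
      turned-square xy Sign.- Sign.- = swap⁻⁻ _ _ _ _

    module _ (ε : ℤ³ → Octant → Bool)
             (atCorner : ∀ u σ → AtCorner (cube x u) (face₁ ρ u) (face₂ ρ u) (face₃ ρ u) σ (ε u σ)) where

      KCv≈ : ∀ σ → KCv x v σ ≈ sg (ε (v ⊕ lowest σ) σ) * facesAt σ
      KCv≈ σ@(σ₁ , σ₂ , σ₃) = ≈-trans (KCv≈K x v σ) (≈-trans
        (K-cong {label x v σ} {turned σ (cube x (v ⊕ lowest σ))} λ i j k → reflexive (cong x (sym (trans (⊕-assoc v (lowest σ) _)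
          (cong (v ⊕_) (cong₂ _,_ (low-turn σ₁ i) (cong₂ _,_ (low-turn σ₂ j) (low-turn σ₃ k))))))))
        (≈-trans (atCorner (v ⊕ lowest σ) σ) (*-cong ≈-refl (*-cong (*-cong
          (reflexive (cong (λ w → ρ w yz) (shift _ (cong₂ _,_ (low-turn σ₁ 0F) (cong₂ _,_ (ℤₚ.+-identityʳ (low σ₂)) (ℤₚ.+-identityʳ (low σ₃)))))))
          (reflexive (cong (λ w → ρ w xz) (shift _ (cong₂ _,_ (ℤₚ.+-identityʳ (low σ₁)) (cong₂ _,_ (low-turn σ₂ 0F) (ℤₚ.+-identityʳ (low σ₃))))))))
          (reflexive (cong (λ w → ρ w xy) (shift _ (cong₂ _,_ (ℤₚ.+-identityʳ (low σ₁)) (cong₂ _,_ (ℤₚ.+-identityʳ (low σ₂)) (low-turn σ₃ 0F))))))))))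
        where
        shift : ∀ w {w′} → lowest σ ⊕ w ≡ w′ → v ⊕ lowest σ ⊕ w ≡ v ⊕ w′
        shift w eq = trans (⊕-assoc v (lowest σ) w) (cong (v ⊕_) eq)

      -- Kept general in the sign pattern: (b) takes `η`, and (a) takes `η` changed by an affine
      -- function in each cube, turning coherence into a parity condition.
      ∏-KCv : ∏ cubesAt (KCv x v) ≈ sg (⨁ cubesAt (λ σ → ε (v ⊕ lowest σ) σ)) * ∏ squaresAt (squareTerm x v)
      ∏-KCv = ≈-trans (∏-cong (KCv x v) (λ σ → sg (ε (v ⊕ lowest σ) σ) * facesAt σ) cubesAt KCv≈) (≈-trans
        (∏-* (λ σ → sg (ε (v ⊕ lowest σ) σ)) facesAt cubesAt)
        (*-cong (sg-⨁ (λ σ → ε (v ⊕ lowest σ) σ) cubesAt)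
          (≈-trans (∏-faces G) (≈-sym (∏-cong (squareTerm x v) (λ (P , σ , τ) → G P σ τ * G P σ τ) squaresAt
            (λ (P , σ , τ) → squareTerm≈ P σ τ))))))

open VertexStar

-- Differences and potentials over 𝔽₂ on ℤ³

module SignPotential where
  open import Data.Integer.Base using (+_; -[1+_])
  open xor-∧-Solver

  infixl 9 _⁻
  _⁻ : ℤ → ℤ
  i ⁻ = i ℤ.+ -1ℤ

  -[1+_]⁻ : ∀ n → -[1+ n ] ⁻ ≡ -[1+ suc n ]
  -[1+ n ]⁻ = cong (λ m → -[1+ suc m ]) (ℕₚ.+-identityʳ n)

  shift-invariant⇒constant : ∀ {A : Set} (φ : ℤ → A) → (∀ i → φ i ≡ φ (i ⁻)) → ∀ i → φ i ≡ φ 0ℤ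
  shift-invariant⇒constant φ inv (+ zero)      = refl
  shift-invariant⇒constant φ inv (+ suc n)     = trans (inv (+ suc n)) (shift-invariant⇒constant φ inv (+ n))
  shift-invariant⇒constant φ inv -[1+ zero ]   = sym (inv 0ℤ)
  shift-invariant⇒constant φ inv -[1+ suc n ]  =
    trans (sym (trans (inv -[1+ n ]) (cong φ -[1+ n ]⁻))) (shift-invariant⇒constant φ inv -[1+ n ])

  -- Normalised to vanish at 0. Modulo 2 there is no difference between adding and subtracting, so
  -- both directions accumulate with `_xor_`.
  antidifference : (ℤ → Bool) → ℤ → Bool
  antidifference c (+ zero)     = false
  antidifference c (+ suc n)    = c (+ n) xor antidifference c (+ n)
  antidifference c -[1+ zero ]  = c -[1+ zero ] xor false
  antidifference c -[1+ suc n ] = c -[1+ suc n ] xor antidifference c -[1+ n ]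

  xor-cancel : ∀ a b → a ≡ b xor (b xor a)
  xor-cancel = solve 2 (λ a b → a := b :+ (b :+ a)) refl

  antidifference-step : ∀ c i → antidifference c i ≡ c (i ⁻) xor antidifference c (i ⁻)
  antidifference-step c (+ zero)     = xor-cancel false (c -1ℤ)
  antidifference-step c (+ suc n)    = refl
  antidifference-step c -[1+ n ] = subst (λ i → antidifference c -[1+ n ] ≡ c i xor antidifference c i) (sym -[1+ n ]⁻)
    (xor-cancel (antidifference c -[1+ n ]) (c -[1+ suc n ]))

  antidifference-step⁺ : ∀ c i → antidifference c (i ℤ.+ 1ℤ) ≡ c i xor antidifference c i
  antidifference-step⁺ c i = subst (λ j → antidifference c (i ℤ.+ 1ℤ) ≡ c j xor antidifference c j)
    (trans (ℤₚ.+-assoc i 1ℤ -1ℤ) (ℤₚ.+-identityʳ i)) (antidifference-step c (i ℤ.+ 1ℤ))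

  xor-zero : ∀ {a b} → a xor b ≡ false → a ≡ b
  xor-zero {false} {false} _ = refl
  xor-zero {true}  {true}  _ = refl

  xor-same : ∀ {a b} → a ≡ b → a xor b ≡ false
  xor-same {false} refl = refl
  xor-same {true}  refl = refl

  Field : Set
  Field = ℤ → ℤ → ℤ → Bool

  D₁ D₂ D₃ : Field → Field
  D₁ φ a b c = φ a b c xor φ (a ⁻) b c
  D₂ φ a b c = φ a b c xor φ a (b ⁻) c
  D₃ φ a b c = φ a b c xor φ a b (c ⁻)

  -- The grouping exhibits f as a sum of three functions, the first without `a`, the second without
  -- `b`, the third without `c`. Subtracting the restriction to one coordinate plane at a time
  -- removes one difference operator at a time.
  inclusion-exclusion : ∀ (f : Field) → (∀ a b c → D₁ (D₂ (D₃ f)) a b c ≡ false) → ∀ a b c →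
    f a b c ≡ (f 0ℤ b c xor f 0ℤ 0ℤ c xor f 0ℤ b 0ℤ xor f 0ℤ 0ℤ 0ℤ) xor ((f a 0ℤ c xor f a 0ℤ 0ℤ) xor f a b 0ℤ)
  inclusion-exclusion f flat a b c = xor-zero (trans
    (solve 8 (λ x₁ x₂ x₃ x₄ x₅ x₆ x₇ x₈ →
        x₁ :+ ((x₂ :+ (x₃ :+ (x₄ :+ x₅))) :+ ((x₆ :+ x₇) :+ x₈))
        := ((x₁ :+ x₂) :+ (x₆ :+ x₃)) :+ ((x₈ :+ x₄) :+ (x₇ :+ x₅))) refl
      (f a b c) (f 0ℤ b c) (f 0ℤ 0ℤ c) (f 0ℤ b 0ℤ) (f 0ℤ 0ℤ 0ℤ) (f a 0ℤ c) (f a 0ℤ 0ℤ) (f a b 0ℤ))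
    (xor-same f″-constant))
    where
    f′ f″ : Field
    f′ a b c = f a b c xor f 0ℤ b c
    f″ a b c = f′ a b c xor f′ a 0ℤ c
    f′-flat : ∀ a b c → D₂ (D₃ f′) a b c ≡ false
    f′-flat a b c = trans
      (solve 8 (λ x₁ x₂ x₃ x₄ x₅ x₆ x₇ x₈ →
          ((x₁ :+ x₂) :+ (x₃ :+ x₄)) :+ ((x₅ :+ x₆) :+ (x₇ :+ x₈))
          := ((x₁ :+ x₃) :+ (x₅ :+ x₇)) :+ ((x₂ :+ x₄) :+ (x₆ :+ x₈))) refl
        (f a b c) (f 0ℤ b c) (f a b (c ⁻)) (f 0ℤ b (c ⁻)) (f a (b ⁻) c) (f 0ℤ (b ⁻) c) (f a (b ⁻) (c ⁻)) (f 0ℤ (b ⁻) (c ⁻)))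
      (xor-same (shift-invariant⇒constant (λ a → D₂ (D₃ f) a b c) (λ a → xor-zero (flat a b c)) a))
    f″-flat : ∀ a b c → D₃ f″ a b c ≡ false
    f″-flat a b c = trans
      (solve 4 (λ x₁ x₂ x₃ x₄ → (x₁ :+ x₂) :+ (x₃ :+ x₄) := (x₁ :+ x₃) :+ (x₂ :+ x₄)) refl
        (f′ a b c) (f′ a 0ℤ c) (f′ a b (c ⁻)) (f′ a 0ℤ (c ⁻)))
      (xor-same (shift-invariant⇒constant (λ b → D₃ f′ a b c) (λ b → xor-zero (f′-flat a b c)) b))
    f″-constant : f″ a b c ≡ f″ a b 0ℤ
    f″-constant = shift-invariant⇒constant (f″ a b) (λ c → xor-zero (f″-flat a b c)) c

  ⨁-cong : ∀ {A : Set} {s t : A → Bool} as → (∀ a → s a ≡ t a) → ⨁ as s ≡ ⨁ as t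
  ⨁-cong []       h = refl
  ⨁-cong (a ∷ as) h = cong₂ _xor_ (h a) (⨁-cong as h)

  down : Sign → ℤ → ℤ
  down Sign.+ i = i
  down Sign.- i = i ⁻

  down≡ : ∀ σ i → i ℤ.+ low σ ≡ down σ i
  down≡ Sign.+ i = ℤₚ.+-identityʳ i
  down≡ Sign.- i = refl

  D-antidifference : ∀ {s₁ s₂ s₃ s₄} k₁ k₂ k₃ k₄ t₁ t₂ t₃ t₄ → s₁ ≡ k₁ xor t₁ → s₂ ≡ k₂ xor t₂ → s₃ ≡ k₃ xor t₃ → s₄ ≡ k₄ xor t₄ →
    ((s₁ xor s₂) xor (s₃ xor s₄)) xor ((t₁ xor t₂) xor (t₃ xor t₄)) ≡ (k₁ xor k₂) xor (k₃ xor k₄)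
  D-antidifference k₁ k₂ k₃ k₄ t₁ t₂ t₃ t₄ refl refl refl refl =
    solve 8 (λ t₁ t₂ t₃ t₄ k₁ k₂ k₃ k₄ →
      (((k₁ :+ t₁) :+ (k₂ :+ t₂)) :+ ((k₃ :+ t₃) :+ (k₄ :+ t₄))) :+ ((t₁ :+ t₂) :+ (t₃ :+ t₄)) := (k₁ :+ k₂) :+ (k₃ :+ k₄)) refl
      t₁ t₂ t₃ t₄ k₁ k₂ k₃ k₄

  D-+ : ∀ (φ ψ : Field) i j k → D₁ (D₂ (D₃ (λ i j k → φ i j k xor ψ i j k))) i j k ≡ D₁ (D₂ (D₃ φ)) i j k xor D₁ (D₂ (D₃ ψ)) i j k
  D-+ φ ψ i j k = trans (cong₂ _xor_ (D₂₃ i) (D₂₃ (i ⁻)))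
    (solve 4 (λ a b c d → (a :+ b) :+ (c :+ d) := (a :+ c) :+ (b :+ d)) refl
      (D₂ (D₃ φ) i j k) (D₂ (D₃ ψ) i j k) (D₂ (D₃ φ) (i ⁻) j k) (D₂ (D₃ ψ) (i ⁻) j k))
    where
    D₂₃ : ∀ i → D₂ (D₃ (λ i j k → φ i j k xor ψ i j k)) i j k ≡ D₂ (D₃ φ) i j k xor D₂ (D₃ ψ) i j k
    D₂₃ i = solve 8 (λ a b c d a′ b′ c′ d′ → ((a :+ a′) :+ (b :+ b′)) :+ ((c :+ c′) :+ (d :+ d′))
        := ((a :+ b) :+ (c :+ d)) :+ ((a′ :+ b′) :+ (c′ :+ d′))) refl
      (φ i j k) (φ i j (k ⁻)) (φ i (j ⁻) k) (φ i (j ⁻) (k ⁻)) (ψ i j k) (ψ i j (k ⁻)) (ψ i (j ⁻) k) (ψ i (j ⁻) (k ⁻))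

  -- Differences commute: this makes the second one outermost, and `D-swap′` the third, so that it
  -- meets the antidifference in the same direction.
  D-swap : ∀ a b c d a′ b′ c′ d′ → ((a xor b) xor (c xor d)) xor ((a′ xor b′) xor (c′ xor d′))
                                 ≡ ((a xor b) xor (a′ xor b′)) xor ((c xor d) xor (c′ xor d′))
  D-swap = solve 8 (λ a b c d a′ b′ c′ d′ → ((a :+ b) :+ (c :+ d)) :+ ((a′ :+ b′) :+ (c′ :+ d′))
    := ((a :+ b) :+ (a′ :+ b′)) :+ ((c :+ d) :+ (c′ :+ d′))) refl

  D-swap′ : ∀ a b c d a′ b′ c′ d′ → ((a xor b) xor (c xor d)) xor ((a′ xor b′) xor (c′ xor d′))
                                  ≡ ((a xor c) xor (a′ xor c′)) xor ((b xor d) xor (b′ xor d′))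
  D-swap′ = solve 8 (λ a b c d a′ b′ c′ d′ → ((a :+ b) :+ (c :+ d)) :+ ((a′ :+ b′) :+ (c′ :+ d′))
    := ((a :+ c) :+ (a′ :+ c′)) :+ ((b :+ d) :+ (b′ :+ d′))) refl

  module Potential (c : ℤ³ → Affine)
                   (closed : ∀ v → ⨁ cubesAt (λ σ → η σ xor affine (c (v ⊕ lowest σ)) σ) ≡ false) where
    -- Any g with the required differences has the form gᵢ = Sᵢ + hᵢ, where hᵢ does not depend on
    -- coordinate i. The condition g₁ + g₂ + g₃ = c₀ becomes h₁ + h₂ + h₃ = `f`, which by
    -- `inclusion-exclusion` is solvable once the third mixed difference of `f` vanishes.
    c₀ c₁ c₂ c₃ S₁ S₂ S₃ f : Field
    c₀ i j k = proj₁ (c (i , j , k))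
    c₁ i j k = proj₁ (proj₂ (c (i , j , k)))
    c₂ i j k = proj₁ (proj₂ (proj₂ (c (i , j , k))))
    c₃ i j k = proj₂ (proj₂ (proj₂ (c (i , j , k))))
    S₁ i j k = antidifference (λ i → c₁ i j k) i
    S₂ i j k = antidifference (λ j → c₂ i j k) j
    S₃ i j k = antidifference (λ k → c₃ i j k) k
    f i j k = c₀ i j k xor (S₁ i j k xor (S₂ i j k xor S₃ i j k))

    -- The vertex has bit 1 along an axis exactly in the cubes shifted back along that axis. So `c₁`
    -- enters only at i - 1, which is also where the backward difference of `S₁` evaluates it, and
    -- likewise for the other axes. The six values `true` of η cancel.
    closed′ : ∀ i j k → D₁ (D₂ (D₃ c₀)) i j k xor (D₂ (D₃ c₁) (i ⁻) j k xor (D₁ (D₃ c₂) i (j ⁻) k xor D₁ (D₂ c₃) i j (k ⁻))) ≡ false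
    closed′ i j k = trans
      (solve 20 (λ x₁ x₂ x₃ x₄ x₅ x₆ x₇ x₈ p₁ p₂ p₃ p₄ q₁ q₂ q₃ q₄ r₁ r₂ r₃ r₄ →
          (((x₁ :+ x₂) :+ (x₃ :+ x₄)) :+ ((x₅ :+ x₆) :+ (x₇ :+ x₈)))
            :+ (((p₁ :+ p₂) :+ (p₃ :+ p₄)) :+ (((q₁ :+ q₂) :+ (q₃ :+ q₄)) :+ ((r₁ :+ r₂) :+ (r₃ :+ r₄))))
          := (F :+ ((x₁ :+ F) :+ (F :+ F))) :+ ((T :+ ((x₂ :+ F) :+ (F :+ r₁))) :+ ((T :+ ((x₃ :+ F) :+ (q₁ :+ F)))
             :+ ((T :+ ((x₄ :+ F) :+ (q₂ :+ r₂))) :+ ((T :+ ((x₅ :+ p₁) :+ (F :+ F))) :+ ((T :+ ((x₆ :+ p₂) :+ (F :+ r₃)))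
             :+ ((T :+ ((x₇ :+ p₃) :+ (q₃ :+ F))) :+ ((F :+ ((x₈ :+ p₄) :+ (q₄ :+ r₄))) :+ F)))))))) refl
        (c₀ i j k) (c₀ i j (k ⁻)) (c₀ i (j ⁻) k) (c₀ i (j ⁻) (k ⁻))
        (c₀ (i ⁻) j k) (c₀ (i ⁻) j (k ⁻)) (c₀ (i ⁻) (j ⁻) k) (c₀ (i ⁻) (j ⁻) (k ⁻))
        (c₁ (i ⁻) j k) (c₁ (i ⁻) j (k ⁻)) (c₁ (i ⁻) (j ⁻) k) (c₁ (i ⁻) (j ⁻) (k ⁻))
        (c₂ i (j ⁻) k) (c₂ i (j ⁻) (k ⁻)) (c₂ (i ⁻) (j ⁻) k) (c₂ (i ⁻) (j ⁻) (k ⁻))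
        (c₃ i j (k ⁻)) (c₃ i (j ⁻) (k ⁻)) (c₃ (i ⁻) j (k ⁻)) (c₃ (i ⁻) (j ⁻) (k ⁻)))
      (trans (sym (⨁-cong {s = λ σ → η σ xor affine (c ((i , j , k) ⊕ lowest σ)) σ}
          {t = λ σ → η σ xor affine (c (down (proj₁ σ) i , down (proj₁ (proj₂ σ)) j , down (proj₂ (proj₂ σ)) k)) σ} cubesAt
          λ σ@(σ₁ , σ₂ , σ₃) → cong (λ w → η σ xor affine (c w) σ) (cong₂ _,_ (down≡ σ₁ i) (cong₂ _,_ (down≡ σ₂ j) (down≡ σ₃ k)))))
        (closed (i , j , k)))
      where
      T F : ∀ {n} → Polynomial n
      T = con true
      F = con false

    flat : ∀ i j k → D₁ (D₂ (D₃ f)) i j k ≡ false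
    flat i j k = trans (D-+ c₀ (λ i j k → S₁ i j k xor (S₂ i j k xor S₃ i j k)) i j k)
      (trans (cong (D₁ (D₂ (D₃ c₀)) i j k xor_) (trans (D-+ S₁ (λ i j k → S₂ i j k xor S₃ i j k) i j k)
        (cong₂ _xor_ DS₁ (trans (D-+ S₂ S₃ i j k) (cong₂ _xor_ DS₂ DS₃)))))
      (closed′ i j k))
      where
      step₁ : ∀ j k → S₁ i j k ≡ c₁ (i ⁻) j k xor S₁ (i ⁻) j k
      step₁ j k = antidifference-step (λ i → c₁ i j k) i
      step₂ : ∀ i k → S₂ i j k ≡ c₂ i (j ⁻) k xor S₂ i (j ⁻) k
      step₂ i k = antidifference-step (λ j → c₂ i j k) j
      step₃ : ∀ i j → S₃ i j k ≡ c₃ i j (k ⁻) xor S₃ i j (k ⁻)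
      step₃ i j = antidifference-step (λ k → c₃ i j k) k
      DS₁ : D₁ (D₂ (D₃ S₁)) i j k ≡ D₂ (D₃ c₁) (i ⁻) j k
      DS₁ = D-antidifference (c₁ (i ⁻) j k) (c₁ (i ⁻) j (k ⁻)) (c₁ (i ⁻) (j ⁻) k) (c₁ (i ⁻) (j ⁻) (k ⁻))
        (S₁ (i ⁻) j k) (S₁ (i ⁻) j (k ⁻)) (S₁ (i ⁻) (j ⁻) k) (S₁ (i ⁻) (j ⁻) (k ⁻))
        (step₁ j k) (step₁ j (k ⁻)) (step₁ (j ⁻) k) (step₁ (j ⁻) (k ⁻))
      DS₂ : D₁ (D₂ (D₃ S₂)) i j k ≡ D₁ (D₃ c₂) i (j ⁻) k
      DS₂ = trans (D-swap (S₂ i j k) (S₂ i j (k ⁻)) (S₂ i (j ⁻) k) (S₂ i (j ⁻) (k ⁻))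
          (S₂ (i ⁻) j k) (S₂ (i ⁻) j (k ⁻)) (S₂ (i ⁻) (j ⁻) k) (S₂ (i ⁻) (j ⁻) (k ⁻)))
        (D-antidifference (c₂ i (j ⁻) k) (c₂ i (j ⁻) (k ⁻)) (c₂ (i ⁻) (j ⁻) k) (c₂ (i ⁻) (j ⁻) (k ⁻))
          (S₂ i (j ⁻) k) (S₂ i (j ⁻) (k ⁻)) (S₂ (i ⁻) (j ⁻) k) (S₂ (i ⁻) (j ⁻) (k ⁻))
          (step₂ i k) (step₂ i (k ⁻)) (step₂ (i ⁻) k) (step₂ (i ⁻) (k ⁻)))
      DS₃ : D₁ (D₂ (D₃ S₃)) i j k ≡ D₁ (D₂ c₃) i j (k ⁻)
      DS₃ = trans (D-swap′ (S₃ i j k) (S₃ i j (k ⁻)) (S₃ i (j ⁻) k) (S₃ i (j ⁻) (k ⁻))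
          (S₃ (i ⁻) j k) (S₃ (i ⁻) j (k ⁻)) (S₃ (i ⁻) (j ⁻) k) (S₃ (i ⁻) (j ⁻) (k ⁻)))
        (D-antidifference (c₃ i j (k ⁻)) (c₃ i (j ⁻) (k ⁻)) (c₃ (i ⁻) j (k ⁻)) (c₃ (i ⁻) (j ⁻) (k ⁻))
          (S₃ i j (k ⁻)) (S₃ i (j ⁻) (k ⁻)) (S₃ (i ⁻) j (k ⁻)) (S₃ (i ⁻) (j ⁻) (k ⁻))
          (step₃ i j) (step₃ i (j ⁻)) (step₃ (i ⁻) j) (step₃ (i ⁻) (j ⁻)))

    g : ℤ³ → Plane → Bool
    g (i , j , k) yz = S₁ i j k xor (f 0ℤ j k xor f 0ℤ 0ℤ k xor f 0ℤ j 0ℤ xor f 0ℤ 0ℤ 0ℤ)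
    g (i , j , k) xz = S₂ i j k xor (f i 0ℤ k xor f i 0ℤ 0ℤ)
    g (i , j , k) xy = S₃ i j k xor f i j 0ℤ

    g-sum : ∀ i j k → c₀ i j k ≡ g (i , j , k) yz xor (g (i , j , k) xz xor g (i , j , k) xy)
    g-sum i j k = trans (xor-cancel (c₀ i j k) (S₁ i j k xor (S₂ i j k xor S₃ i j k))) (trans
      (cong ((S₁ i j k xor (S₂ i j k xor S₃ i j k)) xor_) (trans
        (𝔹ₚ.xor-comm (S₁ i j k xor (S₂ i j k xor S₃ i j k)) (c₀ i j k)) (inclusion-exclusion f flat i j k)))
      (regroup (S₁ i j k) (S₂ i j k) (S₃ i j k) (f 0ℤ j k xor f 0ℤ 0ℤ k xor f 0ℤ j 0ℤ xor f 0ℤ 0ℤ 0ℤ)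
        (f i 0ℤ k xor f i 0ℤ 0ℤ) (f i j 0ℤ)))
      where
      regroup : ∀ a b c d e f → (a xor (b xor c)) xor (d xor (e xor f)) ≡ (a xor d) xor ((b xor e) xor (c xor f))
      regroup = solve 6 (λ a b c d e f → (a :+ (b :+ c)) :+ (d :+ (e :+ f)) := (a :+ d) :+ ((b :+ e) :+ (c :+ f))) refl

    faceSign₁ faceSign₂ faceSign₃ : ℤ³ → Fin 2 → Bool
    faceSign₁ u i = g (u ⊕ (Sign.+ ◃ toℕ i , 0ℤ , 0ℤ)) yz
    faceSign₂ u i = g (u ⊕ (0ℤ , Sign.+ ◃ toℕ i , 0ℤ)) xz
    faceSign₃ u i = g (u ⊕ (0ℤ , 0ℤ , Sign.+ ◃ toℕ i)) xy

    g-step₁ : ∀ i j k m → faceSign₁ (i , j , k) m ≡ (bit m ∧ c₁ i j k) xor g (i , j , k) yz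
    g-step₁ i j k 0F = cong (λ w → g w yz) (⊕-identityʳ (i , j , k))
    g-step₁ i j k 1F = trans (cong₂ (λ j k → g (i ℤ.+ 1ℤ , j , k) yz) (ℤₚ.+-identityʳ j) (ℤₚ.+-identityʳ k))
      (trans (cong (_xor (f 0ℤ j k xor f 0ℤ 0ℤ k xor f 0ℤ j 0ℤ xor f 0ℤ 0ℤ 0ℤ)) (antidifference-step⁺ (λ i → c₁ i j k) i))
        (𝔹ₚ.xor-assoc (c₁ i j k) (S₁ i j k) _))

    g-step₂ : ∀ i j k m → faceSign₂ (i , j , k) m ≡ (bit m ∧ c₂ i j k) xor g (i , j , k) xz
    g-step₂ i j k 0F = cong (λ w → g w xz) (⊕-identityʳ (i , j , k))
    g-step₂ i j k 1F = trans (cong₂ (λ i k → g (i , j ℤ.+ 1ℤ , k) xz) (ℤₚ.+-identityʳ i) (ℤₚ.+-identityʳ k))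
      (trans (cong (_xor (f i 0ℤ k xor f i 0ℤ 0ℤ)) (antidifference-step⁺ (λ j → c₂ i j k) j))
        (𝔹ₚ.xor-assoc (c₂ i j k) (S₂ i j k) _))

    g-step₃ : ∀ i j k m → faceSign₃ (i , j , k) m ≡ (bit m ∧ c₃ i j k) xor g (i , j , k) xy
    g-step₃ i j k 0F = cong (λ w → g w xy) (⊕-identityʳ (i , j , k))
    g-step₃ i j k 1F = trans (cong₂ (λ i j → g (i , j , k ℤ.+ 1ℤ) xy) (ℤₚ.+-identityʳ i) (ℤₚ.+-identityʳ j))
      (trans (cong (_xor f i j 0ℤ) (antidifference-step⁺ (λ k → c₃ i j k) k))
        (𝔹ₚ.xor-assoc (c₃ i j k) (S₃ i j k) _))

    -- At the lowest vertex the three face signs add up to c₀, and passing to the opposite face in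
    -- direction i adds cᵢ; hence one global g corrects all cubes at once.
    affine≡total : ∀ u σ → affine (c u) σ ≡ total (faceSign₁ u) (faceSign₂ u) (faceSign₃ u) σ
    affine≡total u@(i , j , k) (σ₁ , σ₂ , σ₃) = trans
      (cong (λ a → (a xor p₁) xor (p₂ xor p₃)) (g-sum i j k))
      (trans (regroup (g u yz) (g u xz) (g u xy) p₁ p₂ p₃)
        (sym (cong₂ _xor_ (g-step₁ i j k (turn σ₁ 0F)) (cong₂ _xor_ (g-step₂ i j k (turn σ₂ 0F)) (g-step₃ i j k (turn σ₃ 0F))))))
      where
      p₁ p₂ p₃ : Bool
      p₁ = bit (turn σ₁ 0F) ∧ c₁ i j k
      p₂ = bit (turn σ₂ 0F) ∧ c₂ i j k
      p₃ = bit (turn σ₃ 0F) ∧ c₃ i j k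
      regroup : ∀ a b c p q r → ((a xor (b xor c)) xor p) xor (q xor r) ≡ (p xor a) xor ((q xor b) xor (r xor c))
      regroup = solve 6 (λ a b c p q r → ((a :+ (b :+ c)) :+ p) :+ (q :+ r) := (p :+ a) :+ ((q :+ b) :+ (r :+ c))) refl

open SignPotential

-- From cubes to arrays: the two directions of the theorem

module Correspondence where
  open ℂSolver

  HexahedronAt : (ℤ³ → ℂ) → (ℤ³ → Plane → ℂ) → ℤ³ → Set
  HexahedronAt x ρ u = Hexahedron (cube x u) (face₁ ρ u) (face₂ ρ u) (face₃ ρ u)

  module KHexahedron {x̃ : L → ℂ} {x̃#0 : ∀ v → x̃ (vertex v) #0} where
    x : ℤ³ → ℂ
    x = x̃ ∘ vertex
    ρ : ℤ³ → Plane → ℂ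
    ρ v P = x̃ (center v P)

    fromKHexahedron : IsKHexahedron x̃ x̃#0 → ∀ u → HexahedronAt x ρ u
    fromKHexahedron H u = record
      { squares = squares-at {x} {ρ} square u
      -- The equations mention `u`, whereas the cube and its faces are indexed by `u ⊕ origin`,
      -- which is equal to it only propositionally.
      ; opp₁ = subst (λ w → x w * ρ (u ⊕ e 0F) yz ≈ ρ w xz * ρ w xy + ρ w yz * z u 1F 0F 0F) u≡ (≈/⇒*≈ (x u) (x̃#0 u) (opposite-yz u))
      ; opp₂ = subst (λ w → x w * ρ (u ⊕ e 1F) xz ≈ ρ w yz * ρ w xy + ρ w xz * z u 0F 1F 0F) u≡ (≈/⇒*≈ (x u) (x̃#0 u) (opposite-xz u))
      ; opp₃ = subst (λ w → x w * ρ (u ⊕ e 2F) xy ≈ ρ w yz * ρ w xz + ρ w xy * z u 0F 0F 1F) u≡ (≈/⇒*≈ (x u) (x̃#0 u) (opposite-xy u))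
      ; K≈   = combine (½ℂ · subst (λ w → x w * x w * h ≈ 2ℂ * (b₁ * b₂ * b₃) + x w * (b₁ * d₁ + b₂ * d₂ + b₃ * d₃) + 2ℂ * (ρ w yz * ρ w xz * ρ w xy)) u≡
                          (≈/⇒*≈ (x u * x u) (#0-* {x u} {x u} (x̃#0 u) (x̃#0 u)) (opposite-vertex u)))
          (solve 11 (λ a b₁ b₂ b₃ d₁ d₂ d₃ h p q r →
            Kᵖ a b₁ b₂ b₃ d₁ d₂ d₃ h :+ con ½ :* (2ᵖ :* (b₁ :* b₂ :* b₃) :+ a :* (b₁ :* d₁ :+ b₂ :* d₂ :+ b₃ :* d₃) :+ 2ᵖ :* (p :* q :* r))
            := p :* q :* r :+ con ½ :* (a :* a :* h)) ≈-refl
            (z u 0F 0F 0F) b₁ b₂ b₃ d₁ d₂ d₃ h (face₁ ρ u 0F) (face₂ ρ u 0F) (face₃ ρ u 0F))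
      }
      where
      open IsKHexahedron H
      u≡ : u ≡ u ⊕ origin
      u≡ = sym (⊕-identityʳ u)
      b₁ b₂ b₃ d₁ d₂ d₃ h : ℂ
      b₁ = z u 1F 0F 0F
      b₂ = z u 0F 1F 0F
      b₃ = z u 0F 0F 1F
      d₁ = z u 0F 1F 1F
      d₂ = z u 1F 0F 1F
      d₃ = z u 1F 1F 0F
      h = z u 1F 1F 1F

    toKHexahedron : IsRoot x ρ → (∀ u → HexahedronAt x ρ u) → IsKHexahedron x̃ x̃#0
    toKHexahedron root H = record
      { square = root
      ; opposite-yz = λ u → *≈⇒≈/ (x u) (x̃#0 u) (subst (λ w → x w * ρ (u ⊕ e 0F) yz ≈ ρ w xz * ρ w xy + ρ w yz * z u 1F 0F 0F) (⊕-identityʳ u) (Hexahedron.opp₁ (H u)))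
      ; opposite-xz = λ u → *≈⇒≈/ (x u) (x̃#0 u) (subst (λ w → x w * ρ (u ⊕ e 1F) xz ≈ ρ w yz * ρ w xy + ρ w xz * z u 0F 1F 0F) (⊕-identityʳ u) (Hexahedron.opp₂ (H u)))
      ; opposite-xy = λ u → *≈⇒≈/ (x u) (x̃#0 u) (subst (λ w → x w * ρ (u ⊕ e 2F) xy ≈ ρ w yz * ρ w xz + ρ w xy * z u 0F 0F 1F) (⊕-identityʳ u) (Hexahedron.opp₃ (H u)))
      ; opposite-vertex = λ u → *≈⇒≈/ (x u * x u) (#0-* {x u} {x u} (x̃#0 u) (x̃#0 u)) (top u)
      }
      where
      z : ℤ³ → Cube
      z = cube x
      top : ∀ u → x u * x u * z u 1F 1F 1F
        ≈ 2ℂ * (z u 1F 0F 0F * z u 0F 1F 0F * z u 0F 0F 1F)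
          + x u * (z u 1F 0F 0F * z u 0F 1F 1F + z u 0F 1F 0F * z u 1F 0F 1F + z u 0F 0F 1F * z u 1F 1F 0F)
          + 2ℂ * (ρ u yz * ρ u xz * ρ u xy)
      top u = subst (λ w → x w * x w * h ≈ 2ℂ * (b₁ * b₂ * b₃) + x w * (b₁ * d₁ + b₂ * d₂ + b₃ * d₃) + 2ℂ * (ρ w yz * ρ w xz * ρ w xy)) (⊕-identityʳ u)
        (combine (2ℂ · Hexahedron.K≈ (H u)) (solve 11 (λ a b₁ b₂ b₃ d₁ d₂ d₃ h p q r →
            a :* a :* h :+ 2ᵖ :* (p :* q :* r)
            := 2ᵖ :* (b₁ :* b₂ :* b₃) :+ a :* (b₁ :* d₁ :+ b₂ :* d₂ :+ b₃ :* d₃) :+ 2ᵖ :* (p :* q :* r) :+ 2ᵖ :* Kᵖ a b₁ b₂ b₃ d₁ d₂ d₃ h) ≈-refl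
            (z u 0F 0F 0F) b₁ b₂ b₃ d₁ d₂ d₃ h (face₁ ρ u 0F) (face₂ ρ u 0F) (face₃ ρ u 0F)))
        where
        b₁ b₂ b₃ d₁ d₂ d₃ h : ℂ
        b₁ = z u 1F 0F 0F
        b₂ = z u 0F 1F 0F
        b₃ = z u 0F 0F 1F
        d₁ = z u 0F 1F 1F
        d₂ = z u 1F 0F 1F
        d₃ = z u 1F 1F 0F
        h = z u 1F 1F 1F

  open KHexahedron using (fromKHexahedron; toKHexahedron)

  restriction-coherent : (x̃ : L → ℂ) (x̃#0 : ∀ v → x̃ (vertex v) #0) → IsKHexahedron x̃ x̃#0 → IsCoherentSolution (x̃ ∘ vertex)
  restriction-coherent x̃ x̃#0 H = record
    { kashaev   = λ v → ≈-trans (KC≈kashaev (x̃ ∘ vertex) v) (hex⇒kashaev (x̃#0 _) (hex v))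
    ; coherence = λ v → ≈-trans
        (∏-KCv {x̃ ∘ vertex} {λ v P → x̃ (center v P)} (IsKHexahedron.square H) v (λ _ → η) (λ u → corners (λ _ _ _ → x̃#0 _) (hex u)))
        -- Six of the eight values of `η` are `true`, so the sign in front evaluates to 1.
        (*-identityˡ _)
    }
    where
    hex : ∀ u → HexahedronAt (x̃ ∘ vertex) (λ v P → x̃ (center v P)) u
    hex = fromKHexahedron {x̃} {x̃#0} H

  ∏-#0 : ∀ {A : Set} (f : A → ℂ) as → (∀ a → f a #0) → ∏ as f #0
  ∏-#0 f []       h = 1ℚ , from-yes (0ℚ ℚₚ.<? 1ℚ) , 0 , λ _ _ → from-yes (1ℚ ℚₚ.≤? Q.∣ seq (normSq 1ℂ) 0 ∣)
  ∏-#0 f (a ∷ as) h = #0-* {f a} {∏ as f} (h a) (∏-#0 f as h)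

  -- A negative sign would give 2z = 0. This is where an equation between complex products becomes a
  -- parity condition, and why the product of the square terms must be apart from 0.
  sg-trivial : ∀ s {z} → z #0 → z ≈ sg s * z → s ≡ false
  sg-trivial false     z#0 e = refl
  sg-trivial true  {z} z#0 e = ⊥-elim (#0⇒≉0 {2ℂ * z} (#0-* {2ℂ} {z} 2#0 z#0) (combine e
    (solve 1 (λ z → 2ᵖ :* z :+ (:- con 1ℚ) :* z := con 0ℚ :+ z) ≈-refl z)))

  module _ (x : ℤ³ → ℂ) (x#0 : ∀ v → x v #0) (ρ : ℤ³ → Plane → ℂ) (root : IsRoot x ρ) (T#0 : ∀ v P → squareTerm⁺ x v P #0) where
    ρ²#0 : ∀ v P → (ρ v P * ρ v P) #0
    ρ²#0 v P = #0-cong {squareTerm⁺ x v P} {ρ v P * ρ v P} (≈-sym (root v P)) (T#0 v P)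

    squares-#0 : ∀ v → ∏ squaresAt (squareTerm x v) #0
    squares-#0 v = ∏-#0 (squareTerm x v) squaresAt λ (P , σ , τ) →
      #0-cong {G {x} {ρ} root v P σ τ * G {x} {ρ} root v P σ τ} {squareTerm x v (P , σ , τ)}
        (≈-sym (squareTerm≈ {x} {ρ} root v P σ τ)) (ρ²#0 (v ⊕ lowestOf P σ τ) P)

    module _ (coherence : ∀ v → ∏ cubesAt (KCv x v) ≈ ∏ squaresAt (squareTerm x v))
             (signs : ∀ u → ∃ λ c → ∀ σ → AtCorner (cube x u) (face₁ ρ u) (face₂ ρ u) (face₃ ρ u) σ (η σ xor affine c σ)) where

      c : ℤ³ → Affine
      c u = proj₁ (signs u)

      atCorner : ∀ u σ → AtCorner (cube x u) (face₁ ρ u) (face₂ ρ u) (face₃ ρ u) σ (η σ xor affine (c u) σ)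
      atCorner u = proj₂ (signs u)

      closed : ∀ v → ⨁ cubesAt (λ σ → η σ xor affine (c (v ⊕ lowest σ)) σ) ≡ false
      closed v = sg-trivial _ {∏ squaresAt (squareTerm x v)} (squares-#0 v)
        (≈-trans (≈-sym (coherence v)) (∏-KCv {x} {ρ} root v (λ u σ → η σ xor affine (c u) σ) atCorner))

      open Potential c closed

      extension : L → ℂ
      extension (vertex v)   = x v
      extension (center v P) = sg (g v P) * ρ v P

      extension-isKHexahedron : IsKHexahedron extension x#0
      extension-isKHexahedron = toKHexahedron {extension} {x#0}
        (λ v P → ≈-trans (⊙² (g v P) (ρ v P)) (root v P))
        (λ u → hex-intro
          (nonZero²-⊙ {face₁ ρ u} (faceSign₁ u) (λ _ → ρ²#0 _ yz))
          (nonZero²-⊙ {face₂ ρ u} (faceSign₂ u) (λ _ → ρ²#0 _ xz))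
          (nonZero²-⊙ {face₃ ρ u} (faceSign₃ u) (λ _ → ρ²#0 _ xy))
          (squares-⊙ (faceSign₁ u) (faceSign₂ u) (faceSign₃ u) (squares-at {x} {ρ} root u))
          (at u (Sign.+ , Sign.+ , Sign.+)) (at u (Sign.- , Sign.+ , Sign.+))
          (at u (Sign.+ , Sign.- , Sign.+)) (at u (Sign.+ , Sign.+ , Sign.-)))
        where
        at : ∀ u σ → AtCorner (cube x u) (faceSign₁ u ⊙ face₁ ρ u) (faceSign₂ u ⊙ face₂ ρ u) (faceSign₃ u ⊙ face₃ ρ u) σ (η σ)
        at u σ = atCorner-⊙ {cube x u} {face₁ ρ u} {face₂ ρ u} {face₃ ρ u} (faceSign₁ u) (faceSign₂ u) (faceSign₃ u) σ
          (η σ xor affine (c u) σ) (η σ) (cong (η σ xor_) (affine≡total u σ)) (atCorner u σ)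

  axes-distinct : ∀ P → axis₁ P ≢ axis₂ P
  axes-distinct yz ()
  axes-distinct xz ()
  axes-distinct xy ()

  extend : (x : ℤ³ → ℂ) →
    (∀ v → x v #0) →
    IsCoherentSolution x →
    (∀ v (i j : Fin 3) → i ≢ j → (x v * x (v ⊕ e i ⊕ e j) + x (v ⊕ e i) * x (v ⊕ e j)) #0) →
    Σ (L → ℂ) λ x̃ → (∀ v → x̃ (vertex v) ≈ x v) × Σ (∀ v → x̃ (vertex v) #0) λ x̃#0 → IsKHexahedron x̃ x̃#0
  extend x x#0 coherent T#0 = extension x x#0 ρ root T#0′ coherence signs-at
    , (λ v → ≈-refl) , x#0 , extension-isKHexahedron x x#0 ρ root T#0′ coherence signs-at
    where
    open IsCoherentSolution coherent renaming (kashaev to KC≈0)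
    T#0′ : ∀ v P → squareTerm⁺ x v P #0
    T#0′ v P = T#0 v (axis₁ P) (axis₂ P) (axes-distinct P)
    ρ : ℤ³ → Plane → ℂ
    ρ v P = proj₁ (sqrt {squareTerm⁺ x v P} (T#0′ v P))
    root : IsRoot x ρ
    root v P = proj₂ (sqrt {squareTerm⁺ x v P} (T#0′ v P))
    signs-at : ∀ u → ∃ λ c → ∀ σ → AtCorner (cube x u) (face₁ ρ u) (face₂ ρ u) (face₃ ρ u) σ (η σ xor affine c σ)
    signs-at u = affine-signs (λ _ _ _ → x#0 _)
      (λ _ → ρ²#0 x x#0 ρ root T#0′ _ yz) (λ _ → ρ²#0 x x#0 ρ root T#0′ _ xz) (λ _ → ρ²#0 x x#0 ρ root T#0′ _ xy)
      (squares-at {x} {ρ} root u) (≈-trans (≈-sym (KC≈kashaev x u)) (KC≈0 u))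

open Correspondence

theorem2p22 : ((x : ℤ³ → ℂ) →
    (∀ v → x v #0) →
    IsCoherentSolution x →
    (∀ v (i j : Fin 3) → i ≢ j → (x v * x (v ⊕ e i ⊕ e j) + x (v ⊕ e i) * x (v ⊕ e j)) #0) →
    Σ (L → ℂ) λ x̃ → (∀ v → x̃ (vertex v) ≈ x v) × Σ (∀ v → x̃ (vertex v) #0) λ x̃#0 → IsKHexahedron x̃ x̃#0)
    × ((x̃ : L → ℂ) (x̃#0 : ∀ v → x̃ (vertex v) #0) →
    IsKHexahedron x̃ x̃#0 →
    IsCoherentSolution (x̃ ∘ vertex))
theorem2p22 = extend , restriction-coherent
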